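{- Let $p$ be a prime with $p \equiv 2 \pmod 3$ (the case $p=2$ is included), let $s,m$ be positive integers, $q=p^s$, $r=q^m$, and let $\alpha$ be a generator of $\mathrm{GF}(r)^*$. Let $h$ be a positive divisor of $q-1$, and let $e=3$, where it is assumed that $3 \mid \gcd(q-1,hm)$. Put $g=\alpha^{(q-1)/h}$, $n=\frac{h(r-1)}{q-1}$, $\beta=\alpha^{(r-1)/3}$, and assume that $N:=\gcd\left(\frac{r-1}{q-1},\frac{3(q-1)}{h}\right)=3$. Let $\mathrm{Tr}$ denote the trace map from $\mathrm{GF}(r)$ to $\mathrm{GF}(q)$ and consider the cyclic code $\mathcal{C}=\{\mathbf{c}_{(a,b)} : a,b\in \mathrm{GF}(r)\}$ over $\mathrm{GF}(q)$ of length $n$, where $\mathbf{c}_{(a,b)}=\left(\mathrm{Tr}(ag^i+b(\beta g)^i)\right)_{i=0}^{n-1}$. For $(a,b)\in\mathrm{GF}(r)^2$ define the modified weight $\lambda(a,b)=\frac{h(r-1)}{q}-w(\mathbf{c}_{(a,b)})$, where $w$ is the Hamming weight. (Here $s$ is even, so $ms/2$ is an integer, and $\sqrt r=p^{ms/2}$.) Write $\varepsilon=(-1)^{ms/2}$. (1) If $3 \mid \frac{q-1}{h}$, then as $(a,b)$ ranges over $\mathrm{GF}(r)^2$, the values of $\lambda(a,b)$ are distributed as follows (value: number of pairs $(a,b)$; if two listed values coincide, their numbers are added): $-\frac{h}{q}(2\varepsilon\sqrt r+1)$: $\frac{r-1}{27}(r-8-2\varepsilon\sqrt r)$; $\frac{h}{q}(\varepsilon\sqrt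 r-1)$: $\frac{2(r-1)}{27}(4r-14+\varepsilon\sqrt r)$; $-\frac{h}{q}(\varepsilon\sqrt r+1)$: $\frac{2(r-1)}{9}(r-2+\varepsilon\sqrt r)$; $-\frac{h}{q}$: $\frac{2(r-1)}{9}(2r-1-\varepsilon\sqrt r)$; $\frac{h}{3q}(r-4\varepsilon\sqrt r-3)$: $r-1$; $\frac{h}{3q}(r+2\varepsilon\sqrt r-3)$: $2(r-1)$; $\frac{h(r-1)}{q}$: $1$. (2) If $3 \nmid \frac{q-1}{h}$, then the values of $\lambda(a,b)$ are distributed as follows (with the same convention): $-\frac{h}{q}(2\varepsilon\sqrt r+1)$: $\frac{r-1}{27}(r+1-2\varepsilon\sqrt r)$; $\frac{h}{q}(\varepsilon\sqrt r-1)$: $\frac{2(r-1)}{27}(4r-5+\varepsilon\sqrt r)$; $-\frac{h}{q}(\varepsilon\sqrt r+1)$: $\frac{2(r-1)}{9}(r-2+\varepsilon\sqrt r)$; $-\frac{h}{q}$: $\frac{r-1}{9}(4r-11-2\varepsilon\sqrt r)$; $\frac{h}{3q}(r+2\varepsilon\sqrt r-3)$: $r-1$; $\frac{h}{3q}(r-\varepsilon\sqrt r-3)$: $2(r-1)$; $\frac{h(r-1)}{q}$: $1$.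
   Context: The Hamming weight of a vector is its number of nonzero coordinates. The "modified weight distribution" lists, for each value $v$, the number of pairs $(a,b)\in\mathrm{GF}(r)^2$ with $\lambda(a,b)=v$. -}

module Defs where

open import Level using (0ℓ)
open import Data.Nat as ℕ using (ℕ; zero; suc)
open import Data.Nat.DivMod using (_/_; _%_)
open import Data.Integer as ℤ using (ℤ; +_)
open import Data.List using (List; []; _∷_; length; filter; map; foldr; upTo; cartesianProduct)
open import Data.List.Membership.Propositional using (_∈_)
open import Data.List.Relation.Unary.Unique.Propositional using (Unique)
open import Data.Product using (_×_; _,_; proj₁; proj₂; Σ)
open import Relation.Nullary using (¬_; Dec; yes; no)
open import Relation.Nullary.Decidable using (¬?)
open import Relation.Binary.Definitions using (DecidableEquality)
open import Relation.Binary.PropositionalEquality using (_≡_)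
open import Algebra.Structures using (IsCommutativeRing)

record FiniteField : Set₁ where
  field
    Carrier  : Set
    _+_ _*_  : Carrier → Carrier → Carrier
    -_       : Carrier → Carrier
    0# 1#    : Carrier
    isCommutativeRing : IsCommutativeRing _≡_ _+_ _*_ -_ 0# 1#
    1≢0      : ¬ (1# ≡ 0#)
    inverse  : ∀ x → ¬ (x ≡ 0#) → Σ Carrier (λ y → x * y ≡ 1#)
    _≟_      : DecidableEquality Carrier
    elements : List Carrier
    complete : ∀ x → x ∈ elements
    unique   : Unique elements

  order : ℕ
  order = length elements

  _^_ : Carrier → ℕ → Carrier
  x ^ zero  = 1#
  x ^ suc k = x * (x ^ k)

  IsPrimitive : Carrier → Set
  IsPrimitive α = ¬ (α ≡ 0#) × (∀ x → ¬ (x ≡ 0#) → Σ ℕ (λ k → α ^ k ≡ x))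

  sumF : List Carrier → Carrier
  sumF = foldr _+_ 0#

  trace : (q m : ℕ) → Carrier → Carrier
  trace q m x = sumF (map (λ j → x ^ (q ℕ.^ j)) (upTo m))

  codewordWeight : (q m n : ℕ) → (g β a b : Carrier) → ℕ
  codewordWeight q m n g β a b =
    length (filter (λ i → ¬? (trace q m ((a * (g ^ i)) + (b * ((β * g) ^ i))) ≟ 0#)) (upTo n))

  -- 3q·λ(a,b) = 3h(r-1) - 3q·w(c_(a,b))   (scaled by 3q to stay in ℤ)
  scaledLambda : (q m n h r : ℕ) → (g β : Carrier) → Carrier × Carrier → ℤ
  scaledLambda q m n h r g β (a , b) =
    (+ (3 ℕ.* h ℕ.* (r ℕ.∸ 1))) ℤ.- (+ (3 ℕ.* q ℕ.* codewordWeight q m n g β a b))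

  pairCount : (q m n h r : ℕ) → (g β : Carrier) → ℤ → ℕ
  pairCount q m n h r g β z =
    length (filter (λ ab → scaledLambda q m n h r g β ab ℤ.≟ z) (cartesianProduct elements elements))

listedCount : List (ℤ × ℤ) → ℤ → ℤ
listedCount [] z = + 0
listedCount ((v , c) ∷ t) z with v ℤ.≟ z
... | yes _ = c ℤ.+ listedCount t z
... | no _  = listedCount t z

epsSqrt : (p s m : ℕ) → ℤ
epsSqrt p s m with ((m ℕ.* s) / 2) % 2
... | zero  = + (p ℕ.^ ((m ℕ.* s) / 2))
... | suc _ = ℤ.- (+ (p ℕ.^ ((m ℕ.* s) / 2)))

-- Table (1), when 3 | (q-1)/h.  Entries: (3q·value, 27·count), with S = ε√r.
table1 : (h r : ℕ) → (S : ℤ) → List (ℤ × ℤ)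
table1 h r S =
    (ℤ.- (+ 3 ℤ.* H ℤ.* (+ 2 ℤ.* S ℤ.+ + 1)) , R1 ℤ.* (R ℤ.- + 8 ℤ.- + 2 ℤ.* S))
  ∷ (+ 3 ℤ.* H ℤ.* (S ℤ.- + 1) , + 2 ℤ.* R1 ℤ.* (+ 4 ℤ.* R ℤ.- + 14 ℤ.+ S))
  ∷ (ℤ.- (+ 3 ℤ.* H ℤ.* (S ℤ.+ + 1)) , + 6 ℤ.* R1 ℤ.* (R ℤ.- + 2 ℤ.+ S))
  ∷ (ℤ.- (+ 3 ℤ.* H) , + 6 ℤ.* R1 ℤ.* (+ 2 ℤ.* R ℤ.- + 1 ℤ.- S))
  ∷ (H ℤ.* (R ℤ.- + 4 ℤ.* S ℤ.- + 3) , + 27 ℤ.* R1)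
  ∷ (H ℤ.* (R ℤ.+ + 2 ℤ.* S ℤ.- + 3) , + 54 ℤ.* R1)
  ∷ (+ 3 ℤ.* H ℤ.* R1 , + 27)
  ∷ []
  where
  H R R1 : ℤ
  H = + h
  R = + r
  R1 = R ℤ.- + 1

-- Table (2), when 3 ∤ (q-1)/h.  Entries: (3q·value, 27·count), with S = ε√r.
table2 : (h r : ℕ) → (S : ℤ) → List (ℤ × ℤ)
table2 h r S =
    (ℤ.- (+ 3 ℤ.* H ℤ.* (+ 2 ℤ.* S ℤ.+ + 1)) , R1 ℤ.* (R ℤ.+ + 1 ℤ.- + 2 ℤ.* S))
  ∷ (+ 3 ℤ.* H ℤ.* (S ℤ.- + 1) , + 2 ℤ.* R1 ℤ.* (+ 4 ℤ.* R ℤ.- + 5 ℤ.+ S))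
  ∷ (ℤ.- (+ 3 ℤ.* H ℤ.* (S ℤ.+ + 1)) , + 6 ℤ.* R1 ℤ.* (R ℤ.- + 2 ℤ.+ S))
  ∷ (ℤ.- (+ 3 ℤ.* H) , + 3 ℤ.* R1 ℤ.* (+ 4 ℤ.* R ℤ.- + 11 ℤ.- + 2 ℤ.* S))
  ∷ (H ℤ.* (R ℤ.+ + 2 ℤ.* S ℤ.- + 3) , + 27 ℤ.* R1)
  ∷ (H ℤ.* (R ℤ.- S ℤ.- + 3) , + 54 ℤ.* R1)
  ∷ (+ 3 ℤ.* H ℤ.* R1 , + 27)
  ∷ []
  where
  H R R1 : ℤ
  H = + h
  R = + r
  R1 = R ℤ.- + 1

{-# OPTIONS --safe #-}
-- For w(x) = q [Tr x = 0] − 1, the sum of ψ(y x) over y ∈ GF(q)*, the scaled modified weight is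
-- 3 q λ(a , b) = h (K₀(x₀) + K₁(x₁) + K₂(x₂)) with xⱼ = a + b βʲ and Kⱼ(x) = 3 H(gʲ x), where H(x) is
-- the cubic Gaussian period Σ ψ(c x) over the nonzero cubes c; all of this is integer counting.
-- Orthogonality of ψ turns into the convolution identity H ∗ H = r H (and 0 between different
-- cubic classes).  The Frobenius x ↦ x^p swaps the two noncubic classes because p ≡ 2 mod 3, so
-- η₁ = η₂; with Σ η = −1 and Σ η² = r − (r − 1)/3 this gives (3 η₁ + 1)² = r, and the sign is read
-- off modulo 3.  Since x₀ + β x₁ + β² x₂ = 0 and β is a cube, (x₀ , x₁ , x₂) may be replaced by
-- (x , y , x + y); the indicators of {0}, of the cubes and of the noncubes are combinations of 1, δ and K,
-- so every class count is a value of one trilinear form, evaluated by the convolution identity.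
module Submission where

open import Defs
open import Level using (0ℓ)
open import Algebra.Bundles using (CommutativeRing)
import Algebra.Properties.AbelianGroup
import Algebra.Properties.CommutativeSemiring.Binomial
import Algebra.Properties.Ring
import Algebra.Properties.Semiring.Exp
import Algebra.Properties.Semiring.Mult
import Algebra.Properties.Semiring.Sum
open import Data.Fin as Fin using (Fin; toℕ; inject₁; fromℕ)
open import Data.Fin.Properties using (toℕ-inject₁; toℕ-fromℕ; toℕ<n)
open import Data.Integer as ℤ using (ℤ; +_; 0ℤ; 1ℤ; _+_; _*_; -_; _-_)
import Data.Integer.Properties as ℤₚ
open import Data.Integer.Tactic.RingSolver using (solve-∀)
open import Data.List using (List; []; _∷_; _++_; length; filter; map; applyUpTo; upTo; cartesianProduct)
open import Data.List.Properties using (length-upTo; length-applyUpTo; length-map; map-upTo; map-applyUpTo)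
open import Data.List.Membership.Propositional using (_∈_; lose)
open import Data.List.Membership.Propositional.Properties using (∈-∃++; ∈-++⁻; ∈-++⁺ˡ; ∈-++⁺ʳ; ∈-upTo⁺; ∈-upTo⁻; ∈-applyUpTo⁻; ∈-applyUpTo⁺)
open import Data.List.Relation.Unary.All as All using ([]; _∷_)
open import Data.List.Relation.Unary.AllPairs using ([]; _∷_)
open import Data.List.Relation.Unary.Any as Any using (here; there)
open import Data.List.Relation.Unary.Unique.Propositional using (Unique)
import Data.List.Relation.Unary.Unique.Propositional.Properties as Unique
open import Data.List.Relation.Binary.Permutation.Propositional as ↭ using (_↭_; ↭-trans; ↭-sym; ↭-prep; ↭-refl; ↭⇒↭ₛ)
open import Data.List.Relation.Binary.Permutation.Propositional.Properties using (shift; ↭-length)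
import Data.List.Relation.Binary.Permutation.Setoid.Properties as ↭ₛ
open import Data.Nat as ℕ using (ℕ; zero; suc; _≤_; _<_; _≥_; z≤n; s≤s; NonZero; _!)
open import Data.Nat.Combinatorics using (_C_; nCn≡1; nCk≡n!/k![n-k]!; k![n∸k]!∣n!)
open import Data.Nat.Coprimality using (Coprime; coprime-divisor; gcd≡1⇒coprime)
open import Data.Nat.DivMod using (_%_; _/_; m%n<n; m≡m%n+[m/n]*n; m/n*n≡m; m*n/n≡m; m∣n⇒o%n%m≡o%m; [m+kn]%n≡m%n; m<n⇒m%n≡m; %-distribˡ-*)
open import Data.Nat.Divisibility as ∣ using (_∣_; divides; divides-refl)
open import Data.Nat.GCD using (gcd; gcd[m,n]∣m; c*gcd[m,n]≡gcd[cm,cn])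
open import Data.Nat.Induction using (<-rec)
open import Data.Nat.Primality using (Prime; prime?; euclidsLemma; prime⇒nonTrivial; prime⇒nonZero; prime⇒irreducible)
import Data.Nat.Properties as ℕₚ
open import Data.Nat.Tactic.RingSolver using () renaming (solve-∀ to ℕ-solve-∀)
open import Data.Product using (_×_; _,_; proj₁; proj₂; ∃)
open import Data.Sum using (_⊎_; inj₁; inj₂)
open import Function using (_∘_)
open import Relation.Binary.Definitions using (tri<; tri≈; tri>)
open import Relation.Binary.PropositionalEquality
open import Relation.Nullary using (¬_; Dec; yes; no; contradiction)
open import Relation.Nullary.Decidable using (¬?; from-yes)

-- The character `ψ` is only ever summed over all nonzero `GF(q)`-multiples of an element, and such
-- a sum is `q - 1` or `-1`; this is why no complex numbers occur. The hypothesis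
-- `gcd u (3 * k) = 3` with `u = (r - 1)/(q - 1)` does two jobs. Writing `u = 3 v`, it makes
-- `GF(q)*`, generated by `α ^ u`, consist of cubes, so that `H` is defined modulo `GF(q)*`; and it
-- makes `k` coprime to `v`, so that the positions of a codeword in one residue class modulo 3 run
-- `h` times through the cubes modulo `GF(q)*`. The two tables differ only through the twist by
-- `gʲ`, which moves the cubic class by `k j` modulo 3: not at all if `3 ∣ k`, and to three
-- different classes otherwise. This is carried as an idempotent `G`, equal to 1 or 0, so one
-- polynomial computation serves both tables. The values of `K` on cubes and noncubes differ by
-- `3 S`, so an indicator has denominator `3 S` and a product of three has `27 S³`. The factor 27
-- stays in the statement and `S³` is cancelled at the end.

⟦_⟧ : {P : Set} → Dec P → ℤ
⟦ yes _ ⟧ = 1ℤ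
⟦ no _ ⟧  = 0ℤ

⟦⟧-true : {P : Set} (d : Dec P) → P → ⟦ d ⟧ ≡ 1ℤ
⟦⟧-true (yes _) _ = refl
⟦⟧-true (no ¬p) p = contradiction p ¬p

⟦⟧-false : {P : Set} (d : Dec P) → ¬ P → ⟦ d ⟧ ≡ 0ℤ
⟦⟧-false (yes p) ¬p = contradiction p ¬p
⟦⟧-false (no _)  _  = refl

⟦⟧-cong : {P Q : Set} (d : Dec P) (e : Dec Q) → (P → Q) → (Q → P) → ⟦ d ⟧ ≡ ⟦ e ⟧
⟦⟧-cong (yes p) e f g = sym (⟦⟧-true e (f p))
⟦⟧-cong (no ¬p) e f g = sym (⟦⟧-false e (¬p ∘ g))

-- Finite integer sums over lists and their rearrangement.

∑ : {A : Set} → List A → (A → ℤ) → ℤ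
∑ []       f = 0ℤ
∑ (x ∷ xs) f = f x + ∑ xs f

module _ {A : Set} where

  ∑-cong∈ : ∀ (xs : List A) {f g} → (∀ {x} → x ∈ xs → f x ≡ g x) → ∑ xs f ≡ ∑ xs g
  ∑-cong∈ []       h = refl
  ∑-cong∈ (x ∷ xs) h = cong₂ _+_ (h (here refl)) (∑-cong∈ xs (h ∘ there))

  ∑-cong : ∀ (xs : List A) {f g} → (∀ x → f x ≡ g x) → ∑ xs f ≡ ∑ xs g
  ∑-cong xs h = ∑-cong∈ xs (λ {x} _ → h x)

  ∑-+ : ∀ (xs : List A) f g → ∑ xs (λ x → f x + g x) ≡ ∑ xs f + ∑ xs g
  ∑-+ []       f g = refl
  ∑-+ (x ∷ xs) f g = trans (cong (_+_ (f x + g x)) (∑-+ xs f g)) (rearrange (f x) (g x) (∑ xs f) (∑ xs g))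
    where
    rearrange : ∀ a b c d → a + b + (c + d) ≡ a + c + (b + d)
    rearrange = solve-∀

  ∑-*ˡ : ∀ (xs : List A) c f → ∑ xs (λ x → c * f x) ≡ c * ∑ xs f
  ∑-*ˡ []       c f = sym (ℤₚ.*-zeroʳ c)
  ∑-*ˡ (x ∷ xs) c f = trans (cong (_+_ (c * f x)) (∑-*ˡ xs c f)) (sym (ℤₚ.*-distribˡ-+ c (f x) (∑ xs f)))

  ∑-*ʳ : ∀ (xs : List A) c f → ∑ xs (λ x → f x * c) ≡ ∑ xs f * c
  ∑-*ʳ xs c f = trans (∑-cong xs λ x → ℤₚ.*-comm (f x) c) (trans (∑-*ˡ xs c f) (ℤₚ.*-comm c _))

  ∑-const : ∀ (xs : List A) c → ∑ xs (λ _ → c) ≡ + length xs * c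
  ∑-const []       c = refl
  ∑-const (x ∷ xs) c = trans (cong (_+_ c) (∑-const xs c)) (sym (ℤₚ.suc-* (+ length xs) c))

  ∑-zero : ∀ (xs : List A) {f} → (∀ {x} → x ∈ xs → f x ≡ 0ℤ) → ∑ xs f ≡ 0ℤ
  ∑-zero []       h = refl
  ∑-zero (x ∷ xs) h rewrite h (here refl) = trans (ℤₚ.+-identityˡ _) (∑-zero xs (h ∘ there))

  ∑-↭ : ∀ {xs ys : List A} f → xs ↭ ys → ∑ xs f ≡ ∑ ys f
  ∑-↭ f ↭.refl = refl
  ∑-↭ f (↭.prep x p) = cong (_+_ (f x)) (∑-↭ f p)
  ∑-↭ f (↭.swap {xs} x y p) = trans (rearrange (f x) (f y) (∑ xs f)) (cong (λ s → f y + (f x + s)) (∑-↭ f p))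
    where
    rearrange : ∀ a b c → a + (b + c) ≡ b + (a + c)
    rearrange = solve-∀
  ∑-↭ f (↭.trans p q) = trans (∑-↭ f p) (∑-↭ f q)

  ∑-++ : ∀ (xs ys : List A) f → ∑ (xs ++ ys) f ≡ ∑ xs f + ∑ ys f
  ∑-++ []       ys f = sym (ℤₚ.+-identityˡ _)
  ∑-++ (x ∷ xs) ys f = trans (cong (_+_ (f x)) (∑-++ xs ys f)) (sym (ℤₚ.+-assoc (f x) _ _))

  ∑-map : ∀ {B : Set} (g : B → A) (xs : List B) f → ∑ (map g xs) f ≡ ∑ xs (f ∘ g)
  ∑-map g []       f = refl
  ∑-map g (x ∷ xs) f = cong (_+_ (f (g x))) (∑-map g xs f)

  ∑-cartesianProduct : ∀ {B : Set} (xs : List A) (ys : List B) f →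
    ∑ (cartesianProduct xs ys) f ≡ ∑ xs (λ x → ∑ ys (λ y → f (x , y)))
  ∑-cartesianProduct []       ys f = refl
  ∑-cartesianProduct (x ∷ xs) ys f = trans (pairs ys) (cong (_+_ (∑ ys (λ y → f (x , y)))) (∑-cartesianProduct xs ys f))
    where
    pairs : ∀ zs → ∑ (map (x ,_) zs ++ cartesianProduct xs ys) f ≡ ∑ zs (λ y → f (x , y)) + ∑ (cartesianProduct xs ys) f
    pairs []       = sym (ℤₚ.+-identityˡ _)
    pairs (z ∷ zs) = trans (cong (_+_ (f (x , z))) (pairs zs)) (sym (ℤₚ.+-assoc (f (x , z)) _ _))

  length-filter≡∑ : ∀ {P : A → Set} (P? : ∀ x → Dec (P x)) xs → + length (filter P? xs) ≡ ∑ xs (λ x → ⟦ P? x ⟧)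
  length-filter≡∑ P? []       = refl
  length-filter≡∑ P? (x ∷ xs) with P? x
  ... | yes _ = cong (_+_ 1ℤ) (length-filter≡∑ P? xs)
  ... | no _  = trans (length-filter≡∑ P? xs) (sym (ℤₚ.+-identityˡ _))

  ∑-single : ∀ {xs : List A} {x} f → Unique xs → x ∈ xs → (∀ {y} → y ∈ xs → y ≢ x → f y ≡ 0ℤ) → ∑ xs f ≡ f x
  ∑-single {x ∷ xs} f (x∉ ∷ _) (here refl) h =
    trans (cong (_+_ (f x)) (∑-zero xs λ y∈ → h (there y∈) (≢-sym (All.lookup x∉ y∈)))) (ℤₚ.+-identityʳ _)
  ∑-single {y ∷ xs} f (y∉ ∷ xs!) (there x∈) h =
    trans (cong₂ _+_ (h (here refl) (All.lookup y∉ x∈)) (∑-single f xs! x∈ (h ∘ there))) (ℤₚ.+-identityˡ _)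

  private
    extract : ∀ {x} {xs ys : List A} → Unique (x ∷ xs) → (∀ {z} → z ∈ x ∷ xs → z ∈ ys) →
              ∃ λ zs → (ys ↭ x ∷ zs) × (length ys ≡ suc (length zs)) × (∀ {z} → z ∈ xs → z ∈ zs)
    extract {x} (x∉ ∷ xs!) sub with as , bs , refl ← ∈-∃++ (sub (here refl)) =
      as ++ bs , shift x as bs , length-shift as , λ z∈ → drop as (All.lookup x∉ z∈) (sub (there z∈))
      where
      length-shift : ∀ as {bs} → length (as ++ x ∷ bs) ≡ suc (length (as ++ bs))
      length-shift []       = refl
      length-shift (a ∷ as) = cong suc (length-shift as)
      drop : ∀ as {bs z} → x ≢ z → z ∈ as ++ x ∷ bs → z ∈ as ++ bs
      drop as x≢z z∈ with ∈-++⁻ as z∈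
      ... | inj₁ z∈as         = ∈-++⁺ˡ z∈as
      ... | inj₂ (here refl)  = contradiction refl x≢z
      ... | inj₂ (there z∈bs) = ∈-++⁺ʳ as z∈bs

  unique-⊆-length : ∀ {xs ys : List A} → Unique xs → (∀ {z} → z ∈ xs → z ∈ ys) → length xs ≤ length ys
  unique-⊆-length {[]}     _   _   = z≤n
  unique-⊆-length {x ∷ xs} xs! sub with zs , _ , eq , sub′ ← extract xs! sub | _ ∷ xs!′ ← xs! =
    subst (suc (length xs) ≤_) (sym eq) (s≤s (unique-⊆-length xs!′ sub′))

  -- Pigeonhole: after the head of `xs` is removed from `ys`, the length bound passes to the tails.
  -- Every change of variable below rests on it: affine maps of the field, multiplication of
  -- residues, and the listing of the field by powers of `α`.
  unique-⊆-↭ : ∀ {xs ys : List A} → Unique xs → (∀ {z} → z ∈ xs → z ∈ ys) → length ys ≤ length xs → xs ↭ ys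
  unique-⊆-↭ {[]} {[]} _ _ _ = ↭-refl
  unique-⊆-↭ {x ∷ xs} xs! sub len with zs , p , eq , sub′ ← extract xs! sub | _ ∷ xs!′ ← xs! =
    ↭-trans (↭-prep x (unique-⊆-↭ xs!′ sub′ (ℕ.s≤s⁻¹ (subst (_≤ suc (length xs)) eq len)))) (↭-sym p)

∑-swap : ∀ {A B : Set} (xs : List A) (ys : List B) (f : A → B → ℤ) →
         ∑ xs (λ x → ∑ ys (f x)) ≡ ∑ ys (λ y → ∑ xs (λ x → f x y))
∑-swap []       ys f = sym (∑-zero ys λ _ → refl)
∑-swap (x ∷ xs) ys f =
  trans (cong (_+_ (∑ ys (f x))) (∑-swap xs ys f)) (sym (∑-+ ys (f x) (λ y → ∑ xs (λ x → f x y))))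

∑-*-∑ : ∀ {A B : Set} (xs : List A) (ys : List B) f g →
        ∑ xs f * ∑ ys g ≡ ∑ xs (λ x → ∑ ys (λ y → f x * g y))
∑-*-∑ xs ys f g = trans (sym (∑-*ʳ xs (∑ ys g) f)) (∑-cong xs λ x → sym (∑-*ˡ ys (f x) g))

∑-upTo-applyUpTo : ∀ {A : Set} (g : ℕ → A) n f → ∑ (applyUpTo g n) f ≡ ∑ (upTo n) (f ∘ g)
∑-upTo-applyUpTo g n f = trans (cong (λ xs → ∑ xs f) (sym (map-upTo g n))) (∑-map g (upTo n) f)

∑-upTo-const : ∀ n c → ∑ (upTo n) (λ _ → c) ≡ + n * c
∑-upTo-const n c = trans (∑-const (upTo n) c) (cong (λ l → + l * c) (length-upTo n))

∑-upTo-suc : ∀ n f → ∑ (upTo (suc n)) f ≡ f 0 + ∑ (upTo n) (f ∘ suc)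
∑-upTo-suc n f = cong (_+_ (f 0)) (∑-upTo-applyUpTo suc n f)

∑-upTo-+ : ∀ m n f → ∑ (upTo (m ℕ.+ n)) f ≡ ∑ (upTo m) f + ∑ (upTo n) (λ i → f (m ℕ.+ i))
∑-upTo-+ zero    n f = sym (ℤₚ.+-identityˡ _)
∑-upTo-+ (suc m) n f = begin
  ∑ (upTo (suc (m ℕ.+ n))) f                                     ≡⟨ ∑-upTo-suc (m ℕ.+ n) f ⟩
  f 0 + ∑ (upTo (m ℕ.+ n)) (f ∘ suc)                             ≡⟨ cong (_+_ (f 0)) (∑-upTo-+ m n (f ∘ suc)) ⟩
  f 0 + (∑ (upTo m) (f ∘ suc) + ∑ (upTo n) (λ i → f (suc m ℕ.+ i))) ≡⟨ sym (ℤₚ.+-assoc (f 0) _ _) ⟩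
  f 0 + ∑ (upTo m) (f ∘ suc) + ∑ (upTo n) (λ i → f (suc m ℕ.+ i))
      ≡⟨ cong (_+ ∑ (upTo n) (λ i → f (suc m ℕ.+ i))) (sym (∑-upTo-suc m f)) ⟩
  ∑ (upTo (suc m)) f + ∑ (upTo n) (λ i → f (suc m ℕ.+ i))        ∎
  where open ≡-Reasoning

-- Division with remainder by `n`. It separates the positions of a codeword modulo 3 and splits the
-- nonzero cubes into multiples of representatives modulo `GF(q)*`.
∑-upTo-* : ∀ m n f → ∑ (upTo (m ℕ.* n)) f ≡ ∑ (upTo m) (λ i → ∑ (upTo n) (λ j → f (i ℕ.* n ℕ.+ j)))
∑-upTo-* zero    n f = refl
∑-upTo-* (suc m) n f = begin
  ∑ (upTo (n ℕ.+ m ℕ.* n)) f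
    ≡⟨ ∑-upTo-+ n (m ℕ.* n) f ⟩
  ∑ (upTo n) f + ∑ (upTo (m ℕ.* n)) (λ i → f (n ℕ.+ i))
    ≡⟨ cong (_+_ (∑ (upTo n) f)) (∑-upTo-* m n (λ i → f (n ℕ.+ i))) ⟩
  ∑ (upTo n) f + ∑ (upTo m) (λ i → ∑ (upTo n) (λ j → f (n ℕ.+ (i ℕ.* n ℕ.+ j))))
    ≡⟨ cong (_+_ (∑ (upTo n) f)) (∑-cong (upTo m) λ i → ∑-cong (upTo n) λ j → cong f (sym (ℕₚ.+-assoc n (i ℕ.* n) j))) ⟩
  ∑ (upTo n) f + ∑ (upTo m) (λ i → ∑ (upTo n) (λ j → f (suc i ℕ.* n ℕ.+ j)))
    ≡⟨ sym (∑-upTo-suc m (λ i → ∑ (upTo n) (λ j → f (i ℕ.* n ℕ.+ j)))) ⟩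
  ∑ (upTo (suc m)) (λ i → ∑ (upTo n) (λ j → f (i ℕ.* n ℕ.+ j))) ∎
  where open ≡-Reasoning

-- Sums of periodic functions over full periods.

Periodic : ℕ → (ℕ → ℤ) → Set
Periodic v f = ∀ i → f (v ℕ.+ i) ≡ f i

module _ {v : ℕ} {f : ℕ → ℤ} (f-periodic : Periodic v f) where

  periodic-* : ∀ m i → f (m ℕ.* v ℕ.+ i) ≡ f i
  periodic-* zero    i = refl
  periodic-* (suc m) i = trans (cong f (ℕₚ.+-assoc v (m ℕ.* v) i)) (trans (f-periodic _) (periodic-* m i))

  periodic-% : .{{_ : NonZero v}} → ∀ i → f (i % v) ≡ f i
  periodic-% i = sym (trans (cong f (trans (m≡m%n+[m/n]*n i v) (ℕₚ.+-comm (i % v) _))) (periodic-* (i / v) (i % v)))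

  ∑-periodic-* : ∀ h → ∑ (upTo (h ℕ.* v)) f ≡ + h * ∑ (upTo v) f
  ∑-periodic-* h = begin
    ∑ (upTo (h ℕ.* v)) f                                       ≡⟨ ∑-upTo-* h v f ⟩
    ∑ (upTo h) (λ i → ∑ (upTo v) (λ j → f (i ℕ.* v ℕ.+ j)))
        ≡⟨ (∑-cong (upTo h) λ i → ∑-cong (upTo v) λ j → periodic-* i j) ⟩
    ∑ (upTo h) (λ _ → ∑ (upTo v) f)                            ≡⟨ ∑-upTo-const h _ ⟩
    + h * ∑ (upTo v) f                                         ∎
    where open ≡-Reasoning

  -- Both sides complete to the sum over `1 + v` consecutive indices; the extra term is `f 0` on the
  -- left and `f v`, equal to it, on the right.
  ∑-periodic-suc : ∑ (upTo v) (f ∘ suc) ≡ ∑ (upTo v) f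
  ∑-periodic-suc = Algebra.Properties.AbelianGroup.∙-cancelˡ ℤₚ.+-0-abelianGroup (f 0) _ _ (begin
    f 0 + ∑ (upTo v) (f ∘ suc)     ≡⟨ sym (∑-upTo-suc v f) ⟩
    ∑ (upTo (1 ℕ.+ v)) f           ≡⟨ cong (λ k → ∑ (upTo k) f) (ℕₚ.+-comm 1 v) ⟩
    ∑ (upTo (v ℕ.+ 1)) f           ≡⟨ ∑-upTo-+ v 1 f ⟩
    ∑ (upTo v) f + (f (v ℕ.+ 0) + 0ℤ) ≡⟨ cong (_+_ (∑ (upTo v) f)) (trans (ℤₚ.+-identityʳ _) (f-periodic 0)) ⟩
    ∑ (upTo v) f + f 0             ≡⟨ ℤₚ.+-comm _ (f 0) ⟩
    f 0 + ∑ (upTo v) f             ∎)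
    where open ≡-Reasoning

≡-mod⇒∣ : ∀ a b n .{{_ : NonZero n}} → a ≤ b → a % n ≡ b % n → n ∣ b ℕ.∸ a
≡-mod⇒∣ a b n a≤b eq = divides (b / n ℕ.∸ a / n) (begin
  b ℕ.∸ a                                                ≡⟨ cong₂ ℕ._∸_ (m≡m%n+[m/n]*n b n) (m≡m%n+[m/n]*n a n) ⟩
  (b % n ℕ.+ b / n ℕ.* n) ℕ.∸ (a % n ℕ.+ a / n ℕ.* n)
      ≡⟨ cong (λ k → (b % n ℕ.+ b / n ℕ.* n) ℕ.∸ (k ℕ.+ a / n ℕ.* n)) eq ⟩
  (b % n ℕ.+ b / n ℕ.* n) ℕ.∸ (b % n ℕ.+ a / n ℕ.* n)    ≡⟨ ℕₚ.[m+n]∸[m+o]≡n∸o (b % n) _ _ ⟩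
  b / n ℕ.* n ℕ.∸ a / n ℕ.* n                            ≡⟨ sym (ℕₚ.*-distribʳ-∸ n (b / n) (a / n)) ⟩
  (b / n ℕ.∸ a / n) ℕ.* n                                ∎)
  where open ≡-Reasoning

-- Multiplication by `c` is injective on residues modulo `v`, hence permutes them. It is applied
-- with `c = p` for the Frobenius map and with `c = k` for the powers of `g`.
∑-periodic-coprime : ∀ {v f} .{{_ : NonZero v}} → Periodic v f → ∀ c → Coprime v c →
                     ∑ (upTo v) (λ i → f (c ℕ.* i)) ≡ ∑ (upTo v) f
∑-periodic-coprime {v} {f} f-periodic c coprime = begin
  ∑ (upTo v) (λ i → f (c ℕ.* i))       ≡⟨ (∑-cong (upTo v) λ i → sym (periodic-% f-periodic (c ℕ.* i))) ⟩
  ∑ (upTo v) (f ∘ σ)                   ≡⟨ sym (∑-upTo-applyUpTo σ v f) ⟩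
  ∑ (applyUpTo σ v) f
      ≡⟨ ∑-↭ f (unique-⊆-↭ unique sub (ℕₚ.≤-reflexive (trans (length-upTo v) (sym (length-applyUpTo σ v))))) ⟩
  ∑ (upTo v) f                         ∎
  where
  open ≡-Reasoning
  σ : ℕ → ℕ
  σ i = (c ℕ.* i) % v
  unique : Unique (applyUpTo σ v)
  unique = Unique.applyUpTo⁺₁ σ v λ {i} {j} i<j j<v eq →
    let v∣c[j∸i] = subst (v ∣_) (sym (ℕₚ.*-distribˡ-∸ c j i))
                     (≡-mod⇒∣ (c ℕ.* i) (c ℕ.* j) v (ℕₚ.*-monoʳ-≤ c (ℕₚ.<⇒≤ i<j)) eq)
        v≤j∸i = ∣.∣⇒≤ {{ℕ.>-nonZero (ℕₚ.m<n⇒0<n∸m i<j)}} (coprime-divisor coprime v∣c[j∸i])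
    in ℕₚ.<⇒≱ j<v (ℕₚ.≤-trans v≤j∸i (ℕₚ.m∸n≤m j i))
  sub : ∀ {z} → z ∈ applyUpTo σ v → z ∈ upTo v
  sub z∈ with i , _ , refl ← ∈-applyUpTo⁻ σ z∈ = ∈-upTo⁺ (m%n<n (c ℕ.* i) v)

-- Divisibility of the inner binomial coefficients by a prime.

prime∤! : ∀ {p} → Prime p → ∀ k → k < p → ¬ p ∣ k !
prime∤! pp zero    _   p∣1 with refl ← ∣.∣1⇒≡1 p∣1 = contradiction pp λ ()
prime∤! {p} pp (suc k) k<p p∣ with euclidsLemma (suc k) (k !) pp p∣
... | inj₁ p∣k = ℕₚ.<⇒≱ k<p (∣.∣⇒≤ p∣k)
... | inj₂ p∣k! = prime∤! pp k (ℕₚ.<⇒≤ k<p) p∣k!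

n∣n! : ∀ n .{{_ : NonZero n}} → n ∣ n !
n∣n! (suc n) = ∣.m∣m*n (n !)

-- The prime divides `p ! = (p C k) * (k ! * (p - k) !)` but neither factorial, both being products
-- of numbers below `p`.
prime∣C : ∀ {p} → Prime p → ∀ k → 0 < k → k < p → p ∣ p C k
prime∣C {p} pp k 0<k k<p with euclidsLemma (p C k) (k ! ℕ.* (p ℕ.∸ k) !) pp
    (subst (p ∣_) (sym C*k![p-k]!≡p!) (n∣n! p {{prime⇒nonZero pp}}))
  where
  k≤p = ℕₚ.<⇒≤ k<p
  C*k![p-k]!≡p! : (p C k) ℕ.* (k ! ℕ.* (p ℕ.∸ k) !) ≡ p !
  C*k![p-k]!≡p! = trans (cong (ℕ._* (k ! ℕ.* (p ℕ.∸ k) !)) (nCk≡n!/k![n-k]! k≤p))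
    (m/n*n≡m {{ℕₚ.m*n≢0 (k !) _ {{ℕₚ._!≢0 k}} {{ℕₚ._!≢0 (p ℕ.∸ k)}}}} (k![n∸k]!∣n! k≤p))
... | inj₁ p∣C = p∣C
... | inj₂ p∣k![p-k]! with euclidsLemma (k !) ((p ℕ.∸ k) !) pp p∣k![p-k]!
... | inj₁ p∣k! = contradiction p∣k! (prime∤! pp k k<p)
... | inj₂ p∣[p-k]! = contradiction p∣[p-k]!
        (prime∤! pp (p ℕ.∸ k) (ℕₚ.∸-monoʳ-< {p} {k} {0} 0<k (ℕₚ.<⇒≤ k<p)))

-- Field arithmetic, characteristic and the Frobenius map.

module FieldProperties (F : FiniteField) where

  open FiniteField F public renaming
    (_+_ to infixl 6 _⊕_; _*_ to infixl 7 _⊗_; -_ to infix 8 ⊖_; 0# to 𝟘; 1# to 𝟙; _^_ to infixr 8 _↑_; _≟_ to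
        infix 4 _≟_)

  commutativeRing : CommutativeRing 0ℓ 0ℓ
  commutativeRing = record { isCommutativeRing = isCommutativeRing }

  private module R = CommutativeRing commutativeRing
  open R public using ()
    renaming ( +-assoc to ⊕-assoc; +-comm to ⊕-comm; +-identityˡ to ⊕-identityˡ; +-identityʳ to ⊕-identityʳ
             ; -‿inverseˡ to ⊖-inverseˡ; -‿inverseʳ to ⊖-inverseʳ
             ; *-assoc to ⊗-assoc; *-comm to ⊗-comm; *-identityˡ to ⊗-identityˡ; *-identityʳ to ⊗-identityʳ
             ; distribˡ to ⊗-distribˡ-⊕; distribʳ to ⊗-distribʳ-⊕; zeroˡ to ⊗-zeroˡ; zeroʳ to ⊗-zeroʳ)
  open Algebra.Properties.Ring R.ring public using ()
    renaming ( -‿distribˡ-* to ⊖-distribˡ-⊗; -‿distribʳ-* to ⊖-distribʳ-⊗; -‿involutive to ⊖-involutive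
             ; +-cancelˡ to ⊕-cancelˡ; +-cancelʳ to ⊕-cancelʳ; -0#≈0# to ⊖𝟘≡𝟘
             ; +-inverseˡ-unique to ⊕-inverseˡ-unique; +-inverseʳ-unique to ⊕-inverseʳ-unique)
  open Algebra.Properties.Semiring.Mult R.semiring public using ()
    renaming (_×_ to infixr 8 _·_; ×1-homo-* to ·1-homo-*; ×-assoc-* to ·-assoc-⊗)

  private module Sum = Algebra.Properties.Semiring.Sum R.semiring

  ⊕-⊖-cancel : ∀ x y → (x ⊕ y) ⊕ ⊖ y ≡ x
  ⊕-⊖-cancel x y = trans (⊕-assoc x y _) (trans (cong (x ⊕_) (⊖-inverseʳ y)) (⊕-identityʳ x))

  ⊖-⊕-cancel : ∀ x y → (x ⊕ ⊖ y) ⊕ y ≡ x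
  ⊖-⊕-cancel x y = trans (⊕-assoc x _ y) (trans (cong (x ⊕_) (⊖-inverseˡ y)) (⊕-identityʳ x))

  ⊕-interchange : ∀ a b c d → (a ⊕ b) ⊕ (c ⊕ d) ≡ (a ⊕ c) ⊕ (b ⊕ d)
  ⊕-interchange a b c d = begin
    (a ⊕ b) ⊕ (c ⊕ d) ≡⟨ ⊕-assoc a b (c ⊕ d) ⟩
    a ⊕ (b ⊕ (c ⊕ d)) ≡⟨ cong (a ⊕_) (sym (⊕-assoc b c d)) ⟩
    a ⊕ ((b ⊕ c) ⊕ d) ≡⟨ cong (λ t → a ⊕ (t ⊕ d)) (⊕-comm b c) ⟩
    a ⊕ ((c ⊕ b) ⊕ d) ≡⟨ cong (a ⊕_) (⊕-assoc c b d) ⟩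
    a ⊕ (c ⊕ (b ⊕ d)) ≡⟨ sym (⊕-assoc a c (b ⊕ d)) ⟩
    (a ⊕ c) ⊕ (b ⊕ d) ∎
    where open ≡-Reasoning

  ⊗-interchange : ∀ a b c d → (a ⊗ b) ⊗ (c ⊗ d) ≡ (a ⊗ c) ⊗ (b ⊗ d)
  ⊗-interchange a b c d = begin
    (a ⊗ b) ⊗ (c ⊗ d) ≡⟨ ⊗-assoc a b (c ⊗ d) ⟩
    a ⊗ (b ⊗ (c ⊗ d)) ≡⟨ cong (a ⊗_) (sym (⊗-assoc b c d)) ⟩
    a ⊗ ((b ⊗ c) ⊗ d) ≡⟨ cong (λ t → a ⊗ (t ⊗ d)) (⊗-comm b c) ⟩
    a ⊗ ((c ⊗ b) ⊗ d) ≡⟨ cong (a ⊗_) (⊗-assoc c b d) ⟩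
    a ⊗ (c ⊗ (b ⊗ d)) ≡⟨ sym (⊗-assoc a c (b ⊗ d)) ⟩
    (a ⊗ c) ⊗ (b ⊗ d) ∎
    where open ≡-Reasoning

  ⊗-leftComm : ∀ a b c → a ⊗ (b ⊗ c) ≡ b ⊗ (a ⊗ c)
  ⊗-leftComm a b c = trans (sym (⊗-assoc a b c)) (trans (cong (_⊗ c) (⊗-comm a b)) (⊗-assoc b a c))

  ⊖≡0⇒≡ : ∀ x y → x ⊕ ⊖ y ≡ 𝟘 → x ≡ y
  ⊖≡0⇒≡ x y eq = trans (⊕-inverseˡ-unique x (⊖ y) eq) (⊖-involutive y)

  ⊗-cancelˡ : ∀ {x} y z → x ≢ 𝟘 → x ⊗ y ≡ x ⊗ z → y ≡ z
  ⊗-cancelˡ {x} y z x≢0 eq with x⁻¹ , xx⁻¹≡1 ← inverse x x≢0 = begin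
    y                ≡⟨ sym (⊗-identityˡ y) ⟩
    𝟙 ⊗ y            ≡⟨ cong (_⊗ y) (sym x⁻¹x≡1) ⟩
    x⁻¹ ⊗ x ⊗ y      ≡⟨ ⊗-assoc x⁻¹ x y ⟩
    x⁻¹ ⊗ (x ⊗ y)    ≡⟨ cong (x⁻¹ ⊗_) eq ⟩
    x⁻¹ ⊗ (x ⊗ z)    ≡⟨ sym (⊗-assoc x⁻¹ x z) ⟩
    x⁻¹ ⊗ x ⊗ z      ≡⟨ cong (_⊗ z) x⁻¹x≡1 ⟩
    𝟙 ⊗ z            ≡⟨ ⊗-identityˡ z ⟩
    z                ∎
    where
    open ≡-Reasoning
    x⁻¹x≡1 : x⁻¹ ⊗ x ≡ 𝟙
    x⁻¹x≡1 = trans (⊗-comm x⁻¹ x) xx⁻¹≡1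

  ⊗≡0⇒ : ∀ {x y} → x ≢ 𝟘 → x ⊗ y ≡ 𝟘 → y ≡ 𝟘
  ⊗≡0⇒ {x} {y} x≢0 eq = ⊗-cancelˡ y 𝟘 x≢0 (trans eq (sym (⊗-zeroʳ x)))

  ⊗≢0 : ∀ {x y} → x ≢ 𝟘 → y ≢ 𝟘 → x ⊗ y ≢ 𝟘
  ⊗≢0 x≢0 y≢0 eq = y≢0 (⊗≡0⇒ x≢0 eq)

  ↑-+ : ∀ x m n → x ↑ (m ℕ.+ n) ≡ x ↑ m ⊗ x ↑ n
  ↑-+ x zero    n = sym (⊗-identityˡ _)
  ↑-+ x (suc m) n = trans (cong (x ⊗_) (↑-+ x m n)) (sym (⊗-assoc x _ _))

  𝟙↑ : ∀ n → 𝟙 ↑ n ≡ 𝟙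
  𝟙↑ zero    = refl
  𝟙↑ (suc n) = trans (⊗-identityˡ _) (𝟙↑ n)

  ⊗-↑ : ∀ x y n → (x ⊗ y) ↑ n ≡ x ↑ n ⊗ y ↑ n
  ⊗-↑ x y zero    = sym (⊗-identityˡ 𝟙)
  ⊗-↑ x y (suc n) = trans (cong (x ⊗ y ⊗_) (⊗-↑ x y n)) (⊗-interchange x y _ _)

  ↑-* : ∀ x m n → x ↑ (m ℕ.* n) ≡ (x ↑ n) ↑ m
  ↑-* x zero    n = refl
  ↑-* x (suc m) n = trans (↑-+ x n (m ℕ.* n)) (cong (x ↑ n ⊗_) (↑-* x m n))

  ↑-comm : ∀ x m n → (x ↑ m) ↑ n ≡ (x ↑ n) ↑ m
  ↑-comm x m n = trans (sym (↑-* x n m)) (trans (cong (x ↑_) (ℕₚ.*-comm n m)) (↑-* x m n))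

  ↑≢0 : ∀ {x} n → x ≢ 𝟘 → x ↑ n ≢ 𝟘
  ↑≢0 zero    _   = 1≢0
  ↑≢0 (suc n) x≢0 = ⊗≢0 x≢0 (↑≢0 n x≢0)

  𝟘↑ : ∀ n → n ≢ 0 → 𝟘 ↑ n ≡ 𝟘
  𝟘↑ zero    n≢0 = contradiction refl n≢0
  𝟘↑ (suc n) _   = ⊗-zeroˡ _

  ↑≡1⇒ : ∀ x m n → x ↑ n ≡ 𝟙 → x ↑ (m ℕ.* n) ≡ 𝟙
  ↑≡1⇒ x m n eq = trans (↑-* x m n) (trans (cong (_↑ m) eq) (𝟙↑ m))

  elements-↭ : ∀ (g : Carrier → Carrier) → (∀ {x y} → g x ≡ g y → x ≡ y) → map g elements ↭ elements
  elements-↭ g inj = unique-⊆-↭ (Unique.map⁺ inj unique) (λ {z} _ → complete z)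
      (ℕₚ.≤-reflexive (sym (length-map g elements)))

  affine-injective : ∀ {a} b → a ≢ 𝟘 → ∀ {x y} → a ⊗ x ⊕ b ≡ a ⊗ y ⊕ b → x ≡ y
  affine-injective b a≢0 {x} {y} eq = ⊗-cancelˡ x y a≢0 (⊕-cancelʳ b _ _ eq)

  ∑-affine : ∀ {a} b → a ≢ 𝟘 → ∀ f → ∑ elements (λ x → f (a ⊗ x ⊕ b)) ≡ ∑ elements f
  ∑-affine {a} b a≢0 f = trans (sym (∑-map (λ x → a ⊗ x ⊕ b) elements f))
    (∑-↭ f (elements-↭ _ (affine-injective b a≢0)))

  ∑-scale : ∀ {a} → a ≢ 𝟘 → ∀ f → ∑ elements (λ x → f (a ⊗ x)) ≡ ∑ elements f
  ∑-scale {a} a≢0 f = trans (∑-cong elements λ x → cong f (sym (⊕-identityʳ (a ⊗ x)))) (∑-affine 𝟘 a≢0 f)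

  ∑-translate : ∀ b f → ∑ elements (λ x → f (x ⊕ b)) ≡ ∑ elements f
  ∑-translate b f = trans (∑-cong elements λ x → cong (λ t → f (t ⊕ b)) (sym (⊗-identityˡ x))) (∑-affine b 1≢0 f)

  -- Translation by `𝟙` permutes the field, so the sum of all elements does not change when `𝟙` is
  -- added to each of them.
  order·𝟙≡0 : order · 𝟙 ≡ 𝟘
  order·𝟙≡0 = ⊕-cancelˡ (sumF elements) _ _ (begin
    sumF elements ⊕ order · 𝟙     ≡⟨ sym (sum-shift elements) ⟩
    sumF (map (_⊕ 𝟙) elements)    ≡⟨ ↭ₛ.foldr-commMonoid (setoid Carrier) R.+-isCommutativeMonoid
                                       (↭⇒↭ₛ (elements-↭ (_⊕ 𝟙) (⊕-cancelʳ 𝟙 _ _))) ⟩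
    sumF elements                 ≡⟨ sym (⊕-identityʳ _) ⟩
    sumF elements ⊕ 𝟘             ∎)
    where
    open ≡-Reasoning
    sum-shift : ∀ xs → sumF (map (_⊕ 𝟙) xs) ≡ sumF xs ⊕ length xs · 𝟙
    sum-shift []       = sym (⊕-identityʳ 𝟘)
    sum-shift (x ∷ xs) = trans (cong (x ⊕ 𝟙 ⊕_) (sum-shift xs)) (⊕-interchange x 𝟙 _ _)

  -- The map `n ↦ n · 𝟙` is multiplicative, so `order · 𝟙` is the `n`-th power of `p · 𝟙`; a nonzero
  -- element of a field has no vanishing power.
  characteristic : ∀ p n → order ≡ p ℕ.^ n → p · 𝟙 ≡ 𝟘
  characteristic p n eq with p · 𝟙 ≟ 𝟘
  ... | yes p≡0 = p≡0
  ... | no p≢0  = contradiction (trans (sym (power n)) (trans (cong (_· 𝟙) (sym eq)) order·𝟙≡0)) (↑≢0 n p≢0)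
    where
    power : ∀ n → (p ℕ.^ n) · 𝟙 ≡ (p · 𝟙) ↑ n
    power zero    = ⊕-identityʳ 𝟙
    power (suc n) = trans (·1-homo-* p (p ℕ.^ n)) (cong (p · 𝟙 ⊗_) (power n))

  module _ {p : ℕ} (p-prime : Prime p) (p·𝟙≡0 : p · 𝟙 ≡ 𝟘) where

    p∣n⇒n·x≡0 : ∀ {n} x → p ∣ n → n · x ≡ 𝟘
    p∣n⇒n·x≡0 x (divides-refl k) = begin
      (k ℕ.* p) · x              ≡⟨ cong ((k ℕ.* p) ·_) (sym (⊗-identityˡ x)) ⟩
      (k ℕ.* p) · (𝟙 ⊗ x)        ≡⟨ sym (·-assoc-⊗ (k ℕ.* p) 𝟙 x) ⟩
      (k ℕ.* p) · 𝟙 ⊗ x          ≡⟨ cong (_⊗ x) (·1-homo-* k p) ⟩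
      k · 𝟙 ⊗ (p · 𝟙) ⊗ x        ≡⟨ cong (λ t → k · 𝟙 ⊗ t ⊗ x) p·𝟙≡0 ⟩
      k · 𝟙 ⊗ 𝟘 ⊗ x              ≡⟨ cong (_⊗ x) (⊗-zeroʳ _) ⟩
      𝟘 ⊗ x                      ≡⟨ ⊗-zeroˡ x ⟩
      𝟘                          ∎
      where open ≡-Reasoning

    frobenius : ∀ x y → (x ⊕ y) ↑ p ≡ x ↑ p ⊕ y ↑ p
    frobenius x y = go p refl
      where
      open ≡-Reasoning
      open Algebra.Properties.Semiring.Exp R.semiring using () renaming (_^_ to _^ˢ_)
      open Algebra.Properties.CommutativeSemiring.Binomial R.commutativeSemiring
        using (binomialTerm; theorem)
      ↑≡^ : ∀ z n → z ↑ n ≡ z ^ˢ n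
      ↑≡^ z zero    = refl
      ↑≡^ z (suc n) = cong (z ⊗_) (↑≡^ z n)
      ·1 : ∀ z → 1 · z ≡ z
      ·1 = ⊕-identityʳ
      -- The exponent is detached from `p` so that matching exposes it as `suc n`, where the first
      -- and last binomial terms split off; each term between them has a coefficient divisible by
      -- `p`.
      go : ∀ n → n ≡ p → (x ⊕ y) ↑ n ≡ x ↑ n ⊕ y ↑ n
      go zero    refl = contradiction p-prime λ ()
      go (suc n) refl = begin
        (x ⊕ y) ↑ suc n                               ≡⟨ ↑≡^ _ (suc n) ⟩
        (x ⊕ y) ^ˢ suc n                              ≡⟨ theorem (suc n) x y ⟩
        t Fin.zero ⊕ Sum.sum (t ∘ Fin.suc)            ≡⟨ cong₂ _⊕_ first (Sum.sum-init-last (t ∘ Fin.suc)) ⟩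
        y ↑ suc n ⊕ (Sum.sum middle ⊕ t (fromℕ (suc n))) ≡⟨ cong (y ↑ suc n ⊕_) (cong₂ _⊕_ middle≡0 last) ⟩
        y ↑ suc n ⊕ (𝟘 ⊕ x ↑ suc n)                   ≡⟨ cong (y ↑ suc n ⊕_) (⊕-identityˡ _) ⟩
        y ↑ suc n ⊕ x ↑ suc n                         ≡⟨ ⊕-comm _ _ ⟩
        x ↑ suc n ⊕ y ↑ suc n                         ∎
        where
        t : Fin (suc (suc n)) → Carrier
        t = binomialTerm x y (suc n)
        middle : Fin n → Carrier
        middle i = t (Fin.suc (inject₁ i))
        first : t Fin.zero ≡ y ↑ suc n
        first = trans (·1 _) (trans (⊗-identityˡ _) (sym (↑≡^ y (suc n))))
        last : t (fromℕ (suc n)) ≡ x ↑ suc n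
        last = begin
          (suc n C k) · (x ^ˢ k ⊗ y ^ˢ (suc n ℕ.∸ k))
              ≡⟨ cong (λ k → (suc n C k) · (x ^ˢ k ⊗ y ^ˢ (suc n ℕ.∸ k))) (toℕ-fromℕ (suc n)) ⟩
          (suc n C suc n) · (x ^ˢ suc n ⊗ y ^ˢ (n ℕ.∸ n))
              ≡⟨ cong₂ (λ c d → c · (x ^ˢ suc n ⊗ y ^ˢ d)) (nCn≡1 (suc n)) (ℕₚ.n∸n≡0 n) ⟩
          1 · (x ^ˢ suc n ⊗ 𝟙)                            ≡⟨ trans (·1 _) (⊗-identityʳ _) ⟩
          x ^ˢ suc n                                      ≡⟨ sym (↑≡^ x (suc n)) ⟩
          x ↑ suc n                                       ∎
          where k = toℕ (fromℕ (suc n))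
        middle≡0 : Sum.sum middle ≡ 𝟘
        middle≡0 = trans (Sum.sum-cong-≋ {n} {middle} {λ _ → 𝟘} λ i →
          p∣n⇒n·x≡0 _ (prime∣C p-prime (suc (toℕ (inject₁ i))) (s≤s z≤n)
            (s≤s (subst (_< n) (sym (toℕ-inject₁ i)) (toℕ<n i))))) (Sum.sum-replicate-zero n)

    frobenius^ : ∀ n x y → (x ⊕ y) ↑ (p ℕ.^ n) ≡ x ↑ (p ℕ.^ n) ⊕ y ↑ (p ℕ.^ n)
    frobenius^ zero    x y = trans (⊗-identityʳ _) (sym (cong₂ _⊕_ (⊗-identityʳ x) (⊗-identityʳ y)))
    frobenius^ (suc n) x y = begin
      (x ⊕ y) ↑ (p ℕ.* p ℕ.^ n)                    ≡⟨ ↑-* _ p (p ℕ.^ n) ⟩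
      ((x ⊕ y) ↑ (p ℕ.^ n)) ↑ p                    ≡⟨ cong (_↑ p) (frobenius^ n x y) ⟩
      (x ↑ (p ℕ.^ n) ⊕ y ↑ (p ℕ.^ n)) ↑ p          ≡⟨ frobenius _ _ ⟩
      (x ↑ (p ℕ.^ n)) ↑ p ⊕ (y ↑ (p ℕ.^ n)) ↑ p    ≡⟨ sym (cong₂ _⊕_ (↑-* x p (p ℕ.^ n)) (↑-* y p (p ℕ.^ n))) ⟩
      x ↑ (p ℕ.* p ℕ.^ n) ⊕ y ↑ (p ℕ.* p ℕ.^ n)    ∎
      where open ≡-Reasoning

-- The multiplicative group as the powers of a primitive element.

least : ∀ {P : ℕ → Set} → (∀ n → Dec (P n)) → ∀ n → P n → ∃ λ m → P m × (∀ k → k < m → ¬ P k)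
least {P} P? = <-rec (λ n → P n → ∃ λ m → P m × (∀ k → k < m → ¬ P k)) step
  where
  step : ∀ n → (∀ {i} → i < n → P i → ∃ λ m → P m × (∀ k → k < m → ¬ P k)) → P n → ∃ λ m → P m × (∀ k → k < m → ¬ P k)
  step n rec Pn with ℕₚ.anyUpTo? P? n
  ... | yes (i , i<n , Pi) = rec i<n Pi
  ... | no ∄                = n , Pn , λ k k<n Pk → ∄ (k , k<n , Pk)

module PrimitiveElement (F : FiniteField) {α : FiniteField.Carrier F} (α-primitive : FiniteField.IsPrimitive F α) where

  open FieldProperties F

  α≢0 : α ≢ 𝟘
  α≢0 = proj₁ α-primitive

  abstract
    -- Some exponent, not the smallest one: only its residue modulo `αᵒ` is determined. It is
    -- abstract so that goals never unfold it.
    log : ∀ {x} → x ≢ 𝟘 → ℕ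
    log x≢0 = proj₁ (proj₂ α-primitive _ x≢0)

    α↑log : ∀ {x} (x≢0 : x ≢ 𝟘) → α ↑ log x≢0 ≡ x
    α↑log x≢0 = proj₂ (proj₂ α-primitive _ x≢0)

  ↑-cancel : ∀ i {j} → i ≤ j → α ↑ i ≡ α ↑ j → α ↑ (j ℕ.∸ i) ≡ 𝟙
  ↑-cancel i {j} i≤j eq = ⊗-cancelˡ _ _ (↑≢0 i α≢0) (begin
    α ↑ i ⊗ α ↑ (j ℕ.∸ i)  ≡⟨ sym (↑-+ α i (j ℕ.∸ i)) ⟩
    α ↑ (i ℕ.+ (j ℕ.∸ i))  ≡⟨ cong (α ↑_) (ℕₚ.m+[n∸m]≡n i≤j) ⟩
    α ↑ j                  ≡⟨ sym eq ⟩
    α ↑ i                  ≡⟨ sym (⊗-identityʳ _) ⟩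
    α ↑ i ⊗ 𝟙              ∎)
    where open ≡-Reasoning

  private
    inv : ∃ λ y → α ⊗ y ≡ 𝟙
    inv = inverse α α≢0

    inv≢0 : proj₁ inv ≢ 𝟘
    inv≢0 eq = 1≢0 (trans (sym (proj₂ inv)) (trans (cong (α ⊗_) eq) (⊗-zeroʳ α)))

    abstract
      -- The logarithm of the inverse of `α`, plus one, is a positive exponent that returns to `𝟙`,
      -- so the search for the least one ends. Searching over `suc n` excludes the exponent 0 and
      -- makes `αᵒ` visibly nonzero, as `%` and `/` require.
      least-period : ∃ λ n → (α ↑ suc n ≡ 𝟙) × (∀ k → k < n → ¬ α ↑ suc k ≡ 𝟙)
      least-period = least (λ n → α ↑ suc n ≟ 𝟙) (log inv≢0) (trans (cong (α ⊗_) (α↑log inv≢0)) (proj₂ inv))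

  αᵒ : ℕ
  αᵒ = suc (proj₁ least-period)

  α↑αᵒ≡𝟙 : α ↑ αᵒ ≡ 𝟙
  α↑αᵒ≡𝟙 = proj₁ (proj₂ least-period)

  <αᵒ⇒≢𝟙 : ∀ k → 0 < k → k < αᵒ → α ↑ k ≢ 𝟙
  <αᵒ⇒≢𝟙 (suc k) _ (s≤s k<n) = proj₂ (proj₂ least-period) k k<n

  ↑-distinct : ∀ {i j} → i < j → j < αᵒ → α ↑ i ≢ α ↑ j
  ↑-distinct {i} {j} i<j j<αᵒ eq =
    <αᵒ⇒≢𝟙 (j ℕ.∸ i) (ℕₚ.m<n⇒0<n∸m i<j) (ℕₚ.≤-<-trans (ℕₚ.m∸n≤m j i) j<αᵒ) (↑-cancel i (ℕₚ.<⇒≤ i<j) eq)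

  ↑-% : ∀ a → α ↑ (a % αᵒ) ≡ α ↑ a
  ↑-% a = sym (begin
    α ↑ a                                   ≡⟨ cong (α ↑_) (m≡m%n+[m/n]*n a αᵒ) ⟩
    α ↑ (a % αᵒ ℕ.+ a / αᵒ ℕ.* αᵒ)          ≡⟨ ↑-+ α (a % αᵒ) _ ⟩
    α ↑ (a % αᵒ) ⊗ α ↑ (a / αᵒ ℕ.* αᵒ)      ≡⟨ cong (α ↑ (a % αᵒ) ⊗_) (↑≡1⇒ α (a / αᵒ) αᵒ α↑αᵒ≡𝟙) ⟩
    α ↑ (a % αᵒ) ⊗ 𝟙                        ≡⟨ ⊗-identityʳ _ ⟩
    α ↑ (a % αᵒ)                            ∎)
    where open ≡-Reasoning

  ↑-injective-% : ∀ a b → α ↑ a ≡ α ↑ b → a % αᵒ ≡ b % αᵒ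
  ↑-injective-% a b eq with ℕₚ.<-cmp (a % αᵒ) (b % αᵒ) | trans (↑-% a) (trans eq (sym (↑-% b)))
  ... | tri< a<b _ _ | eq′ = contradiction eq′ (↑-distinct a<b (m%n<n b αᵒ))
  ... | tri≈ _ a≡b _ | _   = a≡b
  ... | tri> _ _ b<a | eq′ = contradiction (sym eq′) (↑-distinct b<a (m%n<n a αᵒ))

  ↑-injective-%∣ : ∀ {c} .{{_ : NonZero c}} → c ∣ αᵒ → ∀ a b → α ↑ a ≡ α ↑ b → a % c ≡ b % c
  ↑-injective-%∣ {c} c∣αᵒ a b eq = trans (sym (m∣n⇒o%n%m≡o%m c αᵒ a c∣αᵒ))
    (trans (cong (_% c) (↑-injective-% a b eq)) (m∣n⇒o%n%m≡o%m c αᵒ b c∣αᵒ))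

  ↑≡𝟙⇒∣ : ∀ a → α ↑ a ≡ 𝟙 → αᵒ ∣ a
  ↑≡𝟙⇒∣ a eq = ∣.m%n≡0⇒n∣m a αᵒ (↑-injective-% a 0 eq)

  private
    powers : List Carrier
    powers = 𝟘 ∷ applyUpTo (α ↑_) αᵒ

    powers! : Unique powers
    powers! = All.tabulate (λ x∈ → λ { refl → let (i , _ , eq) = ∈-applyUpTo⁻ (α ↑_) x∈ in ↑≢0 i α≢0 (sym eq) })
            ∷ Unique.applyUpTo⁺₁ (α ↑_) αᵒ ↑-distinct

    ∈powers : ∀ x → x ∈ powers
    ∈powers x with x ≟ 𝟘
    ... | yes x≡0 = here x≡0
    ... | no x≢0  = there (subst (_∈ _) (trans (↑-% (log x≢0)) (α↑log x≢0)) (∈-applyUpTo⁺ (α ↑_) (m%n<n (log x≢0) αᵒ)))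

    -- The powers cover the field because `α` is primitive; being distinct, they are no more
    -- numerous than its elements. This identifies `αᵒ` with `r - 1`.
    elements-↭-powers : elements ↭ powers
    elements-↭-powers = unique-⊆-↭ unique (λ {x} _ → ∈powers x) (unique-⊆-length powers! (λ {x} _ → complete x))

  order≡1+αᵒ : order ≡ suc αᵒ
  order≡1+αᵒ = trans (↭-length elements-↭-powers) (cong suc (length-applyUpTo (α ↑_) αᵒ))

  ∑-elements : ∀ f → ∑ elements f ≡ f 𝟘 + ∑ (upTo αᵒ) (λ i → f (α ↑ i))
  ∑-elements f = trans (∑-↭ f elements-↭-powers) (cong (_+_ (f 𝟘)) (∑-upTo-applyUpTo (α ↑_) αᵒ f))

  ↑order : ∀ x → x ↑ order ≡ x
  ↑order x with x ≟ 𝟘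
  ... | yes refl = 𝟘↑ order (λ eq → ℕₚ.0≢1+n (trans (sym eq) order≡1+αᵒ))
  ... | no x≢0   = begin
    x ↑ order                      ≡⟨ cong (x ↑_) order≡1+αᵒ ⟩
    x ⊗ x ↑ αᵒ                     ≡⟨ cong (λ y → x ⊗ y ↑ αᵒ) (sym (α↑log x≢0)) ⟩
    x ⊗ (α ↑ log x≢0) ↑ αᵒ         ≡⟨ cong (x ⊗_) (↑-comm α (log x≢0) αᵒ) ⟩
    x ⊗ (α ↑ αᵒ) ↑ log x≢0         ≡⟨ cong (λ t → x ⊗ t ↑ log x≢0) α↑αᵒ≡𝟙 ⟩
    x ⊗ 𝟙 ↑ log x≢0                ≡⟨ cong (x ⊗_) (𝟙↑ (log x≢0)) ⟩
    x ⊗ 𝟙                          ≡⟨ ⊗-identityʳ x ⟩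
    x                              ∎
    where open ≡-Reasoning

-- Sums inside the field and linear independence of the conjugates.

module SumF (F : FiniteField) where
  open FieldProperties F

  sumF-cong : ∀ {f g : ℕ → Carrier} xs → (∀ j → f j ≡ g j) → sumF (map f xs) ≡ sumF (map g xs)
  sumF-cong []       eq = refl
  sumF-cong (x ∷ xs) eq = cong₂ _⊕_ (eq x) (sumF-cong xs eq)

  sumF-⊕ : ∀ (f g : ℕ → Carrier) xs → sumF (map (λ j → f j ⊕ g j) xs) ≡ sumF (map f xs) ⊕ sumF (map g xs)
  sumF-⊕ f g []       = sym (⊕-identityʳ 𝟘)
  sumF-⊕ f g (x ∷ xs) = trans (cong (f x ⊕ g x ⊕_) (sumF-⊕ f g xs)) (⊕-interchange (f x) (g x) _ _)

  sumF-⊗ : ∀ c (f : ℕ → Carrier) xs → sumF (map (λ j → c ⊗ f j) xs) ≡ c ⊗ sumF (map f xs)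
  sumF-⊗ c f []       = sym (⊗-zeroʳ c)
  sumF-⊗ c f (x ∷ xs) = trans (cong (c ⊗ f x ⊕_) (sumF-⊗ c f xs)) (sym (⊗-distribˡ-⊕ c _ _))

  sumF-suc : ∀ (f : ℕ → Carrier) n → sumF (map f (upTo (suc n))) ≡ f 0 ⊕ sumF (map (f ∘ suc) (upTo n))
  sumF-suc f n = cong (λ xs → f 0 ⊕ sumF xs) (trans (map-applyUpTo suc f n) (sym (map-upTo (f ∘ suc) n)))

  sumF-last : ∀ (f : ℕ → Carrier) n → sumF (map f (upTo (suc n))) ≡ sumF (map f (upTo n)) ⊕ f n
  sumF-last f zero    = ⊕-comm (f 0) 𝟘
  sumF-last f (suc n) = begin
    sumF (map f (upTo (suc (suc n))))                     ≡⟨ sumF-suc f (suc n) ⟩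
    f 0 ⊕ sumF (map (f ∘ suc) (upTo (suc n)))             ≡⟨ cong (f 0 ⊕_) (sumF-last (f ∘ suc) n) ⟩
    f 0 ⊕ (sumF (map (f ∘ suc) (upTo n)) ⊕ f (suc n))     ≡⟨ sym (⊕-assoc (f 0) _ _) ⟩
    f 0 ⊕ sumF (map (f ∘ suc) (upTo n)) ⊕ f (suc n)       ≡⟨ cong (_⊕ f (suc n)) (sym (sumF-suc f n)) ⟩
    sumF (map f (upTo (suc n))) ⊕ f (suc n)               ∎
    where open ≡-Reasoning

  sumF-additive : ∀ (φ : Carrier → Carrier) → φ 𝟘 ≡ 𝟘 → (∀ x y → φ (x ⊕ y) ≡ φ x ⊕ φ y) →
                  ∀ (f : ℕ → Carrier) xs → φ (sumF (map f xs)) ≡ sumF (map (φ ∘ f) xs)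
  sumF-additive φ φ0 φ⊕ f []       = φ0
  sumF-additive φ φ0 φ⊕ f (x ∷ xs) = trans (φ⊕ _ _) (cong (φ (f x) ⊕_) (sumF-additive φ φ0 φ⊕ f xs))

-- Artin's argument: comparing a relation Σ c_j x^(q^j) = 0 at x and at α x eliminates the last term.
module _ (F : FiniteField) (α : FiniteField.Carrier F) (q m : ℕ)
  (distinct : ∀ {i j} → i < j → j < m → FiniteField._^_ F α (q ℕ.^ i) ≢ FiniteField._^_ F α (q ℕ.^ j)) where

  open FieldProperties F
  open SumF F

  conjugates-independent : ∀ n → n ≤ m → (c : ℕ → Carrier) →
    (∀ x → sumF (map (λ j → c j ⊗ x ↑ (q ℕ.^ j)) (upTo n)) ≡ 𝟘) → ∀ j → j < n → c j ≡ 𝟘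
  conjugates-independent (suc n) n<m c vanish = result
    where
    open ≡-Reasoning
    T : ℕ → (ℕ → Carrier) → Carrier → Carrier
    T n c x = sumF (map (λ j → c j ⊗ x ↑ (q ℕ.^ j)) (upTo n))
    a : ℕ → Carrier
    a j = α ↑ (q ℕ.^ j)
    c′ : ℕ → Carrier
    c′ j = c j ⊗ (a j ⊕ ⊖ a n)
    termwise : ∀ x j → c′ j ⊗ x ↑ (q ℕ.^ j) ⊕ a n ⊗ (c j ⊗ x ↑ (q ℕ.^ j)) ≡ c j ⊗ (α ⊗ x) ↑ (q ℕ.^ j)
    termwise x j = begin
      c j ⊗ (a j ⊕ ⊖ a n) ⊗ y ⊕ a n ⊗ (c j ⊗ y)  ≡⟨ cong₂ _⊕_ (⊗-assoc (c j) _ y) (⊗-leftComm (a n) (c j) y) ⟩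
      c j ⊗ ((a j ⊕ ⊖ a n) ⊗ y) ⊕ c j ⊗ (a n ⊗ y) ≡⟨ sym (⊗-distribˡ-⊕ (c j) _ _) ⟩
      c j ⊗ ((a j ⊕ ⊖ a n) ⊗ y ⊕ a n ⊗ y)         ≡⟨ cong (c j ⊗_) (sym (⊗-distribʳ-⊕ y _ _)) ⟩
      c j ⊗ ((a j ⊕ ⊖ a n ⊕ a n) ⊗ y)             ≡⟨ cong (λ t → c j ⊗ (t ⊗ y)) (⊖-⊕-cancel (a j) (a n)) ⟩
      c j ⊗ (a j ⊗ y)                             ≡⟨ cong (c j ⊗_) (sym (⊗-↑ α x (q ℕ.^ j))) ⟩
      c j ⊗ (α ⊗ x) ↑ (q ℕ.^ j)                   ∎
      where y = x ↑ (q ℕ.^ j)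
    vanish′ : ∀ x → T (suc n) c′ x ≡ 𝟘
    vanish′ x = begin
      T (suc n) c′ x                               ≡⟨ sym (⊕-identityʳ _) ⟩
      T (suc n) c′ x ⊕ 𝟘
          ≡⟨ cong (T (suc n) c′ x ⊕_) (sym (trans (cong (a n ⊗_) (vanish x)) (⊗-zeroʳ (a n)))) ⟩
      T (suc n) c′ x ⊕ a n ⊗ T (suc n) c x         ≡⟨ cong (T (suc n) c′ x ⊕_) (sym (sumF-⊗ (a n) _ (upTo (suc n)))) ⟩
      T (suc n) c′ x ⊕ sumF (map (λ j → a n ⊗ (c j ⊗ x ↑ (q ℕ.^ j))) (upTo (suc n)))
                                                   ≡⟨ sym (sumF-⊕ _ _ (upTo (suc n))) ⟩
      sumF (map (λ j → c′ j ⊗ x ↑ (q ℕ.^ j) ⊕ a n ⊗ (c j ⊗ x ↑ (q ℕ.^ j))) (upTo (suc n)))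
                                                   ≡⟨ sumF-cong (upTo (suc n)) (termwise x) ⟩
      T (suc n) c (α ⊗ x)                          ≡⟨ vanish (α ⊗ x) ⟩
      𝟘                                            ∎
    c′n≡0 : c′ n ≡ 𝟘
    c′n≡0 = trans (cong (c n ⊗_) (⊖-inverseʳ (a n))) (⊗-zeroʳ (c n))
    drop-last : ∀ c x → c n ≡ 𝟘 → T (suc n) c x ≡ T n c x
    drop-last c x cn≡0 = begin
      T (suc n) c x                  ≡⟨ sumF-last _ n ⟩
      T n c x ⊕ c n ⊗ x ↑ (q ℕ.^ n)  ≡⟨ cong (λ t → T n c x ⊕ t ⊗ x ↑ (q ℕ.^ n)) cn≡0 ⟩
      T n c x ⊕ 𝟘 ⊗ x ↑ (q ℕ.^ n)    ≡⟨ cong (T n c x ⊕_) (⊗-zeroˡ _) ⟩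
      T n c x ⊕ 𝟘                    ≡⟨ ⊕-identityʳ _ ⟩
      T n c x                        ∎
    c≡0 : ∀ j → j < n → c j ≡ 𝟘
    c≡0 j j<n = ⊗≡0⇒ (λ eq → distinct j<n n<m (⊖≡0⇒≡ _ _ eq)) (trans (⊗-comm _ (c j))
      (conjugates-independent n (ℕₚ.<⇒≤ n<m) c′ (λ x → trans (sym (drop-last c′ x c′n≡0)) (vanish′ x)) j j<n))
    cn≡0 : c n ≡ 𝟘
    cn≡0 = begin
      c n                                    ≡⟨ sym (⊗-identityʳ (c n)) ⟩
      c n ⊗ 𝟙                                ≡⟨ cong (c n ⊗_) (sym (𝟙↑ (q ℕ.^ n))) ⟩
      c n ⊗ 𝟙 ↑ (q ℕ.^ n)                    ≡⟨ sym (⊕-identityˡ _) ⟩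
      𝟘 ⊕ c n ⊗ 𝟙 ↑ (q ℕ.^ n)                ≡⟨ cong (_⊕ c n ⊗ 𝟙 ↑ (q ℕ.^ n)) (sym (sumF-zero n c≡0)) ⟩
      T n c 𝟙 ⊕ c n ⊗ 𝟙 ↑ (q ℕ.^ n)          ≡⟨ sym (sumF-last _ n) ⟩
      T (suc n) c 𝟙                          ≡⟨ vanish 𝟙 ⟩
      𝟘                                      ∎
      where
      sumF-zero : ∀ k → (∀ j → j < k → c j ≡ 𝟘) → T k c 𝟙 ≡ 𝟘
      sumF-zero zero    _ = refl
      sumF-zero (suc k) h = trans (sumF-last _ k) (trans (cong₂ _⊕_ (sumF-zero k λ j j<k → h j (ℕₚ.m<n⇒m<1+n j<k))
        (trans (cong (_⊗ _) (h k (ℕₚ.n<1+n k))) (⊗-zeroˡ _))) (⊕-identityʳ 𝟘))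
    result : ∀ j → j < suc n → c j ≡ 𝟘
    result j (s≤s j≤n) with j ℕₚ.≟ n
    ... | yes refl = cn≡0
    ... | no j≢n   = c≡0 j (ℕₚ.≤∧≢⇒< j≤n j≢n)

-- The trace onto the subfield of order `q`.

module Trace (F : FiniteField) {α : FiniteField.Carrier F} (α-primitive : FiniteField.IsPrimitive F α)
  {p s m : ℕ} (p-prime : Prime p) (s≥1 : 1 ≤ s) (m≥1 : 1 ≤ m) (order≡ : FiniteField.order F ≡ (p ℕ.^ s) ℕ.^ m) where

  open FieldProperties F
  open PrimitiveElement F α-primitive
  open SumF F

  private
    q : ℕ
    q = p ℕ.^ s

  p≥2 : 2 ≤ p
  p≥2 = ℕ.nonTrivial⇒n>1 p {{prime⇒nonTrivial p-prime}}

  q≥2 : 2 ≤ q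
  q≥2 = ℕₚ.≤-trans p≥2 (ℕₚ.≤-trans (ℕₚ.≤-reflexive (sym (ℕₚ.^-identityʳ p)))
      (ℕₚ.^-monoʳ-≤ p {{prime⇒nonZero p-prime}} s≥1))

  private
    instance
      q-nonZero : NonZero q
      q-nonZero = ℕ.>-nonZero (ℕₚ.<⇒≤ q≥2)

  p·𝟙≡𝟘 : p · 𝟙 ≡ 𝟘
  p·𝟙≡𝟘 = characteristic p (s ℕ.* m) (trans order≡ (ℕₚ.^-*-assoc p s m))

  Tr : Carrier → Carrier
  Tr = trace q m

  -- Membership in `GF(q)`, which is never built as a type of its own: its elements are the roots of
  -- `X ^ q = X`.
  Fixed : Carrier → Set
  Fixed c = c ↑ q ≡ c

  private
    ⊕-↑q^ : ∀ j x y → (x ⊕ y) ↑ (q ℕ.^ j) ≡ x ↑ (q ℕ.^ j) ⊕ y ↑ (q ℕ.^ j)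
    ⊕-↑q^ j x y = subst (λ e → (x ⊕ y) ↑ e ≡ x ↑ e ⊕ y ↑ e) (sym (ℕₚ.^-*-assoc p s j))
      (frobenius^ p-prime p·𝟙≡𝟘 (s ℕ.* j) x y)

    ⊕-↑q : ∀ x y → (x ⊕ y) ↑ q ≡ x ↑ q ⊕ y ↑ q
    ⊕-↑q = frobenius^ p-prime p·𝟙≡𝟘 s

    Fixed-↑q^ : ∀ {c} → Fixed c → ∀ j → c ↑ (q ℕ.^ j) ≡ c
    Fixed-↑q^ {c} fix zero    = ⊗-identityʳ c
    Fixed-↑q^ {c} fix (suc j) = trans (↑-* c q (q ℕ.^ j)) (trans (cong (_↑ q) (Fixed-↑q^ fix j)) fix)

    -- The exponents `q ^ i` and `q ^ j` differ by less than `q ^ m - 1 = αᵒ`, so they lie within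
    -- one period of `α`.
    conjugates-distinct : ∀ {i j} → i < j → j < m → α ↑ (q ℕ.^ i) ≢ α ↑ (q ℕ.^ j)
    conjugates-distinct {i} {j} i<j j<m eq =
      <αᵒ⇒≢𝟙 (q ℕ.^ j ℕ.∸ q ℕ.^ i) (ℕₚ.m<n⇒0<n∸m q^i<q^j) small (↑-cancel (q ℕ.^ i) (ℕₚ.<⇒≤ q^i<q^j) eq)
      where
      q^i<q^j : q ℕ.^ i < q ℕ.^ j
      q^i<q^j = ℕₚ.^-monoʳ-< q q≥2 i<j
      small : q ℕ.^ j ℕ.∸ q ℕ.^ i < αᵒ
      small = begin-strict
        q ℕ.^ j ℕ.∸ q ℕ.^ i   ≤⟨ ℕₚ.∸-monoʳ-≤ (q ℕ.^ j) (ℕₚ.m^n>0 q i) ⟩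
        q ℕ.^ j ℕ.∸ 1         <⟨ ℕₚ.∸-monoˡ-< (ℕₚ.^-monoʳ-< q q≥2 j<m) (ℕₚ.m^n>0 q j) ⟩
        q ℕ.^ m ℕ.∸ 1         ≡⟨ cong (ℕ._∸ 1) (trans (sym order≡) order≡1+αᵒ) ⟩
        αᵒ                    ∎
        where open ℕₚ.≤-Reasoning

  Tr-⊕ : ∀ x y → Tr (x ⊕ y) ≡ Tr x ⊕ Tr y
  Tr-⊕ x y = trans (sumF-cong (upTo m) λ j → ⊕-↑q^ j x y) (sumF-⊕ _ _ (upTo m))

  Tr-𝟘 : Tr 𝟘 ≡ 𝟘
  Tr-𝟘 = ⊕-cancelˡ (Tr 𝟘) _ _ (trans (sym (Tr-⊕ 𝟘 𝟘)) (trans (cong Tr (⊕-identityʳ 𝟘)) (sym (⊕-identityʳ _))))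

  Tr-⊖ : ∀ x → Tr (⊖ x) ≡ ⊖ Tr x
  Tr-⊖ x = ⊕-inverseʳ-unique (Tr x) (Tr (⊖ x)) (trans (sym (Tr-⊕ x (⊖ x))) (trans (cong Tr (⊖-inverseʳ x)) Tr-𝟘))

  Tr-⊗ : ∀ {c} → Fixed c → ∀ x → Tr (c ⊗ x) ≡ c ⊗ Tr x
  Tr-⊗ {c} fix x = trans (sumF-cong (upTo m) λ j
      → trans (⊗-↑ c x (q ℕ.^ j)) (cong (_⊗ x ↑ (q ℕ.^ j)) (Fixed-↑q^ fix j)))
    (sumF-⊗ c _ (upTo m))

  -- The `q`-th power sends each conjugate to the next, and `x ↑ (q ^ m)` is `x` again. The first
  -- conjugate is added to both sides, which turns the shifted sum into one over `m + 1` conjugates,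
  -- and is then cancelled.
  Tr-Fixed : ∀ x → Fixed (Tr x)
  Tr-Fixed x = ⊕-cancelˡ (x ↑ (q ℕ.^ 0)) _ _ (begin
    f 0 ⊕ Tr x ↑ q
        ≡⟨ cong (f 0 ⊕_) (sumF-additive (_↑ q) (𝟘↑ q (ℕ.≢-nonZero⁻¹ q)) ⊕-↑q f (upTo m)) ⟩
    f 0 ⊕ sumF (map (λ j → f j ↑ q) (upTo m)) ≡⟨ cong (f 0 ⊕_) (sumF-cong (upTo m) λ j → sym (↑-* x q (q ℕ.^ j))) ⟩
    f 0 ⊕ sumF (map (f ∘ suc) (upTo m))      ≡⟨ sym (sumF-suc f m) ⟩
    sumF (map f (upTo (suc m)))              ≡⟨ sumF-last f m ⟩
    Tr x ⊕ f m                               ≡⟨ ⊕-comm _ _ ⟩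
    f m ⊕ Tr x
        ≡⟨ cong (_⊕ Tr x) (trans (cong (x ↑_) (sym order≡)) (trans (↑order x) (sym (⊗-identityʳ x)))) ⟩
    f 0 ⊕ Tr x                               ∎)
    where
    open ≡-Reasoning
    f : ℕ → Carrier
    f j = x ↑ (q ℕ.^ j)

  Tr-↑p : ∀ x → Tr (x ↑ p) ≡ Tr x ↑ p
  Tr-↑p x = sym (trans (sumF-additive (_↑ p) (𝟘↑ p (ℕ.≢-nonZero⁻¹ p {{prime⇒nonZero p-prime}}))
      (frobenius p-prime p·𝟙≡𝟘) _ (upTo m))
    (sumF-cong (upTo m) λ j → ↑-comm x (q ℕ.^ j) p))

  -- An identically vanishing trace would be a linear relation between the conjugates with all
  -- coefficients `𝟙`. One nonzero value is enough: linearity over `GF(q)` then makes the trace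
  -- onto.
  Tr≢𝟘 : ∃ λ x → Tr x ≢ 𝟘
  Tr≢𝟘 with Any.any? (λ x → ¬? (Tr x ≟ 𝟘)) elements
  ... | yes any = Any.satisfied any
  ... | no none = contradiction
    (conjugates-independent F α q m conjugates-distinct m ℕₚ.≤-refl (λ _ → 𝟙)
      (λ x → trans (sumF-cong (upTo m) λ j → ⊗-identityˡ _) (vanish x)) 0 m≥1) 1≢0
    where
    vanish : ∀ x → Tr x ≡ 𝟘
    vanish x with Tr x ≟ 𝟘
    ... | yes eq = eq
    ... | no neq = contradiction (lose (complete x) neq) none

-- Equal squares leave a choice of sign, and two integers congruent to 1 modulo 3 are never
-- opposite, as their sum is 2 modulo 3. This fixes the sign of the Gaussian period without
-- evaluating a Gauss sum.
square-root-mod-3 : ∀ a b → (1ℤ + + 3 * a) * (1ℤ + + 3 * a) ≡ (1ℤ + + 3 * b) * (1ℤ + + 3 * b) →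
                    1ℤ + + 3 * a ≡ 1ℤ + + 3 * b
square-root-mod-3 a b eq = go (ℤₚ.i*j≡0⇒i≡0∨j≡0 (1ℤ + + 3 * a - (1ℤ + + 3 * b))
  (trans (difference (1ℤ + + 3 * a) (1ℤ + + 3 * b))
      (ℤₚ.i≡j⇒i-j≡0 {(1ℤ + + 3 * a) * (1ℤ + + 3 * a)} {(1ℤ + + 3 * b) * (1ℤ + + 3 * b)} eq)))
  where
  open ≡-Reasoning
  difference : ∀ x s → (x - s) * (x + s) ≡ x * x - s * s
  difference = solve-∀
  sum : ∀ a b → + 3 * (a + b) ≡ 1ℤ + + 3 * a + (1ℤ + + 3 * b) - + 2
  sum = solve-∀
  2%3≡0 : ∀ t → + 3 * t ≡ - + 2 → 2 % 3 ≡ 0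
  2%3≡0 t e = ∣.n∣m⇒m%n≡0 2 3 (divides ℤ.∣ t ∣
      (trans (sym (cong ℤ.∣_∣ e)) (trans (ℤₚ.abs-* (+ 3) t) (ℕₚ.*-comm 3 ℤ.∣ t ∣))))
  go : (1ℤ + + 3 * a - (1ℤ + + 3 * b) ≡ 0ℤ) ⊎ (1ℤ + + 3 * a + (1ℤ + + 3 * b) ≡ 0ℤ) → 1ℤ + + 3 * a ≡ 1ℤ + + 3 * b
  go (inj₁ diff≡0) = ℤₚ.i-j≡0⇒i≡j (1ℤ + + 3 * a) (1ℤ + + 3 * b) diff≡0
  go (inj₂ sum≡0)  = contradiction (2%3≡0 (a + b) (trans (sum a b) (cong (_- + 2) sum≡0))) λ ()

-- The cubic Gaussian periods.

module Cyclotomy (F : FiniteField) {α : FiniteField.Carrier F} (α-primitive : FiniteField.IsPrimitive F α)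
  {p s m : ℕ} (p-prime : Prime p) (s≥1 : 1 ≤ s) (m≥1 : 1 ≤ m) (order≡ : FiniteField.order F ≡ (p ℕ.^ s) ℕ.^ m)
  (p%3≡2 : p % 3 ≡ 2) (v : ℕ) (3vq⁻≡αᵒ : 3 ℕ.* v ℕ.* (p ℕ.^ s ℕ.∸ 1) ≡ PrimitiveElement.αᵒ F α-primitive) where

  open FieldProperties F
  open PrimitiveElement F α-primitive
  open Trace F α-primitive p-prime s≥1 m≥1 order≡

  -- `R` is `(r - 1)/3`, the number of nonzero cubes, and `v` is their number modulo `GF(q)*`.
  q q⁻ R : ℕ
  q  = p ℕ.^ s
  q⁻ = q ℕ.∸ 1
  R  = q⁻ ℕ.* v

  q≡1+q⁻ : q ≡ suc q⁻
  q≡1+q⁻ = sym (ℕₚ.m+[n∸m]≡n (ℕₚ.<⇒≤ q≥2))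

  q⁻>0 : 0 < q⁻
  q⁻>0 = ℕₚ.m<n⇒0<n∸m q≥2

  αᵒ≡R*3 : αᵒ ≡ R ℕ.* 3
  αᵒ≡R*3 = begin
    αᵒ                 ≡⟨ sym 3vq⁻≡αᵒ ⟩
    3 ℕ.* v ℕ.* q⁻     ≡⟨ ℕₚ.*-assoc 3 v q⁻ ⟩
    3 ℕ.* (v ℕ.* q⁻)   ≡⟨ cong (3 ℕ.*_) (ℕₚ.*-comm v q⁻) ⟩
    3 ℕ.* (q⁻ ℕ.* v)   ≡⟨ ℕₚ.*-comm 3 R ⟩
    R ℕ.* 3            ∎
    where open ≡-Reasoning

  instance
    R-nonZero : NonZero R
    R-nonZero = ℕₚ.m*n≢0⇒m≢0 R {{subst NonZero αᵒ≡R*3 _}}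
    q⁻-nonZero : NonZero q⁻
    q⁻-nonZero = ℕ.>-nonZero q⁻>0
    v-nonZero : NonZero v
    v-nonZero = ℕₚ.m*n≢0⇒n≢0 q⁻

  3∣αᵒ : 3 ∣ αᵒ
  3∣αᵒ = divides R αᵒ≡R*3

  r : ℤ
  r = + order

  r≡1+3R : r ≡ 1ℤ + + 3 * + R
  r≡1+3R = begin
    + order            ≡⟨ cong +_ (trans order≡1+αᵒ (cong suc (trans αᵒ≡R*3 (ℕₚ.*-comm R 3)))) ⟩
    + (1 ℕ.+ 3 ℕ.* R)  ≡⟨ cong (_+_ 1ℤ) (ℤₚ.pos-* 3 R) ⟩
    1ℤ + + 3 * + R     ∎
    where open ≡-Reasoning

  -- A generator of `GF(q)*`, since `3 v = (r - 1)/(q - 1)`. The factor 3 makes every element of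
  -- `GF(q)*` a cube.
  θ : Carrier
  θ = α ↑ (3 ℕ.* v)

  θ≢0 : θ ≢ 𝟘
  θ≢0 = ↑≢0 (3 ℕ.* v) α≢0

  θ↑≡α↑ : ∀ j → θ ↑ j ≡ α ↑ (j ℕ.* (3 ℕ.* v))
  θ↑≡α↑ j = sym (↑-* α j (3 ℕ.* v))

  θ↑q⁻≡𝟙 : θ ↑ q⁻ ≡ 𝟙
  θ↑q⁻≡𝟙 = trans (θ↑≡α↑ q⁻) (trans (cong (α ↑_) (trans (ℕₚ.*-comm q⁻ (3 ℕ.* v)) 3vq⁻≡αᵒ)) α↑αᵒ≡𝟙)

  θ↑-Fixed : ∀ j → Fixed (θ ↑ j)
  θ↑-Fixed j = begin
    (θ ↑ j) ↑ q               ≡⟨ ↑-comm θ j q ⟩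
    (θ ↑ q) ↑ j               ≡⟨ cong (λ n → (θ ↑ n) ↑ j) q≡1+q⁻ ⟩
    (θ ⊗ θ ↑ q⁻) ↑ j          ≡⟨ cong (λ t → (θ ⊗ t) ↑ j) θ↑q⁻≡𝟙 ⟩
    (θ ⊗ 𝟙) ↑ j               ≡⟨ cong (_↑ j) (⊗-identityʳ θ) ⟩
    θ ↑ j                     ∎
    where open ≡-Reasoning

  θ↑-distinct : ∀ {i j} → i < j → j < q⁻ → θ ↑ i ≢ θ ↑ j
  θ↑-distinct {i} {j} i<j j<q⁻ eq = ↑-distinct (ℕₚ.*-monoˡ-< (3 ℕ.* v) {{ℕₚ.m*n≢0 3 v}} i<j)
    (subst (j ℕ.* (3 ℕ.* v) <_) (trans (ℕₚ.*-comm q⁻ _) 3vq⁻≡αᵒ) (ℕₚ.*-monoˡ-< (3 ℕ.* v) {{ℕₚ.m*n≢0 3 v}} j<q⁻))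
    (trans (sym (θ↑≡α↑ i)) (trans eq (θ↑≡α↑ j)))

  abstract
    -- If `y = α ↑ e`, then `y ↑ q⁻ ≡ 𝟙` gives that `αᵒ = 3 v q⁻` divides `q⁻ e`, whence `3 v`
    -- divides `e`.
    Fixed⇒θ↑ : ∀ {y} → Fixed y → y ≢ 𝟘 → ∃ λ j → j < q⁻ × θ ↑ j ≡ y
    Fixed⇒θ↑ {y} fix y≢0 = l % q⁻ , m%n<n l q⁻ , (begin
      θ ↑ (l % q⁻)                              ≡⟨ sym (⊗-identityʳ _) ⟩
      θ ↑ (l % q⁻) ⊗ 𝟙                          ≡⟨ cong (θ ↑ (l % q⁻) ⊗_) (sym (↑≡1⇒ θ (l / q⁻) q⁻ θ↑q⁻≡𝟙)) ⟩
      θ ↑ (l % q⁻) ⊗ θ ↑ (l / q⁻ ℕ.* q⁻)        ≡⟨ sym (↑-+ θ (l % q⁻) _) ⟩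
      θ ↑ (l % q⁻ ℕ.+ l / q⁻ ℕ.* q⁻)            ≡⟨ cong (θ ↑_) (sym (m≡m%n+[m/n]*n l q⁻)) ⟩
      θ ↑ l                                     ≡⟨ θ↑≡α↑ l ⟩
      α ↑ (l ℕ.* (3 ℕ.* v))                     ≡⟨ cong (α ↑_) (sym e≡l*3v) ⟩
      α ↑ log y≢0                               ≡⟨ α↑log y≢0 ⟩
      y                                         ∎)
      where
      open ≡-Reasoning
      y↑q⁻≡𝟙 : y ↑ q⁻ ≡ 𝟙
      y↑q⁻≡𝟙 = ⊗-cancelˡ _ _ y≢0 (trans (cong (y ↑_) (sym q≡1+q⁻)) (trans fix (sym (⊗-identityʳ y))))
      3v∣e : 3 ℕ.* v ∣ log y≢0
      3v∣e = ∣.*-cancelˡ-∣ q⁻ (subst (_∣ q⁻ ℕ.* log y≢0) (trans (sym 3vq⁻≡αᵒ) (ℕₚ.*-comm _ q⁻))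
        (↑≡𝟙⇒∣ (q⁻ ℕ.* log y≢0) (trans (↑-* α q⁻ (log y≢0)) (trans (cong (_↑ q⁻) (α↑log y≢0)) y↑q⁻≡𝟙))))
      l : ℕ
      l = _∣_.quotient 3v∣e
      e≡l*3v : log y≢0 ≡ l ℕ.* (3 ℕ.* v)
      e≡l*3v = _∣_.equality 3v∣e

  Fixed-⊗ : ∀ {x y} → Fixed x → Fixed y → Fixed (x ⊗ y)
  Fixed-⊗ {x} {y} fx fy = trans (⊗-↑ x y q) (cong₂ _⊗_ fx fy)

  Fixed-inverse : ∀ {x y} → x ≢ 𝟘 → Fixed x → x ⊗ y ≡ 𝟙 → Fixed y
  Fixed-inverse {x} {y} x≢0 fix xy≡1 = ⊗-cancelˡ _ _ x≢0 (begin
    x ⊗ y ↑ q      ≡⟨ cong (_⊗ y ↑ q) (sym fix) ⟩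
    x ↑ q ⊗ y ↑ q  ≡⟨ sym (⊗-↑ x y q) ⟩
    (x ⊗ y) ↑ q    ≡⟨ cong (_↑ q) xy≡1 ⟩
    𝟙 ↑ q          ≡⟨ 𝟙↑ q ⟩
    𝟙              ≡⟨ sym xy≡1 ⟩
    x ⊗ y          ∎)
    where open ≡-Reasoning

  abstract
    ∑-Fixed : ∀ {y} → Fixed y → ⟦ y ≟ 𝟘 ⟧ + ∑ (upTo q⁻) (λ j → ⟦ y ≟ θ ↑ j ⟧) ≡ 1ℤ
    ∑-Fixed {y} fix with y ≟ 𝟘
    ... | yes refl = cong (_+_ 1ℤ) (∑-zero (upTo q⁻) λ {j} _ → ⟦⟧-false (𝟘 ≟ θ ↑ j) (≢-sym (↑≢0 j θ≢0)))
    ... | no y≢0 with j , j<q⁻ , refl ← Fixed⇒θ↑ fix y≢0 = trans (ℤₚ.+-identityˡ _)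
      (trans (∑-single (λ i → ⟦ θ ↑ j ≟ θ ↑ i ⟧) (Unique.upTo⁺ q⁻) (∈-upTo⁺ j<q⁻) λ {i} i∈ i≢j
          → ⟦⟧-false (θ ↑ j ≟ θ ↑ i) (distinct (∈-upTo⁻ i∈) i≢j))
             (⟦⟧-true (θ ↑ j ≟ θ ↑ j) refl))
      where
      distinct : ∀ {i} → i < q⁻ → i ≢ j → θ ↑ j ≢ θ ↑ i
      distinct {i} i<q⁻ i≢j eq with ℕₚ.<-cmp i j
      ... | tri< i<j _ _ = θ↑-distinct i<j j<q⁻ (sym eq)
      ... | tri≈ _ i≡j _ = i≢j i≡j
      ... | tri> _ _ j<i = θ↑-distinct j<i i<q⁻ eq

  -- w x is the sum of ψ(y x) over y ∈ GF(q)*, for ψ the canonical additive character.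
  w : Carrier → ℤ
  w x = + q * ⟦ Tr x ≟ 𝟘 ⟧ - 1ℤ

  +q≡1+q⁻ : + q ≡ 1ℤ + + q⁻
  +q≡1+q⁻ = cong +_ q≡1+q⁻

  w-𝟘 : w 𝟘 ≡ + q⁻
  w-𝟘 = trans (cong₂ (λ a b → a * b - 1ℤ) +q≡1+q⁻ (⟦⟧-true (Tr 𝟘 ≟ 𝟘) Tr-𝟘)) (lem (+ q⁻))
    where
    lem : ∀ a → (1ℤ + a) * 1ℤ - 1ℤ ≡ a
    lem = solve-∀

  w-cong : ∀ x y → (Tr x ≡ 𝟘 → Tr y ≡ 𝟘) → (Tr y ≡ 𝟘 → Tr x ≡ 𝟘) → w x ≡ w y
  w-cong x y f g = cong (λ t → + q * t - 1ℤ) (⟦⟧-cong (Tr x ≟ 𝟘) (Tr y ≟ 𝟘) f g)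

  w-⊖ : ∀ x → w (⊖ x) ≡ w x
  w-⊖ x = w-cong (⊖ x) x
    (λ eq → trans (sym (⊖-involutive _)) (trans (cong ⊖_ (trans (sym (Tr-⊖ x)) eq)) ⊖𝟘≡𝟘))
    (λ eq → trans (Tr-⊖ x) (trans (cong ⊖_ eq) ⊖𝟘≡𝟘))

  w-Fixed : ∀ {c} → c ≢ 𝟘 → Fixed c → ∀ x → w (c ⊗ x) ≡ w x
  w-Fixed {c} c≢0 fix x = w-cong (c ⊗ x) x
    (λ eq → ⊗≡0⇒ c≢0 (trans (sym (Tr-⊗ fix x)) eq))
    (λ eq → trans (Tr-⊗ fix x) (trans (cong (c ⊗_) eq) (⊗-zeroʳ c)))

  w-θ : ∀ x → w (θ ⊗ x) ≡ w x
  w-θ = w-Fixed θ≢0 (subst Fixed (⊗-identityʳ θ) (θ↑-Fixed 1))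

  w-↑p : ∀ x → w (x ↑ p) ≡ w x
  w-↑p x = w-cong (x ↑ p) x (λ eq → ↑p≡0 (trans (sym (Tr-↑p x)) eq))
    (λ eq → trans (Tr-↑p x) (trans (cong (_↑ p) eq) (𝟘↑ p (ℕ.≢-nonZero⁻¹ p {{prime⇒nonZero p-prime}}))))
    where
    ↑p≡0 : Tr x ↑ p ≡ 𝟘 → Tr x ≡ 𝟘
    ↑p≡0 eq with Tr x ≟ 𝟘
    ... | yes z = z
    ... | no nz = contradiction eq (↑≢0 p nz)

  private
    unit-trace : ∃ λ x → Tr x ≡ 𝟙
    unit-trace with x , Trx≢0 ← Tr≢𝟘 with y , xy≡1 ← inverse (Tr x) Trx≢0 =
      y ⊗ x , trans (Tr-⊗ (Fixed-inverse Trx≢0 (Tr-Fixed x) xy≡1) x) (trans (⊗-comm y (Tr x)) xy≡1)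

  -- The sum is `q N - r` with `N` the size of the kernel of the trace. Translation by multiples of
  -- an element of trace `𝟙` identifies all `q` fibres with the kernel, so `r = q N`.
  ∑-w : ∑ elements w ≡ 0ℤ
  ∑-w = begin
    ∑ elements (λ x → + q * ⟦ Tr x ≟ 𝟘 ⟧ - 1ℤ)          ≡⟨ ∑-+ elements (λ x → + q * ⟦ Tr x ≟ 𝟘 ⟧) (λ _ → - 1ℤ) ⟩
    ∑ elements (λ x → + q * ⟦ Tr x ≟ 𝟘 ⟧) + ∑ elements (λ _ → - 1ℤ)
                                                        ≡⟨ cong₂ _+_ (∑-*ˡ elements (+ q) _) (∑-const elements (- 1ℤ)) ⟩
    + q * N + r * (- 1ℤ)                                ≡⟨ cong₂ (λ a b → a * N + b * (- 1ℤ)) +q≡1+q⁻ r≡ ⟩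
    (1ℤ + + q⁻) * N + (N + + q⁻ * N) * (- 1ℤ)           ≡⟨ lem (+ q⁻) N ⟩
    0ℤ                                                  ∎
    where
    open ≡-Reasoning
    lem : ∀ a n → (1ℤ + a) * n + (n + a * n) * (- 1ℤ) ≡ 0ℤ
    lem = solve-∀
    N : ℤ
    N = ∑ elements (λ x → ⟦ Tr x ≟ 𝟘 ⟧)
    x₁ : Carrier
    x₁ = proj₁ unit-trace
    fibre : ∀ j → ∑ elements (λ x → ⟦ Tr x ≟ θ ↑ j ⟧) ≡ N
    fibre j = trans (∑-cong elements λ x → ⟦⟧-cong (Tr x ≟ θ ↑ j) (Tr (x ⊕ ⊖ (θ ↑ j ⊗ x₁)) ≟ 𝟘)
        (λ eq → trans (Tr-shift x) (trans (cong (_⊕ ⊖ (θ ↑ j)) eq) (⊖-inverseʳ (θ ↑ j))))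
        (λ eq → ⊖≡0⇒≡ _ _ (trans (sym (Tr-shift x)) eq)))
      (∑-translate (⊖ (θ ↑ j ⊗ x₁)) (λ x → ⟦ Tr x ≟ 𝟘 ⟧))
      where
      Tr-shift : ∀ x → Tr (x ⊕ ⊖ (θ ↑ j ⊗ x₁)) ≡ Tr x ⊕ ⊖ (θ ↑ j)
      Tr-shift x = trans (Tr-⊕ x _) (cong (Tr x ⊕_) (trans (Tr-⊖ _) (cong ⊖_
        (trans (Tr-⊗ (θ↑-Fixed j) x₁) (trans (cong (θ ↑ j ⊗_) (proj₂ unit-trace)) (⊗-identityʳ _))))))
    r≡ : r ≡ N + + q⁻ * N
    r≡ = begin
      + length elements                           ≡⟨ sym (ℤₚ.*-identityʳ _) ⟩
      + length elements * 1ℤ                      ≡⟨ sym (∑-const elements 1ℤ) ⟩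
      ∑ elements (λ _ → 1ℤ)                       ≡⟨ (∑-cong elements λ x → sym (∑-Fixed (Tr-Fixed x))) ⟩
      ∑ elements (λ x → ⟦ Tr x ≟ 𝟘 ⟧ + ∑ (upTo q⁻) (λ j → ⟦ Tr x ≟ θ ↑ j ⟧))
        ≡⟨ ∑-+ elements (λ x → ⟦ Tr x ≟ 𝟘 ⟧) (λ x → ∑ (upTo q⁻) (λ j → ⟦ Tr x ≟ θ ↑ j ⟧)) ⟩
      N + ∑ elements (λ x → ∑ (upTo q⁻) (λ j → ⟦ Tr x ≟ θ ↑ j ⟧))
        ≡⟨ cong (_+_ N) (∑-swap elements (upTo q⁻) (λ x j → ⟦ Tr x ≟ θ ↑ j ⟧)) ⟩
      N + ∑ (upTo q⁻) (λ j → ∑ elements (λ x → ⟦ Tr x ≟ θ ↑ j ⟧))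
        ≡⟨ cong (_+_ N) (trans (∑-cong (upTo q⁻) fibre) (∑-upTo-const q⁻ N)) ⟩
      N + + q⁻ * N                                ∎

  -- In terms of `ψ`, the product is the sum of `ψ(y s + z t)` over nonzero `y`, `z` in `GF(q)`,
  -- regrouped by the ratio `- z / y = θ ↑ j`. Here it is counted directly: if `Tr t` vanishes, all
  -- summands equal `w s`; otherwise `Tr s = θ ↑ j ⊗ Tr t` has exactly one solution `j` when `Tr s`
  -- is nonzero and none when it is zero.
  w-*-w : ∀ s t → w s * w t ≡ ∑ (upTo q⁻) (λ j → w (s ⊕ ⊖ (θ ↑ j ⊗ t)))
  w-*-w s t = sym (begin
    ∑ (upTo q⁻) (λ j → + q * Z j - 1ℤ)     ≡⟨ ∑-+ (upTo q⁻) (λ j → + q * Z j) (λ _ → - 1ℤ) ⟩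
    ∑ (upTo q⁻) (λ j → + q * Z j) + ∑ (upTo q⁻) (λ _ → - 1ℤ)
                                           ≡⟨ cong₂ _+_ (∑-*ˡ (upTo q⁻) (+ q) Z) (∑-upTo-const q⁻ (- 1ℤ)) ⟩
    + q * ∑ (upTo q⁻) Z + + q⁻ * (- 1ℤ)    ≡⟨ main ⟩
    w s * w t                              ∎)
    where
    open ≡-Reasoning
    Z : ℕ → ℤ
    Z j = ⟦ Tr (s ⊕ ⊖ (θ ↑ j ⊗ t)) ≟ 𝟘 ⟧
    Tr-diff : ∀ j → Tr (s ⊕ ⊖ (θ ↑ j ⊗ t)) ≡ Tr s ⊕ ⊖ (θ ↑ j ⊗ Tr t)
    Tr-diff j = trans (Tr-⊕ s _) (cong (Tr s ⊕_) (trans (Tr-⊖ _) (cong ⊖_ (Tr-⊗ (θ↑-Fixed j) t))))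
    A : ℤ
    A = ⟦ Tr s ≟ 𝟘 ⟧
    main : + q * ∑ (upTo q⁻) Z + + q⁻ * (- 1ℤ) ≡ w s * w t
    main with Tr t ≟ 𝟘
    ... | yes Trt≡0 = trans (cong₂ (λ x y → x * y + + q⁻ * (- 1ℤ)) +q≡1+q⁻ (trans (∑-cong (upTo q⁻) λ j →
            ⟦⟧-cong (Tr (s ⊕ ⊖ (θ ↑ j ⊗ t)) ≟ 𝟘) (Tr s ≟ 𝟘) (trans (sym (same j))) (trans (same j)))
                (∑-upTo-const q⁻ A)))
          (trans (lem (+ q⁻) A) (cong (λ x → (x * A - 1ℤ) * (x * 1ℤ - 1ℤ)) (sym +q≡1+q⁻)))
      where
      same : ∀ j → Tr (s ⊕ ⊖ (θ ↑ j ⊗ t)) ≡ Tr s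
      same j = trans (Tr-diff j) (trans (cong (λ y → Tr s ⊕ ⊖ (θ ↑ j ⊗ y)) Trt≡0)
        (trans (cong (λ y → Tr s ⊕ ⊖ y) (⊗-zeroʳ _)) (trans (cong (Tr s ⊕_) ⊖𝟘≡𝟘) (⊕-identityʳ _))))
      lem : ∀ a b → (1ℤ + a) * (a * b) + a * (- 1ℤ) ≡ ((1ℤ + a) * b - 1ℤ) * ((1ℤ + a) * 1ℤ - 1ℤ)
      lem = solve-∀
    ... | no Trt≢0 = trans (cong (λ x → + q * x + + q⁻ * (- 1ℤ)) Z≡1-A)
          (trans (cong (λ x → x * (1ℤ - A) + + q⁻ * (- 1ℤ)) +q≡1+q⁻)
            (trans (lem (+ q⁻) A) (cong (λ x → (x * A - 1ℤ) * (x * 0ℤ - 1ℤ)) (sym +q≡1+q⁻))))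
      where
      lem : ∀ a b → (1ℤ + a) * (1ℤ - b) + a * (- 1ℤ) ≡ ((1ℤ + a) * b - 1ℤ) * ((1ℤ + a) * 0ℤ - 1ℤ)
      lem = solve-∀
      z y : Carrier
      z = proj₁ (inverse (Tr t) Trt≢0)
      y = z ⊗ Tr s
      zt≡1 : z ⊗ Tr t ≡ 𝟙
      zt≡1 = trans (⊗-comm z _) (proj₂ (inverse (Tr t) Trt≢0))
      yt≡s : y ⊗ Tr t ≡ Tr s
      yt≡s = trans (cong (_⊗ Tr t) (⊗-comm z (Tr s)))
          (trans (⊗-assoc _ z _) (trans (cong (Tr s ⊗_) zt≡1) (⊗-identityʳ _)))
      y-Fixed : Fixed y
      y-Fixed = Fixed-⊗ (Fixed-inverse Trt≢0 (Tr-Fixed t) (proj₂ (inverse (Tr t) Trt≢0))) (Tr-Fixed s)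
      A≡ : A ≡ ⟦ y ≟ 𝟘 ⟧
      A≡ = ⟦⟧-cong (Tr s ≟ 𝟘) (y ≟ 𝟘) (λ eq → trans (cong (z ⊗_) eq) (⊗-zeroʳ z))
        (λ eq → trans (sym yt≡s) (trans (cong (_⊗ Tr t) eq) (⊗-zeroˡ _)))
      Z≡ : ∀ j → Z j ≡ ⟦ y ≟ θ ↑ j ⟧
      Z≡ j = ⟦⟧-cong (Tr (s ⊕ ⊖ (θ ↑ j ⊗ t)) ≟ 𝟘) (y ≟ θ ↑ j)
        (λ eq → ⊗-cancelˡ _ _ Trt≢0 (trans (⊗-comm _ y) (trans yt≡s
          (trans (⊖≡0⇒≡ _ _ (trans (sym (Tr-diff j)) eq)) (⊗-comm _ (Tr t))))))
        (λ eq → trans (Tr-diff j) (trans (cong (λ x → Tr s ⊕ ⊖ x) (trans (cong (_⊗ Tr t) (sym eq)) yt≡s))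
            (⊖-inverseʳ _)))
      Z≡1-A : ∑ (upTo q⁻) Z ≡ 1ℤ - A
      Z≡1-A = trans (lem′ A (∑ (upTo q⁻) Z))
          (cong (_- A) (trans (cong₂ _+_ A≡ (∑-cong (upTo q⁻) Z≡)) (∑-Fixed y-Fixed)))
        where
        lem′ : ∀ a c → c ≡ a + c - a
        lem′ = solve-∀

  ∑-w-affine : ∀ a b → ∑ elements (λ y → w (a ⊗ y ⊕ b)) ≡ ⟦ a ≟ 𝟘 ⟧ * (r * w b)
  ∑-w-affine a b with a ≟ 𝟘
  ... | no a≢0   = trans (∑-affine b a≢0 w) (trans ∑-w (sym (ℤₚ.*-zeroˡ (r * w b))))
  ... | yes refl = trans (∑-cong elements λ y → cong w (trans (cong (_⊕ b) (⊗-zeroˡ y)) (⊕-identityˡ b)))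
                     (trans (∑-const elements (w b)) (sym (ℤₚ.*-identityˡ (r * w b))))

  -- By `w-*-w` the product is a sum of values of `w` at affine functions of `y` with slopes
  -- `b - θʲ a`. A nonzero slope contributes `∑ w = 0`; slope zero leaves the constant `w (b ⊗ x)`,
  -- counted `r` times.
  ∑-w-w : ∀ a b x → ∑ elements (λ y → w (a ⊗ y) * w (b ⊗ (x ⊕ y))) ≡
          ∑ (upTo q⁻) (λ j → ⟦ b ≟ θ ↑ j ⊗ a ⟧) * (r * w (b ⊗ x))
  ∑-w-w a b x = begin
    ∑ elements (λ y → w (a ⊗ y) * w (b ⊗ (x ⊕ y)))
      ≡⟨ (∑-cong elements λ y → trans (ℤₚ.*-comm (w (a ⊗ y)) _)
          (trans (w-*-w _ _) (∑-cong (upTo q⁻) λ j → cong w (regroup y j)))) ⟩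
    ∑ elements (λ y → ∑ (upTo q⁻) (λ j → w ((b ⊕ ⊖ (θ ↑ j ⊗ a)) ⊗ y ⊕ b ⊗ x)))
      ≡⟨ ∑-swap elements (upTo q⁻) (λ y j → w ((b ⊕ ⊖ (θ ↑ j ⊗ a)) ⊗ y ⊕ b ⊗ x)) ⟩
    ∑ (upTo q⁻) (λ j → ∑ elements (λ y → w ((b ⊕ ⊖ (θ ↑ j ⊗ a)) ⊗ y ⊕ b ⊗ x)))
      ≡⟨ (∑-cong (upTo q⁻) λ j → trans (∑-w-affine _ (b ⊗ x)) (cong (_* (r * w (b ⊗ x))) (indicator j))) ⟩
    ∑ (upTo q⁻) (λ j → ⟦ b ≟ θ ↑ j ⊗ a ⟧ * (r * w (b ⊗ x)))
      ≡⟨ ∑-*ʳ (upTo q⁻) (r * w (b ⊗ x)) (λ j → ⟦ b ≟ θ ↑ j ⊗ a ⟧) ⟩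
    ∑ (upTo q⁻) (λ j → ⟦ b ≟ θ ↑ j ⊗ a ⟧) * (r * w (b ⊗ x)) ∎
    where
    open ≡-Reasoning
    regroup : ∀ y j → b ⊗ (x ⊕ y) ⊕ ⊖ (θ ↑ j ⊗ (a ⊗ y)) ≡ (b ⊕ ⊖ (θ ↑ j ⊗ a)) ⊗ y ⊕ b ⊗ x
    regroup y j = begin
      b ⊗ (x ⊕ y) ⊕ ⊖ (θ ↑ j ⊗ (a ⊗ y))       ≡⟨ cong₂ _⊕_ (⊗-distribˡ-⊕ b x y) (cong ⊖_ (sym (⊗-assoc _ a y))) ⟩
      b ⊗ x ⊕ b ⊗ y ⊕ ⊖ (θ ↑ j ⊗ a ⊗ y)       ≡⟨ cong (b ⊗ x ⊕ b ⊗ y ⊕_) (⊖-distribˡ-⊗ _ y) ⟩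
      b ⊗ x ⊕ b ⊗ y ⊕ ⊖ (θ ↑ j ⊗ a) ⊗ y       ≡⟨ ⊕-assoc _ _ _ ⟩
      b ⊗ x ⊕ (b ⊗ y ⊕ ⊖ (θ ↑ j ⊗ a) ⊗ y)     ≡⟨ cong (b ⊗ x ⊕_) (sym (⊗-distribʳ-⊕ y b _)) ⟩
      b ⊗ x ⊕ (b ⊕ ⊖ (θ ↑ j ⊗ a)) ⊗ y         ≡⟨ ⊕-comm _ _ ⟩
      (b ⊕ ⊖ (θ ↑ j ⊗ a)) ⊗ y ⊕ b ⊗ x         ∎
    indicator : ∀ j → ⟦ b ⊕ ⊖ (θ ↑ j ⊗ a) ≟ 𝟘 ⟧ ≡ ⟦ b ≟ θ ↑ j ⊗ a ⟧
    indicator j = ⟦⟧-cong (b ⊕ ⊖ (θ ↑ j ⊗ a) ≟ 𝟘) (b ≟ θ ↑ j ⊗ a) (⊖≡0⇒≡ b _)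
      (λ eq → trans (cong (_⊕ ⊖ (θ ↑ j ⊗ a)) eq) (⊖-inverseʳ _))

  -- H x is the sum of ψ(c x) over the nonzero cubes c: each is α^(3i) times an element of GF(q)*.
  H : Carrier → ℤ
  H x = ∑ (upTo v) (λ i → w (α ↑ (3 ℕ.* i) ⊗ x))

  private
    α↑3[i%R] : ∀ l → α ↑ (3 ℕ.* (l % R)) ≡ α ↑ (3 ℕ.* l)
    α↑3[i%R] l = sym (begin
      α ↑ (3 ℕ.* l)                                       ≡⟨ cong (λ n → α ↑ (3 ℕ.* n)) (m≡m%n+[m/n]*n l R) ⟩
      α ↑ (3 ℕ.* (l % R ℕ.+ l / R ℕ.* R))                 ≡⟨ cong (α ↑_) (ℕₚ.*-distribˡ-+ 3 (l % R) _) ⟩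
      α ↑ (3 ℕ.* (l % R) ℕ.+ 3 ℕ.* (l / R ℕ.* R))         ≡⟨ ↑-+ α (3 ℕ.* (l % R)) _ ⟩
      α ↑ (3 ℕ.* (l % R)) ⊗ α ↑ (3 ℕ.* (l / R ℕ.* R))     ≡⟨ cong (λ n → α ↑ (3 ℕ.* (l % R)) ⊗ α ↑ n) rearrange ⟩
      α ↑ (3 ℕ.* (l % R)) ⊗ α ↑ (l / R ℕ.* αᵒ)            ≡⟨ cong (α ↑ (3 ℕ.* (l % R)) ⊗_) (↑≡1⇒ α (l / R) αᵒ α↑αᵒ≡𝟙) ⟩
      α ↑ (3 ℕ.* (l % R)) ⊗ 𝟙                             ≡⟨ ⊗-identityʳ _ ⟩
      α ↑ (3 ℕ.* (l % R))                                 ∎)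
      where
      open ≡-Reasoning
      rearrange : 3 ℕ.* (l / R ℕ.* R) ≡ l / R ℕ.* αᵒ
      rearrange = trans (ℕₚ.*-comm 3 (l / R ℕ.* R)) (trans (ℕₚ.*-assoc (l / R) R 3) (cong (l / R ℕ.*_) (sym αᵒ≡R*3)))

    [3l+a]%3 : ∀ l a → (3 ℕ.* l ℕ.+ a) % 3 ≡ a % 3
    [3l+a]%3 l a = trans (cong (_% 3) (trans (ℕₚ.+-comm _ a) (cong (a ℕ.+_) (ℕₚ.*-comm 3 l)))) ([m+kn]%n≡m%n a l 3)

    -- Since 3 divides `αᵒ`, the quotient `α ↑ b / α ↑ a` is a cube exactly when the exponents agree
    -- modulo 3, and then it is `α ↑ (3 l)` for a single `l < R`.
    cube-count-flat : ∀ a b → ∑ (upTo R) (λ l → ⟦ α ↑ b ≟ α ↑ (3 ℕ.* l ℕ.+ a) ⟧) ≡ ⟦ b % 3 ℕₚ.≟ a % 3 ⟧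
    cube-count-flat a b with b % 3 ℕₚ.≟ a % 3
    ... | no b≢a = ∑-zero (upTo R) λ {l} _ → ⟦⟧-false (α ↑ b ≟ α ↑ (3 ℕ.* l ℕ.+ a)) λ eq →
            b≢a (trans (↑-injective-%∣ 3∣αᵒ b (3 ℕ.* l ℕ.+ a) eq) ([3l+a]%3 l a))
    ... | yes b≡a = trans (∑-single (λ l → ⟦ α ↑ b ≟ α ↑ (3 ℕ.* l ℕ.+ a) ⟧) (Unique.upTo⁺ R) (∈-upTo⁺ (m%n<n l₀ R))
            λ {l} l∈ l≢ → ⟦⟧-false (α ↑ b ≟ α ↑ (3 ℕ.* l ℕ.+ a)) λ eq → l≢ (unique-l (∈-upTo⁻ l∈) (trans (sym eq) hit)))
            (⟦⟧-true (α ↑ b ≟ α ↑ (3 ℕ.* (l₀ % R) ℕ.+ a)) hit)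
      where
      -- Adding a multiple of `αᵒ` to `b` keeps the subtraction of `a` inside the naturals and
      -- changes neither `α ↑ b` nor the residue modulo 3.
      a≤b+aαᵒ : a ≤ b ℕ.+ a ℕ.* αᵒ
      a≤b+aαᵒ = ℕₚ.≤-trans (ℕₚ.m≤m*n a αᵒ) (ℕₚ.m≤n+m _ b)
      3∣diff : 3 ∣ (b ℕ.+ a ℕ.* αᵒ) ℕ.∸ a
      3∣diff = ≡-mod⇒∣ a (b ℕ.+ a ℕ.* αᵒ) 3 a≤b+aαᵒ (trans (sym b≡a) (sym (trans
        (cong (λ n → (b ℕ.+ n) % 3) (trans (cong (a ℕ.*_) αᵒ≡R*3) (sym (ℕₚ.*-assoc a R 3))))
            ([m+kn]%n≡m%n b (a ℕ.* R) 3))))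
      l₀ : ℕ
      l₀ = _∣_.quotient 3∣diff
      l₀-eq : 3 ℕ.* l₀ ℕ.+ a ≡ b ℕ.+ a ℕ.* αᵒ
      l₀-eq = trans (cong (ℕ._+ a) (trans (ℕₚ.*-comm 3 l₀) (sym (_∣_.equality 3∣diff)))) (ℕₚ.m∸n+n≡m a≤b+aαᵒ)
      hit : α ↑ b ≡ α ↑ (3 ℕ.* (l₀ % R) ℕ.+ a)
      hit = sym (begin
        α ↑ (3 ℕ.* (l₀ % R) ℕ.+ a)         ≡⟨ ↑-+ α (3 ℕ.* (l₀ % R)) a ⟩
        α ↑ (3 ℕ.* (l₀ % R)) ⊗ α ↑ a       ≡⟨ cong (_⊗ α ↑ a) (α↑3[i%R] l₀) ⟩
        α ↑ (3 ℕ.* l₀) ⊗ α ↑ a             ≡⟨ sym (↑-+ α (3 ℕ.* l₀) a) ⟩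
        α ↑ (3 ℕ.* l₀ ℕ.+ a)               ≡⟨ cong (α ↑_) l₀-eq ⟩
        α ↑ (b ℕ.+ a ℕ.* αᵒ)               ≡⟨ ↑-+ α b _ ⟩
        α ↑ b ⊗ α ↑ (a ℕ.* αᵒ)             ≡⟨ cong (α ↑ b ⊗_) (↑≡1⇒ α a αᵒ α↑αᵒ≡𝟙) ⟩
        α ↑ b ⊗ 𝟙                          ≡⟨ ⊗-identityʳ _ ⟩
        α ↑ b                              ∎)
        where open ≡-Reasoning
      3*< : ∀ {l} → l < R → 3 ℕ.* l < αᵒ
      3*< {l} l<R = subst (3 ℕ.* l <_) (trans (ℕₚ.*-comm 3 R) (sym αᵒ≡R*3)) (ℕₚ.*-monoʳ-< 3 l<R)
      unique-l : ∀ {l l′} → l < R → α ↑ (3 ℕ.* l ℕ.+ a) ≡ α ↑ (3 ℕ.* (l′ % R) ℕ.+ a) → l ≡ l′ % R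
      unique-l {l} {l′} l<R eq = ℕₚ.*-cancelˡ-≡ l (l′ % R) 3 (begin
        3 ℕ.* l                      ≡⟨ sym (m<n⇒m%n≡m (3*< l<R)) ⟩
        (3 ℕ.* l) % αᵒ               ≡⟨ ↑-injective-% (3 ℕ.* l) (3 ℕ.* (l′ % R)) (⊗-cancelˡ _ _ (↑≢0 a α≢0)
          (trans (⊗-comm _ _) (trans (sym (↑-+ α (3 ℕ.* l) a))
              (trans eq (trans (↑-+ α (3 ℕ.* (l′ % R)) a) (⊗-comm _ _)))))) ⟩
        (3 ℕ.* (l′ % R)) % αᵒ        ≡⟨ m<n⇒m%n≡m (3*< (m%n<n l′ R)) ⟩
        3 ℕ.* (l′ % R)               ∎)
        where open ≡-Reasoning

  -- With `l = j v + i` the element `θ ↑ j ⊗ α ↑ (3 i)` is `α ↑ (3 l)`, so the pairs `(i , j)` run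
  -- through the nonzero cubes once each.
  cube-count : ∀ a b → ∑ (upTo v) (λ i → ∑ (upTo q⁻) (λ j → ⟦ α ↑ b ≟ θ ↑ j ⊗ (α ↑ (3 ℕ.* i) ⊗ α ↑ a) ⟧))
      ≡ ⟦ b % 3 ℕₚ.≟ a % 3 ⟧
  cube-count a b = begin
    ∑ (upTo v) (λ i → ∑ (upTo q⁻) (λ j → ⟦ α ↑ b ≟ θ ↑ j ⊗ (α ↑ (3 ℕ.* i) ⊗ α ↑ a) ⟧))
      ≡⟨ ∑-swap (upTo v) (upTo q⁻) (λ i j → ⟦ α ↑ b ≟ θ ↑ j ⊗ (α ↑ (3 ℕ.* i) ⊗ α ↑ a) ⟧) ⟩
    ∑ (upTo q⁻) (λ j → ∑ (upTo v) (λ i → ⟦ α ↑ b ≟ θ ↑ j ⊗ (α ↑ (3 ℕ.* i) ⊗ α ↑ a) ⟧))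
      ≡⟨ (∑-cong (upTo q⁻) λ j → ∑-cong (upTo v) λ i → cong (λ x → ⟦ α ↑ b ≟ x ⟧) (collect i j)) ⟩
    ∑ (upTo q⁻) (λ j → ∑ (upTo v) (λ i → ⟦ α ↑ b ≟ α ↑ (3 ℕ.* (j ℕ.* v ℕ.+ i) ℕ.+ a) ⟧))
      ≡⟨ sym (∑-upTo-* q⁻ v (λ l → ⟦ α ↑ b ≟ α ↑ (3 ℕ.* l ℕ.+ a) ⟧)) ⟩
    ∑ (upTo R) (λ l → ⟦ α ↑ b ≟ α ↑ (3 ℕ.* l ℕ.+ a) ⟧)
      ≡⟨ cube-count-flat a b ⟩
    ⟦ b % 3 ℕₚ.≟ a % 3 ⟧ ∎
    where
    open ≡-Reasoning
    collect : ∀ i j → θ ↑ j ⊗ (α ↑ (3 ℕ.* i) ⊗ α ↑ a) ≡ α ↑ (3 ℕ.* (j ℕ.* v ℕ.+ i) ℕ.+ a)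
    collect i j = begin
      θ ↑ j ⊗ (α ↑ (3 ℕ.* i) ⊗ α ↑ a)                      ≡⟨ cong₂ _⊗_ (θ↑≡α↑ j) (sym (↑-+ α (3 ℕ.* i) a)) ⟩
      α ↑ (j ℕ.* (3 ℕ.* v)) ⊗ α ↑ (3 ℕ.* i ℕ.+ a)          ≡⟨ sym (↑-+ α (j ℕ.* (3 ℕ.* v)) _) ⟩
      α ↑ (j ℕ.* (3 ℕ.* v) ℕ.+ (3 ℕ.* i ℕ.+ a))            ≡⟨ cong (α ↑_) (lem i j v a) ⟩
      α ↑ (3 ℕ.* (j ℕ.* v ℕ.+ i) ℕ.+ a)                    ∎
      where
      lem : ∀ i j v a → j ℕ.* (3 ℕ.* v) ℕ.+ (3 ℕ.* i ℕ.+ a) ≡ 3 ℕ.* (j ℕ.* v ℕ.+ i) ℕ.+ a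
      lem = ℕ-solve-∀

  -- After expansion of both factors, `∑-w-w` keeps only the pairs of cubes whose coefficients
  -- differ by an element of `GF(q)*`. For each cube of the second factor, `cube-count` finds
  -- exactly one partner if the two classes agree and none otherwise, so the double sum collapses to
  -- `r` times one `H`.
  H-convolution : ∀ e f x → ∑ elements (λ y → H (α ↑ e ⊗ y) * H (α ↑ f ⊗ (x ⊕ y))) ≡
                  ⟦ f % 3 ℕₚ.≟ e % 3 ⟧ * (r * H (α ↑ f ⊗ x))
  H-convolution e f x = begin
    ∑ elements (λ y → H (α ↑ e ⊗ y) * H (α ↑ f ⊗ (x ⊕ y)))
      ≡⟨ (∑-cong elements λ y → trans
          (∑-*-∑ V V (λ i → w (α ↑ (3 ℕ.* i) ⊗ (α ↑ e ⊗ y))) (λ i′ → w (α ↑ (3 ℕ.* i′) ⊗ (α ↑ f ⊗ (x ⊕ y)))))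
           (∑-cong V λ i → ∑-cong V λ i′ → cong₂ (λ s t → w s * w t) (sym (⊗-assoc _ _ y))
               (sym (⊗-assoc _ _ (x ⊕ y))))) ⟩
    ∑ elements (λ y → ∑ V (λ i → ∑ V (λ i′ → G i i′ y)))
      ≡⟨ ∑-swap elements V (λ y i → ∑ V (λ i′ → G i i′ y)) ⟩
    ∑ V (λ i → ∑ elements (λ y → ∑ V (λ i′ → G i i′ y)))
      ≡⟨ (∑-cong V λ i → trans (∑-swap elements V (λ y i′ → G i i′ y)) (∑-cong V λ i′ → ∑-w-w (A i) (B i′) x)) ⟩
    ∑ V (λ i → ∑ V (λ i′ → N i i′ * (r * w (B i′ ⊗ x))))
      ≡⟨ ∑-swap V V (λ i i′ → N i i′ * (r * w (B i′ ⊗ x))) ⟩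
    ∑ V (λ i′ → ∑ V (λ i → N i i′ * (r * w (B i′ ⊗ x))))
      ≡⟨ (∑-cong V λ i′ → trans (∑-*ʳ V (r * w (B i′ ⊗ x)) (λ i → N i i′))
           (cong₂ (λ c t → c * (r * w t)) (count i′) (⊗-assoc _ _ x))) ⟩
    ∑ V (λ i′ → K * (r * w (α ↑ (3 ℕ.* i′) ⊗ (α ↑ f ⊗ x))))
      ≡⟨ ∑-*ˡ V K (λ i′ → r * w (α ↑ (3 ℕ.* i′) ⊗ (α ↑ f ⊗ x))) ⟩
    K * ∑ V (λ i′ → r * w (α ↑ (3 ℕ.* i′) ⊗ (α ↑ f ⊗ x)))
      ≡⟨ cong (K *_) (∑-*ˡ V r (λ i′ → w (α ↑ (3 ℕ.* i′) ⊗ (α ↑ f ⊗ x)))) ⟩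
    K * (r * H (α ↑ f ⊗ x)) ∎
    where
    open ≡-Reasoning
    V : List ℕ
    V = upTo v
    A B : ℕ → Carrier
    A i = α ↑ (3 ℕ.* i) ⊗ α ↑ e
    B i = α ↑ (3 ℕ.* i) ⊗ α ↑ f
    G : ℕ → ℕ → Carrier → ℤ
    G i i′ y = w (A i ⊗ y) * w (B i′ ⊗ (x ⊕ y))
    N : ℕ → ℕ → ℤ
    N i i′ = ∑ (upTo q⁻) (λ j → ⟦ B i′ ≟ θ ↑ j ⊗ A i ⟧)
    K : ℤ
    K = ⟦ f % 3 ℕₚ.≟ e % 3 ⟧
    count : ∀ i′ → ∑ V (λ i → N i i′) ≡ K
    count i′ = begin
      ∑ V (λ i → N i i′)
        ≡⟨ (∑-cong V λ i → ∑-cong (upTo q⁻) λ j → cong (λ b → ⟦ b ≟ θ ↑ j ⊗ A i ⟧) (sym (↑-+ α (3 ℕ.* i′) f))) ⟩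
      ∑ V (λ i → ∑ (upTo q⁻) (λ j → ⟦ α ↑ (3 ℕ.* i′ ℕ.+ f) ≟ θ ↑ j ⊗ A i ⟧))
        ≡⟨ cube-count e (3 ℕ.* i′ ℕ.+ f) ⟩
      ⟦ (3 ℕ.* i′ ℕ.+ f) % 3 ℕₚ.≟ e % 3 ⟧
        ≡⟨ cong (λ n → ⟦ n ℕₚ.≟ e % 3 ⟧) ([3l+a]%3 i′ f) ⟩
      K ∎

  H-𝟘 : H 𝟘 ≡ + R
  H-𝟘 = trans (∑-cong (upTo v) λ i → trans (cong w (⊗-zeroʳ _)) w-𝟘)
    (trans (∑-upTo-const v (+ q⁻)) (trans (sym (ℤₚ.pos-* v q⁻)) (cong +_ (ℕₚ.*-comm v q⁻))))

  H-⊖ : ∀ x → H (⊖ x) ≡ H x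
  H-⊖ x = ∑-cong (upTo v) λ i → trans (cong w (sym (⊖-distribʳ-⊗ _ x))) (w-⊖ _)

  ∑-H : ∀ e → ∑ elements (λ x → H (α ↑ e ⊗ x)) ≡ 0ℤ
  ∑-H e = trans (∑-scale (↑≢0 e α≢0) H) (trans (∑-swap elements (upTo v) (λ x i → w (α ↑ (3 ℕ.* i) ⊗ x)))
    (∑-zero (upTo v) λ {i} _ → trans (∑-scale (↑≢0 (3 ℕ.* i) α≢0) w) ∑-w))

  -- A step of `v` multiplies the argument by `θ`, an element of `GF(q)*`, to which `w` is blind.
  w-α↑3-periodic : ∀ x → Periodic v (λ i → w (α ↑ (3 ℕ.* i) ⊗ x))
  w-α↑3-periodic x i = begin
    w (α ↑ (3 ℕ.* (v ℕ.+ i)) ⊗ x)        ≡⟨ cong (λ n → w (α ↑ n ⊗ x)) (ℕₚ.*-distribˡ-+ 3 v i) ⟩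
    w (α ↑ (3 ℕ.* v ℕ.+ 3 ℕ.* i) ⊗ x)    ≡⟨ cong (λ t → w (t ⊗ x)) (↑-+ α (3 ℕ.* v) _) ⟩
    w (θ ⊗ α ↑ (3 ℕ.* i) ⊗ x)            ≡⟨ cong w (⊗-assoc θ _ x) ⟩
    w (θ ⊗ (α ↑ (3 ℕ.* i) ⊗ x))          ≡⟨ w-θ _ ⟩
    w (α ↑ (3 ℕ.* i) ⊗ x)                ∎
    where open ≡-Reasoning

  H-α³ : ∀ x → H (α ↑ 3 ⊗ x) ≡ H x
  H-α³ x = trans (∑-cong (upTo v) λ i → cong w (trans (sym (⊗-assoc _ _ x)) (cong (_⊗ x)
      (trans (sym (↑-+ α (3 ℕ.* i) 3)) (cong (α ↑_) (trans (ℕₚ.+-comm _ 3) (sym (ℕₚ.*-suc 3 i))))))))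
    (∑-periodic-suc {v} {λ i → w (α ↑ (3 ℕ.* i) ⊗ x)} (w-α↑3-periodic x))

  H-α↑3* : ∀ l x → H (α ↑ (3 ℕ.* l) ⊗ x) ≡ H x
  H-α↑3* zero    x = cong H (⊗-identityˡ x)
  H-α↑3* (suc l) x = begin
    H (α ↑ (3 ℕ.* suc l) ⊗ x)          ≡⟨ cong (λ n → H (α ↑ n ⊗ x)) (ℕₚ.*-suc 3 l) ⟩
    H (α ↑ (3 ℕ.+ 3 ℕ.* l) ⊗ x)        ≡⟨ cong (λ t → H (t ⊗ x)) (↑-+ α 3 (3 ℕ.* l)) ⟩
    H (α ↑ 3 ⊗ α ↑ (3 ℕ.* l) ⊗ x)      ≡⟨ cong H (⊗-assoc (α ↑ 3) _ x) ⟩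
    H (α ↑ 3 ⊗ (α ↑ (3 ℕ.* l) ⊗ x))    ≡⟨ H-α³ _ ⟩
    H (α ↑ (3 ℕ.* l) ⊗ x)              ≡⟨ H-α↑3* l x ⟩
    H x                                ∎
    where open ≡-Reasoning

  H-α↑% : ∀ e x → H (α ↑ e ⊗ x) ≡ H (α ↑ (e % 3) ⊗ x)
  H-α↑% e x = begin
    H (α ↑ e ⊗ x)
        ≡⟨ cong (λ n → H (α ↑ n ⊗ x)) (trans (m≡m%n+[m/n]*n e 3)
        (trans (ℕₚ.+-comm (e % 3) _) (cong (ℕ._+ e % 3) (ℕₚ.*-comm (e / 3) 3)))) ⟩
    H (α ↑ (3 ℕ.* (e / 3) ℕ.+ e % 3) ⊗ x)           ≡⟨ cong (λ t → H (t ⊗ x)) (↑-+ α (3 ℕ.* (e / 3)) (e % 3)) ⟩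
    H (α ↑ (3 ℕ.* (e / 3)) ⊗ α ↑ (e % 3) ⊗ x)       ≡⟨ cong H (⊗-assoc _ _ x) ⟩
    H (α ↑ (3 ℕ.* (e / 3)) ⊗ (α ↑ (e % 3) ⊗ x))     ≡⟨ H-α↑3* (e / 3) _ ⟩
    H (α ↑ (e % 3) ⊗ x)                             ∎
    where open ≡-Reasoning

  η : ℕ → ℤ
  η e = H (α ↑ e)

  η-% : ∀ e → η e ≡ η (e % 3)
  η-% e = trans (cong H (sym (⊗-identityʳ _))) (trans (H-α↑% e 𝟙) (cong H (⊗-identityʳ _)))

  private
    ∣p⇒≡ : ∀ {d} → d ∣ p → d ≡ 1 ⊎ d ≡ p
    ∣p⇒≡ = prime⇒irreducible p-prime

    -- The prime divides `r = q ^ m`, while `v` divides `αᵒ = r - 1`.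
    p∤v : ¬ p ∣ v
    p∤v p∣v = ℕₚ.<⇒≢ p≥2 (sym (∣.∣1⇒≡1
        (∣.∣m+n∣m⇒∣n (subst (p ∣_) (trans (trans (sym order≡) order≡1+αᵒ) (ℕₚ.+-comm 1 αᵒ)) p∣q^m) p∣αᵒ)))
      where
      p∣αᵒ : p ∣ αᵒ
      p∣αᵒ = subst (p ∣_) 3vq⁻≡αᵒ (∣.∣m⇒∣m*n q⁻ (∣.∣n⇒∣m*n 3 p∣v))
      p∣^ : ∀ {b n} → p ∣ b → 1 ≤ n → p ∣ b ℕ.^ n
      p∣^ {b} {suc n} p∣b _ = ∣.∣m⇒∣m*n (b ℕ.^ n) p∣b
      p∣q^m : p ∣ (p ℕ.^ s) ℕ.^ m
      p∣q^m = p∣^ (p∣^ ∣.∣-refl s≥1) m≥1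

    v-p-coprime : Coprime v p
    v-p-coprime (d∣v , d∣p) with ∣p⇒≡ d∣p
    ... | inj₁ d≡1  = d≡1
    ... | inj₂ refl = contradiction d∣v p∤v

  -- The Frobenius x ↦ x^p fixes the kernel of Tr and, as p ≡ 2 mod 3, swaps the two noncubic classes.
  η₁≡η₂ : η 1 ≡ η 2
  η₁≡η₂ = sym (begin
    η 2                                                   ≡⟨ cong η (sym p%3≡2) ⟩
    η (p % 3)                                             ≡⟨ sym (η-% p) ⟩
    -- Replacing `i` by `p i` permutes the period and turns each argument into a `p`-th power, where
    -- `w` takes the same value as at the root.
    ∑ (upTo v) (λ i → w (α ↑ (3 ℕ.* i) ⊗ α ↑ p))
        ≡⟨ sym (∑-periodic-coprime (w-α↑3-periodic (α ↑ p)) p v-p-coprime) ⟩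
    ∑ (upTo v) (λ i → w (α ↑ (3 ℕ.* (p ℕ.* i)) ⊗ α ↑ p))
        ≡⟨ (∑-cong (upTo v) λ i → trans (cong w (p-th-power i)) (w-↑p _)) ⟩
    ∑ (upTo v) (λ i → w (α ↑ (3 ℕ.* i) ⊗ α))              ≡⟨ cong H (sym (⊗-identityʳ α)) ⟩
    η 1                                                   ∎)
    where
    open ≡-Reasoning
    p-th-power : ∀ i → α ↑ (3 ℕ.* (p ℕ.* i)) ⊗ α ↑ p ≡ (α ↑ (3 ℕ.* i) ⊗ α) ↑ p
    p-th-power i = trans (cong (_⊗ α ↑ p) (trans (cong (α ↑_) (lem p i)) (↑-* α p (3 ℕ.* i)))) (sym (⊗-↑ _ α p))
      where
      lem : ∀ p i → 3 ℕ.* (p ℕ.* i) ≡ p ℕ.* (3 ℕ.* i)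
      lem = ℕ-solve-∀

  -- A function constant on the cubic classes takes each of its three values `R` times on the
  -- nonzero elements.
  ∑-elements-classes : ∀ f → (∀ e → f (α ↑ e) ≡ f (α ↑ (e % 3))) →
    ∑ elements f ≡ f 𝟘 + + R * (f (α ↑ 0) + (f (α ↑ 1) + (f (α ↑ 2) + 0ℤ)))
  ∑-elements-classes f f-% = begin
    ∑ elements f                                            ≡⟨ ∑-elements f ⟩
    f 𝟘 + ∑ (upTo αᵒ) (λ i → f (α ↑ i))                     ≡⟨ cong (λ n → f 𝟘 + ∑ (upTo n) (λ i → f (α ↑ i))) αᵒ≡R*3 ⟩
    f 𝟘 + ∑ (upTo (R ℕ.* 3)) (λ i → f (α ↑ i))              ≡⟨ cong (_+_ (f 𝟘)) (∑-upTo-* R 3 (λ i → f (α ↑ i))) ⟩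
    f 𝟘 + ∑ (upTo R) (λ i → ∑ (upTo 3) (λ j → f (α ↑ (i ℕ.* 3 ℕ.+ j))))
      ≡⟨ cong (_+_ (f 𝟘)) (∑-cong (upTo R) λ i → ∑-cong∈ (upTo 3) λ {j} j∈ → trans (f-% (i ℕ.* 3 ℕ.+ j))
           (cong (λ n → f (α ↑ n)) (trans (cong (_% 3) (ℕₚ.+-comm (i ℕ.* 3) j))
               (trans ([m+kn]%n≡m%n j i 3) (m<n⇒m%n≡m (∈-upTo⁻ j∈)))))) ⟩
    f 𝟘 + ∑ (upTo R) (λ _ → ∑ (upTo 3) (λ j → f (α ↑ j)))   ≡⟨ cong (_+_ (f 𝟘)) (∑-upTo-const R _) ⟩
    f 𝟘 + + R * (f (α ↑ 0) + (f (α ↑ 1) + (f (α ↑ 2) + 0ℤ))) ∎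
    where open ≡-Reasoning

  -- `H` sums to zero over the field, and its value at `𝟘` is `R`, so cancelling `R` gives
  -- `1 + η₀ + η₁ + η₂ = 0`.
  ∑-η : η 0 ≡ - 1ℤ - + 2 * η 1
  ∑-η = ℤₚ.*-cancelˡ-≡ (+ R) (η 0) (- 1ℤ - + 2 * η 1) (begin
    + R * η 0                                                     ≡⟨ lem (+ R) (η 0) (η 1) ⟩
    + R + + R * (η 0 + (η 1 + (η 1 + 0ℤ))) + + R * (- 1ℤ - + 2 * η 1)
      ≡⟨ cong₂ (λ a b → a + + R * (η 0 + (η 1 + (b + 0ℤ))) + + R * (- 1ℤ - + 2 * η 1)) (sym H-𝟘) η₁≡η₂ ⟩
    H 𝟘 + + R * (η 0 + (η 1 + (η 2 + 0ℤ))) + + R * (- 1ℤ - + 2 * η 1)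
      ≡⟨ cong (_+ + R * (- 1ℤ - + 2 * η 1)) (sym (∑-elements-classes H η-%)) ⟩
    ∑ elements H + + R * (- 1ℤ - + 2 * η 1)
      ≡⟨ cong (_+ + R * (- 1ℤ - + 2 * η 1)) (trans (∑-cong elements λ x → cong H (sym (⊗-identityˡ x))) (∑-H 0)) ⟩
    0ℤ + + R * (- 1ℤ - + 2 * η 1)                                 ≡⟨ ℤₚ.+-identityˡ _ ⟩
    + R * (- 1ℤ - + 2 * η 1)                                      ∎)
    where
    open ≡-Reasoning
    lem : ∀ a x y → a * x ≡ a + a * (x + (y + (y + 0ℤ))) + a * (- 1ℤ - + 2 * y)
    lem = solve-∀

  -- The convolution of `H` with itself at the shift `𝟘` gives `∑ H² = r R`; the common factor `R`
  -- is cancelled.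
  ∑-η² : + R + (η 0 * η 0 + (η 1 * η 1 + (η 1 * η 1 + 0ℤ))) ≡ r
  ∑-η² = ℤₚ.*-cancelˡ-≡ (+ R) (+ R + (η 0 * η 0 + (η 1 * η 1 + (η 1 * η 1 + 0ℤ)))) r (begin
    + R * (+ R + (η 0 * η 0 + (η 1 * η 1 + (η 1 * η 1 + 0ℤ))))
        ≡⟨ ℤₚ.*-distribˡ-+ (+ R) (+ R) (η 0 * η 0 + (η 1 * η 1 + (η 1 * η 1 + 0ℤ))) ⟩
    + R * + R + + R * (η 0 * η 0 + (η 1 * η 1 + (η 1 * η 1 + 0ℤ)))
      ≡⟨ cong₂ (λ a b → a * a + + R * (η 0 * η 0 + (η 1 * η 1 + (b * b + 0ℤ)))) (sym H-𝟘) η₁≡η₂ ⟩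
    H 𝟘 * H 𝟘 + + R * (η 0 * η 0 + (η 1 * η 1 + (η 2 * η 2 + 0ℤ)))
      ≡⟨ sym (∑-elements-classes (λ x → H x * H x) (λ e → cong₂ _*_ (η-% e) (η-% e))) ⟩
    ∑ elements (λ x → H x * H x)
      ≡⟨ (∑-cong elements λ x → cong₂ (λ a b → H a * H b) (sym (⊗-identityˡ x))
          (sym (trans (⊗-identityˡ _) (⊕-identityˡ x)))) ⟩
    ∑ elements (λ x → H (α ↑ 0 ⊗ x) * H (α ↑ 0 ⊗ (𝟘 ⊕ x)))      ≡⟨ H-convolution 0 0 𝟘 ⟩
    1ℤ * (r * H (α ↑ 0 ⊗ 𝟘))                                    ≡⟨ ℤₚ.*-identityˡ (r * H (α ↑ 0 ⊗ 𝟘)) ⟩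
    r * H (α ↑ 0 ⊗ 𝟘)                                           ≡⟨ cong (r *_) (trans (cong H (⊗-zeroʳ _)) H-𝟘) ⟩
    r * + R                                                     ≡⟨ ℤₚ.*-comm r (+ R) ⟩
    + R * r                                                     ∎)
    where open ≡-Reasoning

  module _ (S σ : ℤ) (S²≡r : S * S ≡ r) (S≡1+3σ : S ≡ 1ℤ + + 3 * σ) where

    private
      X : ℤ
      X = 1ℤ + + 3 * η 1

      -- With `η₀ = -1 - 2 η₁` the sum of the three squares is `6 η₁² + 4 η₁ + 1`, and three times
      -- this is `2 X² + 1`. Working with `2 X²` avoids division.
      X²≡r : X * X ≡ r
      X²≡r = ℤₚ.*-cancelˡ-≡ (+ 2) (X * X) r (begin
        + 2 * (X * X)                                ≡⟨ lem₁ (η 1) (+ R) ⟩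
        + 3 * (+ R + E (- 1ℤ - + 2 * η 1)) - (1ℤ + + 3 * + R)
                                                     ≡⟨ cong₂ (λ a b → + 3 * (+ R + E a) - b) (sym ∑-η) (sym r≡1+3R) ⟩
        + 3 * (+ R + E (η 0)) - r                    ≡⟨ cong (λ a → + 3 * a - r) ∑-η² ⟩
        + 3 * r - r                                  ≡⟨ lem₂ r ⟩
        + 2 * r                                      ∎)
        where
        open ≡-Reasoning
        E : ℤ → ℤ
        E a = a * a + (η 1 * η 1 + (η 1 * η 1 + 0ℤ))
        lem₁ : ∀ y R → + 2 * ((1ℤ + + 3 * y) * (1ℤ + + 3 * y)) ≡
               + 3 * (R + ((- 1ℤ - + 2 * y) * (- 1ℤ - + 2 * y) + (y * y + (y * y + 0ℤ)))) - (1ℤ + + 3 * R)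
        lem₁ = solve-∀
        lem₂ : ∀ r → + 3 * r - r ≡ + 2 * r
        lem₂ = solve-∀

      X≡S : X ≡ S
      X≡S = trans (square-root-mod-3 (η 1) σ (trans X²≡r (trans (sym S²≡r) (cong (λ t → t * t) S≡1+3σ)))) (sym S≡1+3σ)

    3η₁ : + 3 * η 1 ≡ S - 1ℤ
    3η₁ = trans (lem (η 1)) (cong (_- 1ℤ) X≡S)
      where
      lem : ∀ y → + 3 * y ≡ 1ℤ + + 3 * y - 1ℤ
      lem = solve-∀

    3η₀ : + 3 * η 0 ≡ - 1ℤ - + 2 * S
    3η₀ = trans (cong (+ 3 *_) ∑-η) (trans (lem (η 1)) (cong (λ a → - 1ℤ - + 2 * a) X≡S))
      where
      lem : ∀ y → + 3 * (- 1ℤ - + 2 * y) ≡ - 1ℤ - + 2 * (1ℤ + + 3 * y)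
      lem = solve-∀

    3η : ∀ e → e % 3 ≢ 0 → + 3 * η e ≡ S - 1ℤ
    3η e e%3≢0 = trans (cong (+ 3 *_) (η-% e)) (go (e % 3) (m%n<n e 3) e%3≢0)
      where
      go : ∀ d → d < 3 → d ≢ 0 → + 3 * η d ≡ S - 1ℤ
      go 0 _ d≢0 = contradiction refl d≢0
      go 1 _ _   = 3η₁
      go 2 _ _   = trans (cong (+ 3 *_) (sym η₁≡η₂)) 3η₁
      go (suc (suc (suc d))) (s≤s (s≤s (s≤s ())))

-- The three classes of elements and the trilinear counting form.

∑-trinomials : ∀ {A : Set} (xs : List A) (d K d′ K′ : A → ℤ) a b c a′ b′ c′ →
  ∑ xs (λ x → (a + b * d x + c * K x) * (a′ + b′ * d′ x + c′ * K′ x)) ≡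
  a * a′ * + length xs + a * b′ * ∑ xs d′ + a * c′ * ∑ xs K′
  + (b * a′ * ∑ xs d + b * b′ * ∑ xs (λ x → d x * d′ x) + b * c′ * ∑ xs (λ x → d x * K′ x))
  + (c * a′ * ∑ xs K + c * b′ * ∑ xs (λ x → K x * d′ x) + c * c′ * ∑ xs (λ x → K x * K′ x))
∑-trinomials []       d K d′ K′ a b c a′ b′ c′ = lem a b c a′ b′ c′
  where
  lem : ∀ a b c a′ b′ c′ → 0ℤ ≡ a * a′ * 0ℤ + a * b′ * 0ℤ + a * c′ * 0ℤ
    + (b * a′ * 0ℤ + b * b′ * 0ℤ + b * c′ * 0ℤ) + (c * a′ * 0ℤ + c * b′ * 0ℤ + c * c′ * 0ℤ)
  lem = solve-∀
∑-trinomials (x ∷ xs) d K d′ K′ a b c a′ b′ c′ = trans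
  (cong (_+_ ((a + b * d x + c * K x) * (a′ + b′ * d′ x + c′ * K′ x))) (∑-trinomials xs d K d′ K′ a b c a′ b′ c′))
  (lem a b c a′ b′ c′ (d x) (K x) (d′ x) (K′ x) (+ length xs) (∑ xs d) (∑ xs K) (∑ xs d′) (∑ xs K′)
    (∑ xs (λ x → d x * d′ x)) (∑ xs (λ x → d x * K′ x)) (∑ xs (λ x → K x * d′ x)) (∑ xs (λ x → K x * K′ x)))
  where
  lem : ∀ a b c a′ b′ c′ e k e′ k′ n E K E′ K′ EE EK KE KK →
    (a + b * e + c * k) * (a′ + b′ * e′ + c′ * k′) +
    (a * a′ * n + a * b′ * E′ + a * c′ * K′ + (b * a′ * E + b * b′ * EE + b * c′ * EK)
        + (c * a′ * K + c * b′ * KE + c * c′ * KK)) ≡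
    a * a′ * (1ℤ + n) + a * b′ * (e′ + E′) + a * c′ * (k′ + K′)
    + (b * a′ * (e + E) + b * b′ * (e * e′ + EE) + b * c′ * (e * k′ + EK))
    + (c * a′ * (k + K) + c * b′ * (k * e′ + KE) + c * c′ * (k * k′ + KK))
  lem = solve-∀

-- The two noncubic classes are merged because their periods coincide, so `K` cannot tell them
-- apart.
data Class : Set where
  null cubic noncubic : Class

classes : List Class
classes = null ∷ cubic ∷ noncubic ∷ []

χ : Class → Class → ℤ
χ null     null     = 1ℤ
χ cubic    cubic    = 1ℤ
χ noncubic noncubic = 1ℤ
χ _        _        = 0ℤ

∑-χ : ∀ c (f : Class → ℤ) → f c ≡ ∑ classes (λ s → χ s c * f s)
∑-χ null     f = lem (f null) (f cubic) (f noncubic)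
  where
  lem : ∀ x y z → x ≡ 1ℤ * x + (0ℤ * y + (0ℤ * z + 0ℤ))
  lem = solve-∀
∑-χ cubic    f = lem (f null) (f cubic) (f noncubic)
  where
  lem : ∀ x y z → y ≡ 0ℤ * x + (1ℤ * y + (0ℤ * z + 0ℤ))
  lem = solve-∀
∑-χ noncubic f = lem (f null) (f cubic) (f noncubic)
  where
  lem : ∀ x y z → z ≡ 0ℤ * x + (0ℤ * y + (1ℤ * z + 0ℤ))
  lem = solve-∀

-- The 27 triples fall into ten multisets; 1, 3 and 6 are the numbers of their orderings.
∑-symmetric : ∀ (U : Class → Class → Class → ℤ) → (∀ a b c → U a b c ≡ U b a c) → (∀ a b c → U a b c ≡ U a c b) →
  ∑ classes (λ a → ∑ classes (λ b → ∑ classes (λ c → U a b c))) ≡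
  U null null null + + 3 * U null null cubic + + 3 * U null null noncubic + + 3 * U null cubic cubic
      + + 6 * U null cubic noncubic + + 3 * U null noncubic noncubic + U cubic cubic cubic
      + + 3 * U cubic cubic noncubic + + 3 * U cubic noncubic noncubic + U noncubic noncubic noncubic
∑-symmetric U swap₁₂ swap₂₃
  rewrite swap₁₂ cubic null null | swap₁₂ cubic null cubic | swap₁₂ cubic null noncubic
        | swap₁₂ noncubic null null | swap₁₂ noncubic null cubic | swap₁₂ noncubic null noncubic
        | swap₁₂ noncubic cubic null | swap₁₂ noncubic cubic cubic | swap₁₂ noncubic cubic noncubic
        | swap₂₃ null cubic null | swap₂₃ null noncubic null | swap₂₃ null noncubic cubic
        | swap₂₃ cubic cubic null | swap₂₃ cubic noncubic null | swap₂₃ cubic noncubic cubic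
        | swap₂₃ noncubic noncubic null | swap₂₃ noncubic noncubic cubic | swap₁₂ cubic null cubic
        | swap₁₂ cubic null noncubic | swap₁₂ noncubic null noncubic | swap₁₂ noncubic cubic noncubic
  = lem (U null null null) (U null null cubic) (U null null noncubic) (U null cubic cubic) (U null cubic noncubic)
      (U null noncubic noncubic) (U cubic cubic cubic) (U cubic cubic noncubic) (U cubic noncubic noncubic)
      (U noncubic noncubic noncubic)
  where
  lem : ∀ nnn nnc nng ncc ncg ngg ccc ccg cgg ggg →
    (((nnn + (nnc + (nng + 0ℤ))) + ((nnc + (ncc + (ncg + 0ℤ))) + ((nng + (ncg + (ngg + 0ℤ))) + 0ℤ)))
        + (((nnc + (ncc + (ncg + 0ℤ))) + ((ncc + (ccc + (ccg + 0ℤ))) + ((ncg + (ccg + (cgg + 0ℤ))) + 0ℤ)))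
        + (((nng + (ncg + (ngg + 0ℤ))) + ((ncg + (ccg + (cgg + 0ℤ))) + ((ngg + (cgg + (ggg + 0ℤ))) + 0ℤ)))
        + 0ℤ))) ≡
    nnn + + 3 * nnc + + 3 * nng + + 3 * ncc + + 6 * ncg + + 3 * ngg + ccc + + 3 * ccg + + 3 * cgg + ggg
  lem = solve-∀

-- The value of `K` on each class: `3 R` at zero, and `3 η₀`, `3 η₁` as expressed through `S`.
value : ℤ → Class → ℤ
value S null     = S * S - 1ℤ
value S cubic    = - 1ℤ - + 2 * S
value S noncubic = S - 1ℤ

-- The indicator of a class, times 3S, is a combination of 1, δ and K with these coefficients.
coefficient₁ coefficientδ coefficientK : ℤ → Class → ℤ
coefficient₁ S null     = 0ℤ
coefficient₁ S cubic    = S - 1ℤ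
coefficient₁ S noncubic = + 3 * S - (S - 1ℤ)
coefficientδ S null     = + 3 * S
coefficientδ S cubic    = S * S - S
coefficientδ S noncubic = - (+ 3 * S) - (S * S - S)
coefficientK S null     = 0ℤ
coefficientK S cubic    = - 1ℤ
coefficientK S noncubic = 1ℤ

-- The function `S - 1 - K` is `3 S` on cubes and 0 on noncubes; its value `S - S²` at zero is
-- removed by the `δ` coefficient. The noncubic coefficients are those of the constant `3 S` minus
-- the other two rows.
3Sχ : ∀ S s c → + 3 * S * χ s c ≡ coefficient₁ S s + coefficientδ S s * χ null c + coefficientK S s * value S c
3Sχ S null null = lem S
  where
  lem : ∀ S → + 3 * S * 1ℤ ≡ 0ℤ + + 3 * S * 1ℤ + 0ℤ * (S * S - 1ℤ)
  lem = solve-∀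
3Sχ S null cubic = lem S
  where
  lem : ∀ S → + 3 * S * 0ℤ ≡ 0ℤ + + 3 * S * 0ℤ + 0ℤ * (- 1ℤ - + 2 * S)
  lem = solve-∀
3Sχ S null noncubic = lem S
  where
  lem : ∀ S → + 3 * S * 0ℤ ≡ 0ℤ + + 3 * S * 0ℤ + 0ℤ * (S - 1ℤ)
  lem = solve-∀
3Sχ S cubic null = lem S
  where
  lem : ∀ S → + 3 * S * 0ℤ ≡ S - 1ℤ + (S * S - S) * 1ℤ + - 1ℤ * (S * S - 1ℤ)
  lem = solve-∀
3Sχ S cubic cubic = lem S
  where
  lem : ∀ S → + 3 * S * 1ℤ ≡ S - 1ℤ + (S * S - S) * 0ℤ + - 1ℤ * (- 1ℤ - + 2 * S)
  lem = solve-∀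
3Sχ S cubic noncubic = lem S
  where
  lem : ∀ S → + 3 * S * 0ℤ ≡ S - 1ℤ + (S * S - S) * 0ℤ + - 1ℤ * (S - 1ℤ)
  lem = solve-∀
3Sχ S noncubic null = lem S
  where
  lem : ∀ S → + 3 * S * 0ℤ ≡ + 3 * S - (S - 1ℤ) + (- (+ 3 * S) - (S * S - S)) * 1ℤ + 1ℤ * (S * S - 1ℤ)
  lem = solve-∀
3Sχ S noncubic cubic = lem S
  where
  lem : ∀ S → + 3 * S * 0ℤ ≡ + 3 * S - (S - 1ℤ) + (- (+ 3 * S) - (S * S - S)) * 0ℤ + 1ℤ * (- 1ℤ - + 2 * S)
  lem = solve-∀
3Sχ S noncubic noncubic = lem S
  where
  lem : ∀ S → + 3 * S * 1ℤ ≡ + 3 * S - (S - 1ℤ) + (- (+ 3 * S) - (S * S - S)) * 0ℤ + 1ℤ * (S - 1ℤ)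
  lem = solve-∀

-- The sum of φ₀(x) φ₁(y) φ₂(x + y) over x, y for φⱼ = aⱼ + bⱼ δ + cⱼ Kⱼ, where r is the order of the field,
-- A = Kⱼ(0), and G is 1 or 0 according to whether the Kⱼ are all equal or belong to different cubic classes.
trilinear : (r A G a₀ b₀ c₀ a₁ b₁ c₁ a₂ b₂ c₂ : ℤ) → ℤ
trilinear r A G a₀ b₀ c₀ a₁ b₁ c₁ a₂ b₂ c₂ =
  a₀ * a₁ * a₂ * r * r + (a₀ * a₁ * b₂ + a₀ * b₁ * a₂ + b₀ * a₁ * a₂) * r
  + (a₀ * b₁ * b₂ + b₀ * a₁ * b₂ + b₀ * b₁ * a₂) + b₀ * b₁ * b₂
  + A * (b₀ * b₁ * c₂ + b₀ * c₁ * b₂ + c₀ * b₁ * b₂)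
  + + 3 * G * r * A * (b₀ * c₁ * c₂ + c₀ * b₁ * c₂ + c₀ * c₁ * b₂)
  + + 9 * G * r * r * A * (c₀ * c₁ * c₂)

trilinear-swap₁₂ : ∀ r A G a₀ b₀ c₀ a₁ b₁ c₁ a₂ b₂ c₂ →
  trilinear r A G a₀ b₀ c₀ a₁ b₁ c₁ a₂ b₂ c₂ ≡ trilinear r A G a₁ b₁ c₁ a₀ b₀ c₀ a₂ b₂ c₂
trilinear-swap₁₂ = lem
  where
  lem : ∀ r A G a₀ b₀ c₀ a₁ b₁ c₁ a₂ b₂ c₂ →
    a₀ * a₁ * a₂ * r * r + (a₀ * a₁ * b₂ + a₀ * b₁ * a₂ + b₀ * a₁ * a₂) * r
        + (a₀ * b₁ * b₂ + b₀ * a₁ * b₂ + b₀ * b₁ * a₂) + b₀ * b₁ * b₂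
        + A * (b₀ * b₁ * c₂ + b₀ * c₁ * b₂ + c₀ * b₁ * b₂)
        + + 3 * G * r * A * (b₀ * c₁ * c₂ + c₀ * b₁ * c₂ + c₀ * c₁ * b₂)
        + + 9 * G * r * r * A * (c₀ * c₁ * c₂)
        ≡ a₁ * a₀ * a₂ * r * r + (a₁ * a₀ * b₂ + a₁ * b₀ * a₂ + b₁ * a₀ * a₂) * r
        + (a₁ * b₀ * b₂ + b₁ * a₀ * b₂ + b₁ * b₀ * a₂) + b₁ * b₀ * b₂
        + A * (b₁ * b₀ * c₂ + b₁ * c₀ * b₂ + c₁ * b₀ * b₂)
        + + 3 * G * r * A * (b₁ * c₀ * c₂ + c₁ * b₀ * c₂ + c₁ * c₀ * b₂)
        + + 9 * G * r * r * A * (c₁ * c₀ * c₂)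
  lem = solve-∀

trilinear-swap₂₃ : ∀ r A G a₀ b₀ c₀ a₁ b₁ c₁ a₂ b₂ c₂ →
  trilinear r A G a₀ b₀ c₀ a₁ b₁ c₁ a₂ b₂ c₂ ≡ trilinear r A G a₀ b₀ c₀ a₂ b₂ c₂ a₁ b₁ c₁
trilinear-swap₂₃ = lem
  where
  lem : ∀ r A G a₀ b₀ c₀ a₁ b₁ c₁ a₂ b₂ c₂ →
    a₀ * a₁ * a₂ * r * r + (a₀ * a₁ * b₂ + a₀ * b₁ * a₂ + b₀ * a₁ * a₂) * r
        + (a₀ * b₁ * b₂ + b₀ * a₁ * b₂ + b₀ * b₁ * a₂) + b₀ * b₁ * b₂
        + A * (b₀ * b₁ * c₂ + b₀ * c₁ * b₂ + c₀ * b₁ * b₂)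
        + + 3 * G * r * A * (b₀ * c₁ * c₂ + c₀ * b₁ * c₂ + c₀ * c₁ * b₂)
        + + 9 * G * r * r * A * (c₀ * c₁ * c₂)
        ≡ a₀ * a₂ * a₁ * r * r + (a₀ * a₂ * b₁ + a₀ * b₂ * a₁ + b₀ * a₂ * a₁) * r
        + (a₀ * b₂ * b₁ + b₀ * a₂ * b₁ + b₀ * b₂ * a₁) + b₀ * b₂ * b₁
        + A * (b₀ * b₂ * c₁ + b₀ * c₂ * b₁ + c₀ * b₂ * b₁)
        + + 3 * G * r * A * (b₀ * c₂ * c₁ + c₀ * b₂ * c₁ + c₀ * c₂ * b₁)
        + + 9 * G * r * r * A * (c₀ * c₂ * c₁)
  lem = solve-∀

-- Each coefficient is 27 times a class count times the number of orderings. Triples with exactly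
-- two zeros are absent, since two zeros among `x`, `y`, `x + y` force the third. One further term
-- vanishes at `G = 1` and another at `G = 0`, which leaves the seven lines of each table.
distributionSum : (S G : ℤ) → (Class → Class → Class → ℤ) → ℤ
distributionSum S G f =
  + 27 * f null null null + + 27 * (S * S - 1ℤ) * G * f null cubic cubic
  + + 54 * (S * S - 1ℤ) * (1ℤ - G) * f null cubic noncubic + + 27 * (S * S - 1ℤ) * (1ℤ + G) * f null noncubic noncubic
  + (S * S - 1ℤ) * (S * S + 1ℤ - + 2 * S - + 9 * G) * f cubic cubic cubic
  + + 6 * (S * S - 1ℤ) * (S * S - + 2 + S) * f cubic cubic noncubic
  + + 3 * (S * S - 1ℤ) * (+ 4 * (S * S) - + 11 - + 2 * S + + 9 * G) * f cubic noncubic noncubic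
  + + 2 * (S * S - 1ℤ) * (+ 4 * (S * S) - + 5 + S - + 9 * G) * f noncubic noncubic noncubic

-- Counting pairs `(x , y)` by the classes of `x`, `y` and `x + y`.

module _ (F : FiniteField) where

  open FieldProperties F

  module Distribution (S G : ℤ) (order≡S² : + order ≡ S * S) (G²≡G : G * G ≡ G)
    (K : ℕ → Carrier → ℤ) (class : ℕ → Carrier → Class)
    (K-class : ∀ j x → K j x ≡ value S (class j x))
    (null-class : ∀ j x → ⟦ x ≟ 𝟘 ⟧ ≡ χ null (class j x))
    (K-⊖ : ∀ j x → K j (⊖ x) ≡ K j x)
    (∑-K : ∀ j → ∑ elements (K j) ≡ 0ℤ)
    (K-convolution : ∀ i j → i < j → j < 3 → ∀ x → ∑ elements (λ y → K i y * K j (x ⊕ y))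
        ≡ G * (+ 3 * (+ order * K j x)))
    where

    δ : Carrier → ℤ
    δ x = ⟦ x ≟ 𝟘 ⟧

    ∑-δ-* : ∀ (f : Carrier → ℤ) → ∑ elements (λ y → δ y * f y) ≡ f 𝟘
    ∑-δ-* f = trans (∑-single (λ y → δ y * f y) unique (complete 𝟘)
        λ {y} _ y≢0 → trans (cong (_* f y) (⟦⟧-false (y ≟ 𝟘) y≢0)) (ℤₚ.*-zeroˡ (f y)))
      (trans (cong (_* f 𝟘) (⟦⟧-true (𝟘 ≟ 𝟘) refl)) (ℤₚ.*-identityˡ (f 𝟘)))

    ∑-δ-shift-* : ∀ x (f : Carrier → ℤ) → ∑ elements (λ y → δ (x ⊕ y) * f y) ≡ f (⊖ x)
    ∑-δ-shift-* x f = trans (∑-cong elements λ y → cong (_* f y) (⟦⟧-cong (x ⊕ y ≟ 𝟘) (y ⊕ x ≟ 𝟘)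
        (trans (⊕-comm y x)) (trans (⊕-comm x y))))
      (trans (∑-cong elements λ y → cong (λ t → δ (y ⊕ x) * f t) (sym (⊕-⊖-cancel y x)))
        (trans (∑-translate x (λ y → δ y * f (y ⊕ ⊖ x))) (trans (∑-δ-* (λ y → f (y ⊕ ⊖ x))) (cong f (⊕-identityˡ _)))))

    ∑-δ : ∑ elements δ ≡ 1ℤ
    ∑-δ = trans (∑-cong elements λ x → sym (ℤₚ.*-identityʳ (δ x))) (∑-δ-* (λ _ → 1ℤ))

    ∑-shift : ∀ x (f : Carrier → ℤ) → ∑ elements (λ y → f (x ⊕ y)) ≡ ∑ elements f
    ∑-shift x f = trans (∑-cong elements λ y → cong f (⊕-comm x y)) (∑-translate x f)

    K-𝟘 : ∀ j → K j 𝟘 ≡ S * S - 1ℤ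
    K-𝟘 j = trans (K-class j 𝟘) (go (class j 𝟘) (trans (sym (⟦⟧-true (𝟘 ≟ 𝟘) refl)) (null-class j 𝟘)))
      where
      go : ∀ c → 1ℤ ≡ χ null c → value S c ≡ S * S - 1ℤ
      go null _ = refl
      go cubic ()
      go noncubic ()

    φ : ℕ → ℤ → ℤ → ℤ → Carrier → ℤ
    φ j a b c x = a + b * δ x + c * K j x

    private
      r A : ℤ
      r = + order
      A = S * S - 1ℤ

    -- Both `K 1` and `K 2` survive the inner sum and may be different functions, so the result is
    -- grouped as two trinomials, each ready to be summed against `φ 0`.
    ∑-φ-φ : ∀ a₁ b₁ c₁ a₂ b₂ c₂ x → ∑ elements (λ y → φ 1 a₁ b₁ c₁ y * φ 2 a₂ b₂ c₂ (x ⊕ y)) ≡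
      ((a₁ * a₂ * r + a₁ * b₂ + b₁ * a₂) + b₁ * b₂ * δ x + c₁ * b₂ * K 1 x)
      + (0ℤ + 0ℤ * δ x + (b₁ * c₂ + c₁ * c₂ * (G * (+ 3 * r))) * K 2 x)
    ∑-φ-φ a₁ b₁ c₁ a₂ b₂ c₂ x = begin
      ∑ elements (λ y → φ 1 a₁ b₁ c₁ y * φ 2 a₂ b₂ c₂ (x ⊕ y))
        ≡⟨ ∑-trinomials elements δ (K 1) (λ y → δ (x ⊕ y)) (λ y → K 2 (x ⊕ y)) a₁ b₁ c₁ a₂ b₂ c₂ ⟩
      expand (∑ elements (λ y → δ (x ⊕ y))) (∑ elements (λ y → K 2 (x ⊕ y))) (∑ elements δ)
        (∑ elements (λ y → δ y * δ (x ⊕ y))) (∑ elements (λ y → δ y * K 2 (x ⊕ y)))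
        (∑ elements (K 1)) (∑ elements (λ y → K 1 y * δ (x ⊕ y))) (∑ elements (λ y → K 1 y * K 2 (x ⊕ y)))
        ≡⟨ expand-cong (trans (∑-shift x δ) ∑-δ) (trans (∑-shift x (K 2)) (∑-K 2)) ∑-δ
             (trans (∑-δ-* (λ y → δ (x ⊕ y))) (cong δ (⊕-identityʳ x)))
                 (trans (∑-δ-* (λ y → K 2 (x ⊕ y))) (cong (K 2) (⊕-identityʳ x)))
             (∑-K 1) (trans (∑-cong elements λ y → ℤₚ.*-comm (K 1 y) (δ (x ⊕ y)))
                 (trans (∑-δ-shift-* x (K 1)) (K-⊖ 1 x)))
             (K-convolution 1 2 (s≤s (s≤s z≤n)) (s≤s (s≤s (s≤s z≤n))) x) ⟩
      expand 1ℤ 0ℤ 1ℤ (δ x) (K 2 x) 0ℤ (K 1 x) (G * (+ 3 * (r * K 2 x)))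
        ≡⟨ lem a₁ b₁ c₁ a₂ b₂ c₂ r G (δ x) (K 1 x) (K 2 x) ⟩
      ((a₁ * a₂ * r + a₁ * b₂ + b₁ * a₂) + b₁ * b₂ * δ x + c₁ * b₂ * K 1 x)
      + (0ℤ + 0ℤ * δ x + (b₁ * c₂ + c₁ * c₂ * (G * (+ 3 * r))) * K 2 x) ∎
      where
      open ≡-Reasoning
      expand : (E′ K′ E EE EK K KE KK : ℤ) → ℤ
      expand E′ K′ E EE EK K KE KK = a₁ * a₂ * r + a₁ * b₂ * E′ + a₁ * c₂ * K′
        + (b₁ * a₂ * E + b₁ * b₂ * EE + b₁ * c₂ * EK) + (c₁ * a₂ * K + c₁ * b₂ * KE + c₁ * c₂ * KK)
      expand-cong : ∀ {x₁ x₂ x₃ x₄ x₅ x₆ x₇ x₈ y₁ y₂ y₃ y₄ y₅ y₆ y₇ y₈} →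
        x₁ ≡ y₁ → x₂ ≡ y₂ → x₃ ≡ y₃ → x₄ ≡ y₄ → x₅ ≡ y₅ → x₆ ≡ y₆ → x₇ ≡ y₇ → x₈ ≡ y₈ →
        expand x₁ x₂ x₃ x₄ x₅ x₆ x₇ x₈ ≡ expand y₁ y₂ y₃ y₄ y₅ y₆ y₇ y₈
      expand-cong refl refl refl refl refl refl refl refl = refl
      lem : ∀ a₁ b₁ c₁ a₂ b₂ c₂ r G d k₁ k₂ →
        a₁ * a₂ * r + a₁ * b₂ * 1ℤ + a₁ * c₂ * 0ℤ + (b₁ * a₂ * 1ℤ + b₁ * b₂ * d + b₁ * c₂ * k₂)
        + (c₁ * a₂ * 0ℤ + c₁ * b₂ * k₁ + c₁ * c₂ * (G * (+ 3 * (r * k₂)))) ≡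
        ((a₁ * a₂ * r + a₁ * b₂ + b₁ * a₂) + b₁ * b₂ * d + c₁ * b₂ * k₁)
        + (0ℤ + 0ℤ * d + (b₁ * c₂ + c₁ * c₂ * (G * (+ 3 * r))) * k₂)
      lem = solve-∀

    -- Products with `δ` are evaluations at `𝟘`; only `K 0 * K j` calls for the convolution
    -- identity, taken at the shift `𝟘`.
    ∑-φ₀ : ∀ j → 0 < j → j < 3 → ∀ a b c a′ b′ c′ → ∑ elements (λ x → φ 0 a b c x * φ j a′ b′ c′ x) ≡
      a * a′ * r + a * b′ + b * a′ + b * b′ + (b * c′ + c * b′) * A + c * c′ * (G * (+ 3 * (r * A)))
    ∑-φ₀ j 0<j j<3 a b c a′ b′ c′ = begin
      ∑ elements (λ x → φ 0 a b c x * φ j a′ b′ c′ x)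
        ≡⟨ ∑-trinomials elements δ (K 0) δ (K j) a b c a′ b′ c′ ⟩
      expand (∑ elements δ) (∑ elements (K j)) (∑ elements δ)
        (∑ elements (λ y → δ y * δ y)) (∑ elements (λ y → δ y * K j y))
        (∑ elements (K 0)) (∑ elements (λ y → K 0 y * δ y)) (∑ elements (λ y → K 0 y * K j y))
        ≡⟨ expand-cong ∑-δ (∑-K j) ∑-δ (trans (∑-δ-* δ) (⟦⟧-true (𝟘 ≟ 𝟘) refl)) (trans (∑-δ-* (K j)) (K-𝟘 j))
             (∑-K 0) (trans (∑-cong elements λ y → ℤₚ.*-comm (K 0 y) (δ y)) (trans (∑-δ-* (K 0)) (K-𝟘 0)))
             (trans (∑-cong elements λ y → cong (λ t → K 0 y * K j t) (sym (⊕-identityˡ y)))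
               (trans (K-convolution 0 j 0<j j<3 𝟘) (cong (λ t → G * (+ 3 * (r * t))) (K-𝟘 j)))) ⟩
      expand 1ℤ 0ℤ 1ℤ 1ℤ A 0ℤ A (G * (+ 3 * (r * A)))
        ≡⟨ lem a b c a′ b′ c′ r G A ⟩
      a * a′ * r + a * b′ + b * a′ + b * b′ + (b * c′ + c * b′) * A + c * c′ * (G * (+ 3 * (r * A))) ∎
      where
      open ≡-Reasoning
      expand : (E′ K′ E EE EK K KE KK : ℤ) → ℤ
      expand E′ K′ E EE EK K KE KK = a * a′ * r + a * b′ * E′ + a * c′ * K′
        + (b * a′ * E + b * b′ * EE + b * c′ * EK) + (c * a′ * K + c * b′ * KE + c * c′ * KK)
      expand-cong : ∀ {x₁ x₂ x₃ x₄ x₅ x₆ x₇ x₈ y₁ y₂ y₃ y₄ y₅ y₆ y₇ y₈} →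
        x₁ ≡ y₁ → x₂ ≡ y₂ → x₃ ≡ y₃ → x₄ ≡ y₄ → x₅ ≡ y₅ → x₆ ≡ y₆ → x₇ ≡ y₇ → x₈ ≡ y₈ →
        expand x₁ x₂ x₃ x₄ x₅ x₆ x₇ x₈ ≡ expand y₁ y₂ y₃ y₄ y₅ y₆ y₇ y₈
      expand-cong refl refl refl refl refl refl refl refl = refl
      lem : ∀ a b c a′ b′ c′ r G A →
        a * a′ * r + a * b′ * 1ℤ + a * c′ * 0ℤ + (b * a′ * 1ℤ + b * b′ * 1ℤ + b * c′ * A)
        + (c * a′ * 0ℤ + c * b′ * A + c * c′ * (G * (+ 3 * (r * A)))) ≡
        a * a′ * r + a * b′ + b * a′ + b * b′ + (b * c′ + c * b′) * A + c * c′ * (G * (+ 3 * (r * A)))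
      lem = solve-∀

    ∑-φ-φ-φ : ∀ a₀ b₀ c₀ a₁ b₁ c₁ a₂ b₂ c₂ →
      ∑ elements (λ x → ∑ elements (λ y → φ 0 a₀ b₀ c₀ x * (φ 1 a₁ b₁ c₁ y * φ 2 a₂ b₂ c₂ (x ⊕ y)))) ≡
      trilinear r A G a₀ b₀ c₀ a₁ b₁ c₁ a₂ b₂ c₂
    ∑-φ-φ-φ a₀ b₀ c₀ a₁ b₁ c₁ a₂ b₂ c₂ = begin
      ∑ elements (λ x → ∑ elements (λ y → φ 0 a₀ b₀ c₀ x * (φ 1 a₁ b₁ c₁ y * φ 2 a₂ b₂ c₂ (x ⊕ y))))
        ≡⟨ (∑-cong elements λ x → trans (∑-*ˡ elements (φ 0 a₀ b₀ c₀ x) (λ y → φ 1 a₁ b₁ c₁ y * φ 2 a₂ b₂ c₂ (x ⊕ y)))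
             (trans (cong (_*_ (φ 0 a₀ b₀ c₀ x)) (∑-φ-φ a₁ b₁ c₁ a₂ b₂ c₂ x))
                 (ℤₚ.*-distribˡ-+ (φ 0 a₀ b₀ c₀ x) (φ 1 P Q U x) (φ 2 0ℤ 0ℤ V x)))) ⟩
      ∑ elements (λ x → φ 0 a₀ b₀ c₀ x * φ 1 P Q U x + φ 0 a₀ b₀ c₀ x * φ 2 0ℤ 0ℤ V x)
        ≡⟨ ∑-+ elements (λ x → φ 0 a₀ b₀ c₀ x * φ 1 P Q U x) (λ x → φ 0 a₀ b₀ c₀ x * φ 2 0ℤ 0ℤ V x) ⟩
      ∑ elements (λ x → φ 0 a₀ b₀ c₀ x * φ 1 P Q U x) + ∑ elements (λ x → φ 0 a₀ b₀ c₀ x * φ 2 0ℤ 0ℤ V x)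
        ≡⟨ cong₂ _+_ (∑-φ₀ 1 (s≤s z≤n) (s≤s (s≤s z≤n)) a₀ b₀ c₀ P Q U)
            (∑-φ₀ 2 (s≤s z≤n) (s≤s (s≤s (s≤s z≤n))) a₀ b₀ c₀ 0ℤ 0ℤ V) ⟩
      (a₀ * P * r + a₀ * Q + b₀ * P + b₀ * Q + (b₀ * U + c₀ * Q) * A + c₀ * U * (G * (+ 3 * (r * A))))
      + (a₀ * 0ℤ * r + a₀ * 0ℤ + b₀ * 0ℤ + b₀ * 0ℤ + (b₀ * V + c₀ * 0ℤ) * A + c₀ * V * (G * (+ 3 * (r * A))))
        ≡⟨ lem₁ r A G a₀ b₀ c₀ a₁ b₁ c₁ a₂ b₂ c₂ ⟩
      -- The product of all three `K` passes through the convolution twice and carries `G * G`;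
      -- idempotence makes it linear in `G`, as in `trilinear`.
      trilinear r A G a₀ b₀ c₀ a₁ b₁ c₁ a₂ b₂ c₂ + + 9 * r * r * A * (c₀ * c₁ * c₂) * (G * G - G)
        ≡⟨ cong (λ t → trilinear r A G a₀ b₀ c₀ a₁ b₁ c₁ a₂ b₂ c₂ + + 9 * r * r * A * (c₀ * c₁ * c₂) * t)
            (ℤₚ.i≡j⇒i-j≡0 {G * G} {G} G²≡G) ⟩
      trilinear r A G a₀ b₀ c₀ a₁ b₁ c₁ a₂ b₂ c₂ + + 9 * r * r * A * (c₀ * c₁ * c₂) * 0ℤ
        ≡⟨ lem₂ (trilinear r A G a₀ b₀ c₀ a₁ b₁ c₁ a₂ b₂ c₂) (+ 9 * r * r * A * (c₀ * c₁ * c₂)) ⟩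
      trilinear r A G a₀ b₀ c₀ a₁ b₁ c₁ a₂ b₂ c₂ ∎
      where
      open ≡-Reasoning
      P Q U V : ℤ
      P = a₁ * a₂ * r + a₁ * b₂ + b₁ * a₂
      Q = b₁ * b₂
      U = c₁ * b₂
      V = b₁ * c₂ + c₁ * c₂ * (G * (+ 3 * r))
      lem₁ : ∀ r A G a₀ b₀ c₀ a₁ b₁ c₁ a₂ b₂ c₂ →
        (a₀ * (a₁ * a₂ * r + a₁ * b₂ + b₁ * a₂) * r + a₀ * (b₁ * b₂) + b₀ * (a₁ * a₂ * r + a₁ * b₂ + b₁ * a₂)
            + b₀ * (b₁ * b₂) + (b₀ * (c₁ * b₂) + c₀ * (b₁ * b₂)) * A + c₀ * (c₁ * b₂) * (G * (+ 3 * (r * A))))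
        + (a₀ * 0ℤ * r + a₀ * 0ℤ + b₀ * 0ℤ + b₀ * 0ℤ + (b₀ * (b₁ * c₂ + c₁ * c₂ * (G * (+ 3 * r))) + c₀ * 0ℤ) * A
            + c₀ * (b₁ * c₂ + c₁ * c₂ * (G * (+ 3 * r))) * (G * (+ 3 * (r * A)))) ≡
        a₀ * a₁ * a₂ * r * r + (a₀ * a₁ * b₂ + a₀ * b₁ * a₂ + b₀ * a₁ * a₂) * r
            + (a₀ * b₁ * b₂ + b₀ * a₁ * b₂ + b₀ * b₁ * a₂) + b₀ * b₁ * b₂
            + A * (b₀ * b₁ * c₂ + b₀ * c₁ * b₂ + c₀ * b₁ * b₂)
            + + 3 * G * r * A * (b₀ * c₁ * c₂ + c₀ * b₁ * c₂ + c₀ * c₁ * b₂)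
            + + 9 * G * r * r * A * (c₀ * c₁ * c₂) + + 9 * r * r * A * (c₀ * c₁ * c₂) * (G * G - G)
      lem₁ = solve-∀
      lem₂ : ∀ t x → t + x * 0ℤ ≡ t
      lem₂ = solve-∀

    indicator : ℕ → Class → Carrier → ℤ
    indicator j s = φ j (coefficient₁ S s) (coefficientδ S s) (coefficientK S s)

    indicator≡ : ∀ j s x → indicator j s x ≡ + 3 * S * χ s (class j x)
    indicator≡ j s x = trans (cong₂ (λ d k → coefficient₁ S s + coefficientδ S s * d + coefficientK S s * k)
        (null-class j x) (K-class j x))
      (sym (3Sχ S s (class j x)))

    -- 27 S³ times the number of (x , y) with x, y, x + y in the given classes for j = 0, 1, 2.
    count : Class → Class → Class → ℤ
    count a b c = trilinear r A G (coefficient₁ S a) (coefficientδ S a) (coefficientK S a)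
      (coefficient₁ S b) (coefficientδ S b) (coefficientK S b) (coefficient₁ S c) (coefficientδ S c) (coefficientK S c)

    module _ (Φ : ℤ → ℤ) where

      Φ-values : Class → Class → Class → ℤ
      Φ-values a b c = Φ (value S a + (value S b + value S c))

      private
        k : ℤ
        k = + 3 * S

        ∑³ : (Class → Class → Class → ℤ) → ℤ
        ∑³ f = ∑ classes (λ a → ∑ classes (λ b → ∑ classes (λ c → f a b c)))

        -- The argument of `Φ` depends only on three classes. Inserting a partition of unity for
        -- each of them absorbs one factor `k = 3 S`, and `Φ` is left at constant arguments.
        pointwise : ∀ x y z → k * k * k * Φ (K 0 x + (K 1 y + K 2 z)) ≡
                    ∑³ (λ a b c → (indicator 0 a x * (indicator 1 b y * indicator 2 c z)) * Φ-values a b c)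
        pointwise x y z = begin
          k * k * k * Φ (K 0 x + (K 1 y + K 2 z))
            ≡⟨ cong (_*_ (k * k * k)) (cong₂ (λ s t → Φ (s + t)) (K-class 0 x)
                (cong₂ _+_ (K-class 1 y) (K-class 2 z))) ⟩
          k * k * k * Φ-values c₀ c₁ c₂
            ≡⟨ cong (_*_ (k * k * k)) (∑-χ c₀ (λ a → Φ-values a c₁ c₂)) ⟩
          k * k * k * ∑ classes (λ a → χ a c₀ * Φ-values a c₁ c₂)
            ≡⟨ sym (∑-*ˡ classes (k * k * k) (λ a → χ a c₀ * Φ-values a c₁ c₂)) ⟩
          ∑ classes (λ a → k * k * k * (χ a c₀ * Φ-values a c₁ c₂))
            ≡⟨ (∑-cong classes λ a → begin
              k * k * k * (χ a c₀ * Φ-values a c₁ c₂)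
                ≡⟨ lem k (χ a c₀) (k * k) (Φ-values a c₁ c₂) ⟩
              k * χ a c₀ * k * k * Φ-values a c₁ c₂
                ≡⟨ cong₂ (λ s t → s * k * k * t) (sym (indicator≡ 0 a x)) (∑-χ c₁ (λ b → Φ-values a b c₂)) ⟩
              indicator 0 a x * k * k * ∑ classes (λ b → χ b c₁ * Φ-values a b c₂)
                ≡⟨ sym (∑-*ˡ classes (indicator 0 a x * k * k) (λ b → χ b c₁ * Φ-values a b c₂)) ⟩
              ∑ classes (λ b → indicator 0 a x * k * k * (χ b c₁ * Φ-values a b c₂))
                ≡⟨ (∑-cong classes λ b → begin
                  indicator 0 a x * k * k * (χ b c₁ * Φ-values a b c₂)
                    ≡⟨ lem₂ (indicator 0 a x) k (χ b c₁) (Φ-values a b c₂) ⟩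
                  indicator 0 a x * (k * χ b c₁) * k * Φ-values a b c₂
                    ≡⟨ cong₂ (λ s t → indicator 0 a x * s * k * t) (sym (indicator≡ 1 b y))
                        (∑-χ c₂ (λ c → Φ-values a b c)) ⟩
                  indicator 0 a x * indicator 1 b y * k * ∑ classes (λ c → χ c c₂ * Φ-values a b c)
                    ≡⟨ sym (∑-*ˡ classes (indicator 0 a x * indicator 1 b y * k) (λ c → χ c c₂ * Φ-values a b c)) ⟩
                  ∑ classes (λ c → indicator 0 a x * indicator 1 b y * k * (χ c c₂ * Φ-values a b c))
                    ≡⟨ (∑-cong classes λ c → trans (lem₃ (indicator 0 a x) (indicator 1 b y) k (χ c c₂)
                        (Φ-values a b c))
                         (cong (λ s → indicator 0 a x * (indicator 1 b y * s) * Φ-values a b c)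
                             (sym (indicator≡ 2 c z)))) ⟩
                  ∑ classes (λ c → indicator 0 a x * (indicator 1 b y * indicator 2 c z) * Φ-values a b c) ∎) ⟩
              ∑ classes (λ b → ∑ classes (λ c → indicator 0 a x * (indicator 1 b y * indicator 2 c z) * Φ-values a b c)) ∎) ⟩
          ∑³ (λ a b c → (indicator 0 a x * (indicator 1 b y * indicator 2 c z)) * Φ-values a b c) ∎
          where
          open ≡-Reasoning
          c₀ c₁ c₂ : Class
          c₀ = class 0 x
          c₁ = class 1 y
          c₂ = class 2 z
          lem : ∀ k a l u → k * k * k * (a * u) ≡ k * a * k * k * u
          lem = solve-∀
          lem₂ : ∀ f k b u → f * k * k * (b * u) ≡ f * (k * b) * k * u
          lem₂ = solve-∀
          lem₃ : ∀ f g k c u → f * g * k * (c * u) ≡ f * (g * (k * c)) * u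
          lem₃ = solve-∀

        ∑∑-swap : ∀ (f : Carrier → Carrier → Class → ℤ) →
          ∑ elements (λ x → ∑ elements (λ y → ∑ classes (f x y)))
              ≡ ∑ classes (λ a → ∑ elements (λ x → ∑ elements (λ y → f x y a)))
        ∑∑-swap f = trans (∑-cong elements λ x → ∑-swap elements classes (f x))
          (∑-swap elements classes (λ x a → ∑ elements (λ y → f x y a)))

      total : ℤ
      total = ∑ elements (λ x → ∑ elements (λ y → Φ (K 0 x + (K 1 y + K 2 (x ⊕ y)))))

      private
        total-expansion : k * k * k * total ≡ ∑³ (λ a b c → count a b c * Φ-values a b c)
        total-expansion = begin
          k * k * k * total
            ≡⟨ sym (trans (∑-cong elements λ x → ∑-*ˡ elements (k * k * k) (λ y → Φ (K 0 x + (K 1 y + K 2 (x ⊕ y)))))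
                 (∑-*ˡ elements (k * k * k) (λ x → ∑ elements (λ y → Φ (K 0 x + (K 1 y + K 2 (x ⊕ y))))))) ⟩
          ∑ elements (λ x → ∑ elements (λ y → k * k * k * Φ (K 0 x + (K 1 y + K 2 (x ⊕ y)))))
            ≡⟨ (∑-cong elements λ x → ∑-cong elements λ y → pointwise x y (x ⊕ y)) ⟩
          ∑ elements (λ x → ∑ elements (λ y → ∑³ (λ a b c → P a b c x y * Φ-values a b c)))
            ≡⟨ ∑∑-swap (λ x y a → ∑ classes (λ b → ∑ classes (λ c → P a b c x y * Φ-values a b c))) ⟩
          ∑ classes (λ a → ∑ elements (λ x
              → ∑ elements (λ y → ∑ classes (λ b → ∑ classes (λ c → P a b c x y * Φ-values a b c)))))
            ≡⟨ (∑-cong classes λ a → trans (∑∑-swap (λ x y b → ∑ classes (λ c → P a b c x y * Φ-values a b c)))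
                 (∑-cong classes λ b → trans (∑∑-swap (λ x y c → P a b c x y * Φ-values a b c)) (∑-cong classes λ c
                     → collect a b c))) ⟩
          ∑³ (λ a b c → count a b c * Φ-values a b c) ∎
          where
          open ≡-Reasoning
          P : Class → Class → Class → Carrier → Carrier → ℤ
          P a b c x y = indicator 0 a x * (indicator 1 b y * indicator 2 c (x ⊕ y))
          collect : ∀ a b c → ∑ elements (λ x → ∑ elements (λ y → P a b c x y * Φ-values a b c))
              ≡ count a b c * Φ-values a b c
          collect a b c = trans (∑-cong elements λ x → ∑-*ʳ elements (Φ-values a b c) (P a b c x))
            (trans (∑-*ʳ elements (Φ-values a b c) (λ x → ∑ elements (P a b c x)))
              (cong (_* Φ-values a b c) (∑-φ-φ-φ (coefficient₁ S a) (coefficientδ S a) (coefficientK S a)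
                (coefficient₁ S b) (coefficientδ S b) (coefficientK S b) (coefficient₁ S c) (coefficientδ S c)
                    (coefficientK S c))))

        -- Even when the three `K j` are different functions the count is symmetric, because the
        -- trilinear form sees them only through `G`.
        symmetric₁₂ : ∀ a b c → count a b c * Φ-values a b c ≡ count b a c * Φ-values b a c
        symmetric₁₂ a b c = cong₂ _*_ (trilinear-swap₁₂ r A G (coefficient₁ S a) (coefficientδ S a) (coefficientK S a)
            (coefficient₁ S b) (coefficientδ S b) (coefficientK S b) (coefficient₁ S c) (coefficientδ S c)
                (coefficientK S c))
          (cong Φ (lem (value S a) (value S b) (value S c)))
          where
          lem : ∀ x y z → x + (y + z) ≡ y + (x + z)
          lem = solve-∀

        symmetric₂₃ : ∀ a b c → count a b c * Φ-values a b c ≡ count a c b * Φ-values a c b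
        symmetric₂₃ a b c = cong₂ _*_ (trilinear-swap₂₃ r A G (coefficient₁ S a) (coefficientδ S a) (coefficientK S a)
            (coefficient₁ S b) (coefficientδ S b) (coefficientK S b) (coefficient₁ S c) (coefficientδ S c)
                (coefficientK S c))
          (cong (λ t → Φ (value S a + t)) (ℤₚ.+-comm (value S b) (value S c)))

        -- Only the pair `(𝟘 , 𝟘)` is counted. Here and in the nine evaluations that follow,
        -- `r = S²` leaves a polynomial identity in `S` and `G`, stated with the coefficients of the
        -- classes unfolded.
        nnn : count null null null ≡ S * S * S * + 27
        nnn = trans (cong (λ r → trilinear r A G (coefficient₁ S null) (coefficientδ S null) (coefficientK S null)
            (coefficient₁ S null) (coefficientδ S null) (coefficientK S null) (coefficient₁ S null)
            (coefficientδ S null) (coefficientK S null)) order≡S²) (lem S G)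
          where
          lem : ∀ S G → 0ℤ * 0ℤ * 0ℤ * (S * S) * (S * S)
              + (0ℤ * 0ℤ * (+ 3 * S) + 0ℤ * (+ 3 * S) * 0ℤ + (+ 3 * S) * 0ℤ * 0ℤ) * (S * S)
              + (0ℤ * (+ 3 * S) * (+ 3 * S) + (+ 3 * S) * 0ℤ * (+ 3 * S) + (+ 3 * S) * (+ 3 * S) * 0ℤ)
              + (+ 3 * S) * (+ 3 * S) * (+ 3 * S)
              + (S * S - 1ℤ) * ((+ 3 * S) * (+ 3 * S) * 0ℤ + (+ 3 * S) * 0ℤ * (+ 3 * S)
              + 0ℤ * (+ 3 * S) * (+ 3 * S)) + + 3 * G * (S * S) * (S * S - 1ℤ) *
              ((+ 3 * S) * 0ℤ * 0ℤ + 0ℤ * (+ 3 * S) * 0ℤ + 0ℤ * 0ℤ * (+ 3 * S))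
              + + 9 * G * (S * S) * (S * S) * (S * S - 1ℤ) * (0ℤ * 0ℤ * 0ℤ) ≡ S * S * S * + 27
          lem = solve-∀

        nnc : count null null cubic ≡ S * S * S * 0ℤ
        nnc = trans (cong (λ r → trilinear r A G (coefficient₁ S null) (coefficientδ S null) (coefficientK S null)
            (coefficient₁ S null) (coefficientδ S null) (coefficientK S null) (coefficient₁ S cubic)
            (coefficientδ S cubic) (coefficientK S cubic)) order≡S²) (lem S G)
          where
          lem : ∀ S G → 0ℤ * 0ℤ * (S - 1ℤ) * (S * S) * (S * S)
              + (0ℤ * 0ℤ * (S * S - S) + 0ℤ * (+ 3 * S) * (S - 1ℤ) + (+ 3 * S) * 0ℤ * (S - 1ℤ)) * (S * S)
              + (0ℤ * (+ 3 * S) * (S * S - S) + (+ 3 * S) * 0ℤ * (S * S - S)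
              + (+ 3 * S) * (+ 3 * S) * (S - 1ℤ)) + (+ 3 * S) * (+ 3 * S) * (S * S - S)
              + (S * S - 1ℤ) * ((+ 3 * S) * (+ 3 * S) * - 1ℤ + (+ 3 * S) * 0ℤ * (S * S - S)
              + 0ℤ * (+ 3 * S) * (S * S - S))
              + + 3 * G * (S * S) * (S * S - 1ℤ) *
              ((+ 3 * S) * 0ℤ * - 1ℤ + 0ℤ * (+ 3 * S) * - 1ℤ + 0ℤ * 0ℤ * (S * S - S))
              + + 9 * G * (S * S) * (S * S) * (S * S - 1ℤ) * (0ℤ * 0ℤ * - 1ℤ)
              ≡ S * S * S * 0ℤ
          lem = solve-∀

        nng : count null null noncubic ≡ S * S * S * 0ℤ
        nng = trans (cong (λ r → trilinear r A G (coefficient₁ S null) (coefficientδ S null) (coefficientK S null)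
            (coefficient₁ S null) (coefficientδ S null) (coefficientK S null) (coefficient₁ S noncubic)
            (coefficientδ S noncubic) (coefficientK S noncubic)) order≡S²) (lem S G)
          where
          lem : ∀ S G → 0ℤ * 0ℤ * (+ 3 * S - (S - 1ℤ)) * (S * S) * (S * S)
              + (0ℤ * 0ℤ * (- (+ 3 * S) - (S * S - S)) + 0ℤ * (+ 3 * S) * (+ 3 * S - (S - 1ℤ))
              + (+ 3 * S) * 0ℤ * (+ 3 * S - (S - 1ℤ))) * (S * S)
              + (0ℤ * (+ 3 * S) * (- (+ 3 * S) - (S * S - S))
              + (+ 3 * S) * 0ℤ * (- (+ 3 * S) - (S * S - S))
              + (+ 3 * S) * (+ 3 * S) * (+ 3 * S - (S - 1ℤ)))
              + (+ 3 * S) * (+ 3 * S) * (- (+ 3 * S) - (S * S - S))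
              + (S * S - 1ℤ) * ((+ 3 * S) * (+ 3 * S) * 1ℤ
              + (+ 3 * S) * 0ℤ * (- (+ 3 * S) - (S * S - S))
              + 0ℤ * (+ 3 * S) * (- (+ 3 * S) - (S * S - S)))
              + + 3 * G * (S * S) * (S * S - 1ℤ) *
              ((+ 3 * S) * 0ℤ * 1ℤ + 0ℤ * (+ 3 * S) * 1ℤ
              + 0ℤ * 0ℤ * (- (+ 3 * S) - (S * S - S)))
              + + 9 * G * (S * S) * (S * S) * (S * S - 1ℤ) *
              (0ℤ * 0ℤ * 1ℤ) ≡ S * S * S * 0ℤ
          lem = solve-∀

        -- With `x = 𝟘` the other two arguments coincide. An element cubic for both `j = 1` and
        -- `j = 2` exists only if the twists agree, and then there are `R = (S² - 1)/3` of them.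
        ncc : count null cubic cubic ≡ S * S * S * (+ 9 * (S * S - 1ℤ) * G)
        ncc = trans (cong (λ r → trilinear r A G (coefficient₁ S null) (coefficientδ S null) (coefficientK S null)
            (coefficient₁ S cubic) (coefficientδ S cubic) (coefficientK S cubic) (coefficient₁ S cubic)
            (coefficientδ S cubic) (coefficientK S cubic)) order≡S²) (lem S G)
          where
          lem : ∀ S G → 0ℤ * (S - 1ℤ) * (S - 1ℤ) * (S * S) * (S * S)
              + (0ℤ * (S - 1ℤ) * (S * S - S) + 0ℤ * (S * S - S) * (S - 1ℤ) + (+ 3 * S) * (S - 1ℤ) * (S - 1ℤ)) *
              (S * S) + (0ℤ * (S * S - S) * (S * S - S) + (+ 3 * S) * (S - 1ℤ) * (S * S - S)
              + (+ 3 * S) * (S * S - S) * (S - 1ℤ)) + (+ 3 * S) * (S * S - S) * (S * S - S)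
              + (S * S - 1ℤ) * ((+ 3 * S) * (S * S - S) * - 1ℤ + (+ 3 * S) * - 1ℤ * (S * S - S)
              + 0ℤ * (S * S - S) * (S * S - S))
              + + 3 * G * (S * S) * (S * S - 1ℤ) *
              ((+ 3 * S) * - 1ℤ * - 1ℤ + 0ℤ * (S * S - S) * - 1ℤ + 0ℤ * - 1ℤ * (S * S - S))
              + + 9 * G * (S * S) * (S * S) * (S * S - 1ℤ) * (0ℤ * - 1ℤ * - 1ℤ)
              ≡ S * S * S * (+ 9 * (S * S - 1ℤ) * G)
          lem = solve-∀

        ncg : count null cubic noncubic ≡ S * S * S * (+ 9 * (S * S - 1ℤ) * (1ℤ - G))
        ncg = trans (cong (λ r → trilinear r A G (coefficient₁ S null) (coefficientδ S null) (coefficientK S null)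
            (coefficient₁ S cubic) (coefficientδ S cubic) (coefficientK S cubic) (coefficient₁ S noncubic)
            (coefficientδ S noncubic) (coefficientK S noncubic)) order≡S²) (lem S G)
          where
          lem : ∀ S G → 0ℤ * (S - 1ℤ) * (+ 3 * S - (S - 1ℤ)) * (S * S) * (S * S)
              + (0ℤ * (S - 1ℤ) * (- (+ 3 * S) - (S * S - S)) + 0ℤ * (S * S - S) * (+ 3 * S - (S - 1ℤ))
              + (+ 3 * S) * (S - 1ℤ) * (+ 3 * S - (S - 1ℤ))) * (S * S)
              + (0ℤ * (S * S - S) * (- (+ 3 * S) - (S * S - S))
              + (+ 3 * S) * (S - 1ℤ) * (- (+ 3 * S) - (S * S - S))
              + (+ 3 * S) * (S * S - S) * (+ 3 * S - (S - 1ℤ)))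
              + (+ 3 * S) * (S * S - S) * (- (+ 3 * S) - (S * S - S))
              + (S * S - 1ℤ) * ((+ 3 * S) * (S * S - S) * 1ℤ
              + (+ 3 * S) * - 1ℤ * (- (+ 3 * S) - (S * S - S))
              + 0ℤ * (S * S - S) * (- (+ 3 * S) - (S * S - S)))
              + + 3 * G * (S * S) * (S * S - 1ℤ) *
              ((+ 3 * S) * - 1ℤ * 1ℤ + 0ℤ * (S * S - S) * 1ℤ
              + 0ℤ * - 1ℤ * (- (+ 3 * S) - (S * S - S)))
              + + 9 * G * (S * S) * (S * S) * (S * S - 1ℤ) *
              (0ℤ * - 1ℤ * 1ℤ) ≡ S * S * S * (+ 9 *
              (S * S - 1ℤ) * (1ℤ - G))
          lem = solve-∀

        -- Of the three cubic classes, two are noncubic for both twists when `G = 1`, but only one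
        -- when `G = 0`; hence the factor `1 + G`.
        ngg : count null noncubic noncubic ≡ S * S * S * (+ 9 * (S * S - 1ℤ) * (1ℤ + G))
        ngg = trans (cong (λ r → trilinear r A G (coefficient₁ S null) (coefficientδ S null) (coefficientK S null)
            (coefficient₁ S noncubic) (coefficientδ S noncubic) (coefficientK S noncubic) (coefficient₁ S noncubic)
            (coefficientδ S noncubic) (coefficientK S noncubic)) order≡S²) (lem S G)
          where
          lem : ∀ S G → 0ℤ * (+ 3 * S - (S - 1ℤ)) * (+ 3 * S - (S - 1ℤ)) * (S * S) * (S * S)
              + (0ℤ * (+ 3 * S - (S - 1ℤ)) * (- (+ 3 * S) - (S * S - S))
              + 0ℤ * (- (+ 3 * S) - (S * S - S)) * (+ 3 * S - (S - 1ℤ))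
              + (+ 3 * S) * (+ 3 * S - (S - 1ℤ)) * (+ 3 * S - (S - 1ℤ))) * (S * S)
              + (0ℤ * (- (+ 3 * S) - (S * S - S)) * (- (+ 3 * S) - (S * S - S))
              + (+ 3 * S) * (+ 3 * S - (S - 1ℤ)) * (- (+ 3 * S) - (S * S - S))
              + (+ 3 * S) * (- (+ 3 * S) - (S * S - S)) * (+ 3 * S - (S - 1ℤ)))
              + (+ 3 * S) * (- (+ 3 * S) - (S * S - S)) * (- (+ 3 * S) - (S * S - S))
              + (S * S - 1ℤ) * ((+ 3 * S) * (- (+ 3 * S) - (S * S - S)) * 1ℤ
              + (+ 3 * S) * 1ℤ * (- (+ 3 * S) - (S * S - S))
              + 0ℤ * (- (+ 3 * S) - (S * S - S)) * (- (+ 3 * S) - (S * S - S)))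
              + + 3 * G * (S * S) * (S * S - 1ℤ) *
              ((+ 3 * S) * 1ℤ * 1ℤ + 0ℤ * (- (+ 3 * S) - (S * S - S)) *
              1ℤ + 0ℤ * 1ℤ * (- (+ 3 * S) - (S * S - S)))
              + + 9 * G * (S * S) * (S * S) * (S * S - 1ℤ) *
              (0ℤ * 1ℤ * 1ℤ) ≡ S * S * S * (+ 9 *
              (S * S - 1ℤ) * (1ℤ + G))
          lem = solve-∀

        ccc : count cubic cubic cubic ≡ S * S * S * ((S * S - 1ℤ) * (S * S + 1ℤ - + 2 * S - + 9 * G))
        ccc = trans (cong (λ r → trilinear r A G (coefficient₁ S cubic) (coefficientδ S cubic)
            (coefficientK S cubic) (coefficient₁ S cubic) (coefficientδ S cubic) (coefficientK S cubic)
            (coefficient₁ S cubic) (coefficientδ S cubic) (coefficientK S cubic)) order≡S²) (lem S G)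
          where
          lem : ∀ S G → (S - 1ℤ) * (S - 1ℤ) * (S - 1ℤ) * (S * S) * (S * S)
              + ((S - 1ℤ) * (S - 1ℤ) * (S * S - S) + (S - 1ℤ) * (S * S - S) * (S - 1ℤ)
              + (S * S - S) * (S - 1ℤ) * (S - 1ℤ)) * (S * S)
              + ((S - 1ℤ) * (S * S - S) * (S * S - S) + (S * S - S) * (S - 1ℤ) * (S * S - S)
              + (S * S - S) * (S * S - S) * (S - 1ℤ)) + (S * S - S) * (S * S - S) * (S * S - S)
              + (S * S - 1ℤ) * ((S * S - S) * (S * S - S) * - 1ℤ + (S * S - S) * - 1ℤ * (S * S - S)
              + - 1ℤ * (S * S - S) * (S * S - S))
              + + 3 * G * (S * S) * (S * S - 1ℤ) *
              ((S * S - S) * - 1ℤ * - 1ℤ + - 1ℤ * (S * S - S) * - 1ℤ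
              + - 1ℤ * - 1ℤ * (S * S - S)) + + 9 * G * (S * S) * (S * S) *
              (S * S - 1ℤ) * (- 1ℤ * - 1ℤ * - 1ℤ)
              ≡ S * S * S * ((S * S - 1ℤ) * (S * S + 1ℤ - + 2 * S - + 9 * G))
          lem = solve-∀

        ccg : count cubic cubic noncubic ≡ S * S * S * (+ 2 * (S * S - 1ℤ) * (S * S - + 2 + S))
        ccg = trans (cong (λ r → trilinear r A G (coefficient₁ S cubic) (coefficientδ S cubic)
            (coefficientK S cubic) (coefficient₁ S cubic) (coefficientδ S cubic) (coefficientK S cubic)
            (coefficient₁ S noncubic) (coefficientδ S noncubic) (coefficientK S noncubic)) order≡S²) (lem S G)
          where
          lem : ∀ S G → (S - 1ℤ) * (S - 1ℤ) * (+ 3 * S - (S - 1ℤ)) * (S * S) * (S * S)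
              + ((S - 1ℤ) * (S - 1ℤ) * (- (+ 3 * S) - (S * S - S)) + (S - 1ℤ) * (S * S - S) * (+ 3 * S - (S - 1ℤ))
              + (S * S - S) * (S - 1ℤ) * (+ 3 * S - (S - 1ℤ))) * (S * S)
              + ((S - 1ℤ) * (S * S - S) * (- (+ 3 * S) - (S * S - S))
              + (S * S - S) * (S - 1ℤ) * (- (+ 3 * S) - (S * S - S))
              + (S * S - S) * (S * S - S) * (+ 3 * S - (S - 1ℤ)))
              + (S * S - S) * (S * S - S) * (- (+ 3 * S) - (S * S - S))
              + (S * S - 1ℤ) * ((S * S - S) * (S * S - S) * 1ℤ
              + (S * S - S) * - 1ℤ * (- (+ 3 * S) - (S * S - S))
              + - 1ℤ * (S * S - S) * (- (+ 3 * S) - (S * S - S)))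
              + + 3 * G * (S * S) * (S * S - 1ℤ) *
              ((S * S - S) * - 1ℤ * 1ℤ + - 1ℤ * (S * S - S) * 1ℤ
              + - 1ℤ * - 1ℤ * (- (+ 3 * S) - (S * S - S)))
              + + 9 * G * (S * S) * (S * S) * (S * S - 1ℤ) *
              (- 1ℤ * - 1ℤ * 1ℤ) ≡ S * S * S *
              (+ 2 * (S * S - 1ℤ) * (S * S - + 2 + S))
          lem = solve-∀

        cgg : count cubic noncubic noncubic ≡ S * S * S * ((S * S - 1ℤ) * (+ 4 * (S * S) - + 11 - + 2 * S + + 9 * G))
        cgg = trans (cong (λ r → trilinear r A G (coefficient₁ S cubic) (coefficientδ S cubic)
            (coefficientK S cubic) (coefficient₁ S noncubic) (coefficientδ S noncubic) (coefficientK S noncubic)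
            (coefficient₁ S noncubic) (coefficientδ S noncubic) (coefficientK S noncubic)) order≡S²) (lem S G)
          where
          lem : ∀ S G → (S - 1ℤ) * (+ 3 * S - (S - 1ℤ)) * (+ 3 * S - (S - 1ℤ)) * (S * S) * (S * S)
              + ((S - 1ℤ) * (+ 3 * S - (S - 1ℤ)) * (- (+ 3 * S) - (S * S - S))
              + (S - 1ℤ) * (- (+ 3 * S) - (S * S - S)) * (+ 3 * S - (S - 1ℤ))
              + (S * S - S) * (+ 3 * S - (S - 1ℤ)) * (+ 3 * S - (S - 1ℤ))) * (S * S)
              + ((S - 1ℤ) * (- (+ 3 * S) - (S * S - S)) * (- (+ 3 * S) - (S * S - S))
              + (S * S - S) * (+ 3 * S - (S - 1ℤ)) * (- (+ 3 * S) - (S * S - S))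
              + (S * S - S) * (- (+ 3 * S) - (S * S - S)) * (+ 3 * S - (S - 1ℤ)))
              + (S * S - S) * (- (+ 3 * S) - (S * S - S)) * (- (+ 3 * S) - (S * S - S))
              + (S * S - 1ℤ) * ((S * S - S) * (- (+ 3 * S) - (S * S - S)) * 1ℤ
              + (S * S - S) * 1ℤ * (- (+ 3 * S) - (S * S - S))
              + - 1ℤ * (- (+ 3 * S) - (S * S - S)) *
              (- (+ 3 * S) - (S * S - S))) + + 3 * G * (S * S) *
              (S * S - 1ℤ) * ((S * S - S) * 1ℤ * 1ℤ
              + - 1ℤ * (- (+ 3 * S) - (S * S - S)) * 1ℤ
              + - 1ℤ * 1ℤ * (- (+ 3 * S) - (S * S - S)))
              + + 9 * G * (S * S) * (S * S) *
              (S * S - 1ℤ) * (- 1ℤ * 1ℤ * 1ℤ)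
              ≡ S * S * S * ((S * S - 1ℤ) * (+ 4 *
              (S * S) - + 11 - + 2 * S + + 9 * G))
          lem = solve-∀

        ggg : count noncubic noncubic noncubic ≡ S * S * S * (+ 2 * (S * S - 1ℤ) * (+ 4 * (S * S) - + 5 + S - + 9 * G))
        ggg = trans (cong (λ r → trilinear r A G (coefficient₁ S noncubic) (coefficientδ S noncubic)
            (coefficientK S noncubic) (coefficient₁ S noncubic) (coefficientδ S noncubic) (coefficientK S noncubic)
            (coefficient₁ S noncubic) (coefficientδ S noncubic) (coefficientK S noncubic)) order≡S²) (lem S G)
          where
          lem : ∀ S G → (+ 3 * S - (S - 1ℤ)) * (+ 3 * S - (S - 1ℤ)) * (+ 3 * S - (S - 1ℤ)) * (S * S) * (S * S)
              + ((+ 3 * S - (S - 1ℤ)) * (+ 3 * S - (S - 1ℤ)) * (- (+ 3 * S) - (S * S - S))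
              + (+ 3 * S - (S - 1ℤ)) * (- (+ 3 * S) - (S * S - S)) * (+ 3 * S - (S - 1ℤ))
              + (- (+ 3 * S) - (S * S - S)) * (+ 3 * S - (S - 1ℤ)) * (+ 3 * S - (S - 1ℤ))) * (S * S)
              + ((+ 3 * S - (S - 1ℤ)) * (- (+ 3 * S) - (S * S - S)) * (- (+ 3 * S) - (S * S - S))
              + (- (+ 3 * S) - (S * S - S)) * (+ 3 * S - (S - 1ℤ)) * (- (+ 3 * S) - (S * S - S))
              + (- (+ 3 * S) - (S * S - S)) * (- (+ 3 * S) - (S * S - S)) *
              (+ 3 * S - (S - 1ℤ))) + (- (+ 3 * S) - (S * S - S)) *
              (- (+ 3 * S) - (S * S - S)) * (- (+ 3 * S) - (S * S - S))
              + (S * S - 1ℤ) * ((- (+ 3 * S) - (S * S - S)) *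
              (- (+ 3 * S) - (S * S - S)) * 1ℤ
              + (- (+ 3 * S) - (S * S - S)) * 1ℤ *
              (- (+ 3 * S) - (S * S - S)) + 1ℤ *
              (- (+ 3 * S) - (S * S - S)) * (- (+ 3 * S) -
              (S * S - S))) + + 3 * G * (S * S) *
              (S * S - 1ℤ) * ((- (+ 3 * S) - (S * S - S)) *
              1ℤ * 1ℤ + 1ℤ * (- (+ 3 * S) - (S * S -
              S)) * 1ℤ + 1ℤ * 1ℤ * (- (+ 3 * S) -
              (S * S - S))) + + 9 * G * (S * S)
              * (S * S) * (S * S - 1ℤ) * (1ℤ * 1ℤ * 1ℤ) ≡ S * S * S * (+ 2 * (S * S - 1ℤ) * (+ 4 * (S * S) - + 5 + S - + 9 * G))
          lem = solve-∀

      distribution : {{_ : ℤ.NonZero (S * S * S)}} → + 27 * total ≡ distributionSum S G Φ-values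
      distribution = ℤₚ.*-cancelˡ-≡ (S * S * S) (+ 27 * total) (distributionSum S G Φ-values) (begin
        S * S * S * (+ 27 * total)     ≡⟨ lem₁ S total ⟩
        k * k * k * total              ≡⟨ total-expansion ⟩
        ∑³ U                           ≡⟨ ∑-symmetric U symmetric₁₂ symmetric₂₃ ⟩
        ten (count null null null) (count null null cubic) (count null null noncubic) (count null cubic cubic)
            (count null cubic noncubic)
          (count null noncubic noncubic) (count cubic cubic cubic) (count cubic cubic noncubic)
              (count cubic noncubic noncubic) (count noncubic noncubic noncubic)
          ≡⟨ ten-cong nnn nnc nng ncc ncg ngg ccc ccg cgg ggg ⟩
        ten (S * S * S * NNN) (S * S * S * NNC) (S * S * S * NNG) (S * S * S * NCC) (S * S * S * NCG) (S * S * S * NGG)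
          (S * S * S * CCC) (S * S * S * CCG) (S * S * S * CGG) (S * S * S * GGG)
          ≡⟨ lem₂ S G (Φ-values null null null) (Φ-values null null cubic) (Φ-values null null noncubic)
              (Φ-values null cubic cubic)
               (Φ-values null cubic noncubic) (Φ-values null noncubic noncubic) (Φ-values cubic cubic cubic)
               (Φ-values cubic cubic noncubic) (Φ-values cubic noncubic noncubic)
                   (Φ-values noncubic noncubic noncubic) ⟩
        S * S * S * distributionSum S G Φ-values             ∎)
        where
        open ≡-Reasoning
        U : Class → Class → Class → ℤ
        U a b c = count a b c * Φ-values a b c
        NNN NNC NNG NCC NCG NGG CCC CCG CGG GGG : ℤ
        NNN = + 27
        NNC = 0ℤ
        NNG = 0ℤ
        NCC = (+ 9 * (S * S - 1ℤ) * G)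
        NCG = (+ 9 * (S * S - 1ℤ) * (1ℤ - G))
        NGG = (+ 9 * (S * S - 1ℤ) * (1ℤ + G))
        CCC = ((S * S - 1ℤ) * (S * S + 1ℤ - + 2 * S - + 9 * G))
        CCG = (+ 2 * (S * S - 1ℤ) * (S * S - + 2 + S))
        CGG = ((S * S - 1ℤ) * (+ 4 * (S * S) - + 11 - + 2 * S + + 9 * G))
        GGG = (+ 2 * (S * S - 1ℤ) * (+ 4 * (S * S) - + 5 + S - + 9 * G))
        ten : (x₁ x₂ x₃ x₄ x₅ x₆ x₇ x₈ x₉ x₁₀ : ℤ) → ℤ
        ten x₁ x₂ x₃ x₄ x₅ x₆ x₇ x₈ x₉ x₁₀ = x₁ * Φ-values null null null + + 3 * (x₂ * Φ-values null null cubic)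
          + + 3 * (x₃ * Φ-values null null noncubic) + + 3 * (x₄ * Φ-values null cubic cubic)
              + + 6 * (x₅ * Φ-values null cubic noncubic)
          + + 3 * (x₆ * Φ-values null noncubic noncubic) + x₇ * Φ-values cubic cubic cubic
              + + 3 * (x₈ * Φ-values cubic cubic noncubic)
          + + 3 * (x₉ * Φ-values cubic noncubic noncubic) + x₁₀ * Φ-values noncubic noncubic noncubic
        ten-cong : ∀ {x₁ x₂ x₃ x₄ x₅ x₆ x₇ x₈ x₉ x₁₀ y₁ y₂ y₃ y₄ y₅ y₆ y₇ y₈ y₉ y₁₀} →
          x₁ ≡ y₁ → x₂ ≡ y₂ → x₃ ≡ y₃ → x₄ ≡ y₄ → x₅ ≡ y₅ → x₆ ≡ y₆ → x₇ ≡ y₇ → x₈ ≡ y₈ → x₉ ≡ y₉ → x₁₀ ≡ y₁₀ →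
          ten x₁ x₂ x₃ x₄ x₅ x₆ x₇ x₈ x₉ x₁₀ ≡ ten y₁ y₂ y₃ y₄ y₅ y₆ y₇ y₈ y₉ y₁₀
        ten-cong refl refl refl refl refl refl refl refl refl refl = refl
        lem₁ : ∀ S t → S * S * S * (+ 27 * t) ≡ (+ 3 * S) * (+ 3 * S) * (+ 3 * S) * t
        lem₁ = solve-∀
        lem₂ : ∀ S G f₁ f₂ f₃ f₄ f₅ f₆ f₇ f₈ f₉ f₁₀ → S * S * S * + 27 * f₁ + + 3 * (S * S * S * 0ℤ * f₂)
            + + 3 * (S * S * S * 0ℤ * f₃) + + 3 * (S * S * S * (+ 9 * (S * S - 1ℤ) * G) * f₄)
            + + 6 * (S * S * S * (+ 9 * (S * S - 1ℤ) * (1ℤ - G)) * f₅)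
            + + 3 * (S * S * S * (+ 9 * (S * S - 1ℤ) * (1ℤ + G)) * f₆)
            + S * S * S * ((S * S - 1ℤ) * (S * S + 1ℤ - + 2 * S - + 9 * G)) * f₇
            + + 3 * (S * S * S * (+ 2 * (S * S - 1ℤ) * (S * S - + 2 + S)) * f₈)
            + + 3 * (S * S * S * ((S * S - 1ℤ) * (+ 4 * (S * S) - + 11 - + 2 * S + + 9 * G)) *
            f₉) + S * S * S * (+ 2 * (S * S - 1ℤ) * (+ 4 * (S * S) - + 5 + S - + 9 * G)) *
            f₁₀ ≡
          S * S * S * (+ 27 * f₁ + + 27 * (S * S - 1ℤ) * G * f₄ + + 54 * (S * S - 1ℤ) * (1ℤ - G) * f₅
              + + 27 * (S * S - 1ℤ) * (1ℤ + G) * f₆ + (S * S - 1ℤ) * (S * S + 1ℤ - + 2 * S - + 9 * G) * f₇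
              + + 6 * (S * S - 1ℤ) * (S * S - + 2 + S) * f₈
              + + 3 * (S * S - 1ℤ) * (+ 4 * (S * S) - + 11 - + 2 * S + + 9 * G) * f₉
              + + 2 * (S * S - 1ℤ) * (+ 4 * (S * S) - + 5 + S - + 9 * G) * f₁₀)
        lem₂ = solve-∀

-- From codeword weights to the cubic periods.

module Code (F : FiniteField) {α : FiniteField.Carrier F} (α-primitive : FiniteField.IsPrimitive F α)
  {p s m : ℕ} (p-prime : Prime p) (s≥1 : 1 ≤ s) (m≥1 : 1 ≤ m) (order≡ : FiniteField.order F ≡ (p ℕ.^ s) ℕ.^ m)
  (p%3≡2 : p % 3 ≡ 2) (v : ℕ) (3vq⁻≡αᵒ : 3 ℕ.* v ℕ.* (p ℕ.^ s ℕ.∸ 1) ≡ PrimitiveElement.αᵒ F α-primitive)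
  (3∣q⁻ : 3 ∣ p ℕ.^ s ℕ.∸ 1) (h k : ℕ) (v-k-coprime : Coprime v k)
  (S σ : ℤ) (S²≡order : S * S ≡ + FiniteField.order F) (S≡1+3σ : S ≡ 1ℤ + + 3 * σ)
  (G : ℤ) (G²≡G : G * G ≡ G) (same-class : ∀ i j → i < j → j < 3 → ⟦ (k ℕ.* j) % 3 ℕₚ.≟ (k ℕ.* i) % 3 ⟧ ≡ G) where

  open FieldProperties F
  open PrimitiveElement F α-primitive
  open Trace F α-primitive p-prime s≥1 m≥1 order≡
  open Cyclotomy F α-primitive p-prime s≥1 m≥1 order≡ p%3≡2 v 3vq⁻≡αᵒ

  -- The exponent `k j` is the twist by `gʲ`; the factor 3 clears the denominators of the periods in
  -- terms of `S`.
  K : ℕ → Carrier → ℤ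
  K j x = + 3 * H (α ↑ (k ℕ.* j) ⊗ x)

  cubicity : {P : Set} → Dec P → Class
  cubicity (yes _) = cubic
  cubicity (no _)  = noncubic

  -- The class is that of `gʲ x`. The decision is an argument, so that facts about `class` can be
  -- proved by matching on it.
  classify : ∀ j x → Dec (x ≡ 𝟘) → Class
  classify j x (yes _)  = null
  classify j x (no x≢0) = cubicity ((k ℕ.* j ℕ.+ log x≢0) % 3 ℕₚ.≟ 0)

  class : ℕ → Carrier → Class
  class j x = classify j x (x ≟ 𝟘)

  K-classify : ∀ j x (d : Dec (x ≡ 𝟘)) → K j x ≡ value S (classify j x d)
  K-classify j x (yes x≡0) = begin
    + 3 * H (α ↑ (k ℕ.* j) ⊗ x)     ≡⟨ cong (λ y → + 3 * H y) (trans (cong (α ↑ (k ℕ.* j) ⊗_) x≡0) (⊗-zeroʳ _)) ⟩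
    + 3 * H 𝟘                       ≡⟨ cong (+ 3 *_) H-𝟘 ⟩
    + 3 * + R                       ≡⟨ lem (+ R) ⟩
    (1ℤ + + 3 * + R) - 1ℤ           ≡⟨ cong (_- 1ℤ) (trans (sym r≡1+3R) (sym S²≡order)) ⟩
    S * S - 1ℤ                      ∎
    where
    open ≡-Reasoning
    lem : ∀ R → + 3 * R ≡ (1ℤ + + 3 * R) - 1ℤ
    lem = solve-∀
  K-classify j x (no x≢0) = trans (cong (λ y → + 3 * H y) x-power) (go ((k ℕ.* j ℕ.+ log x≢0) % 3 ℕₚ.≟ 0))
    where
    x-power : α ↑ (k ℕ.* j) ⊗ x ≡ α ↑ (k ℕ.* j ℕ.+ log x≢0)
    x-power = trans (cong (α ↑ (k ℕ.* j) ⊗_) (sym (α↑log x≢0))) (sym (↑-+ α (k ℕ.* j) _))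
    go : (d : Dec ((k ℕ.* j ℕ.+ log x≢0) % 3 ≡ 0)) → + 3 * η (k ℕ.* j ℕ.+ log x≢0) ≡ value S (cubicity d)
    go (yes e≡0) = trans (cong (+ 3 *_) (trans (η-% (k ℕ.* j ℕ.+ log x≢0)) (cong η e≡0))) (3η₀ S σ S²≡order S≡1+3σ)
    go (no e≢0)  = 3η S σ S²≡order S≡1+3σ (k ℕ.* j ℕ.+ log x≢0) e≢0

  null-classify : ∀ j x (d : Dec (x ≡ 𝟘)) → ⟦ d ⟧ ≡ χ null (classify j x d)
  null-classify j x (yes _)  = refl
  null-classify j x (no x≢0) = go ((k ℕ.* j ℕ.+ log x≢0) % 3 ℕₚ.≟ 0)
    where
    go : (d : Dec ((k ℕ.* j ℕ.+ log x≢0) % 3 ≡ 0)) → 0ℤ ≡ χ null (cubicity d)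
    go (yes _) = refl
    go (no _)  = refl

  K-⊖ : ∀ j x → K j (⊖ x) ≡ K j x
  K-⊖ j x = cong (+ 3 *_) (trans (cong H (sym (⊖-distribʳ-⊗ _ x))) (H-⊖ _))

  ∑-K : ∀ j → ∑ elements (K j) ≡ 0ℤ
  ∑-K j = trans (∑-*ˡ elements (+ 3) (λ x → H (α ↑ (k ℕ.* j) ⊗ x))) (cong (+ 3 *_) (∑-H (k ℕ.* j)))

  K-convolution : ∀ i j → i < j → j < 3 → ∀ x → ∑ elements (λ y → K i y * K j (x ⊕ y)) ≡ G * (+ 3 * (+ order * K j x))
  K-convolution i j i<j j<3 x = begin
    ∑ elements (λ y → K i y * K j (x ⊕ y))
      ≡⟨ (∑-cong elements λ y → lem₁ (H (α ↑ (k ℕ.* i) ⊗ y)) (H (α ↑ (k ℕ.* j) ⊗ (x ⊕ y)))) ⟩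
    ∑ elements (λ y → + 9 * (H (α ↑ (k ℕ.* i) ⊗ y) * H (α ↑ (k ℕ.* j) ⊗ (x ⊕ y))))
      ≡⟨ ∑-*ˡ elements (+ 9) (λ y → H (α ↑ (k ℕ.* i) ⊗ y) * H (α ↑ (k ℕ.* j) ⊗ (x ⊕ y))) ⟩
    + 9 * ∑ elements (λ y → H (α ↑ (k ℕ.* i) ⊗ y) * H (α ↑ (k ℕ.* j) ⊗ (x ⊕ y)))
      ≡⟨ cong (+ 9 *_) (trans (H-convolution (k ℕ.* i) (k ℕ.* j) x)
          (cong (_* (r * H (α ↑ (k ℕ.* j) ⊗ x))) (same-class i j i<j j<3))) ⟩
    + 9 * (G * (r * H (α ↑ (k ℕ.* j) ⊗ x)))
      ≡⟨ lem₂ G r (H (α ↑ (k ℕ.* j) ⊗ x)) ⟩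
    G * (+ 3 * (r * K j x)) ∎
    where
    open ≡-Reasoning
    lem₁ : ∀ a b → + 3 * a * (+ 3 * b) ≡ + 9 * (a * b)
    lem₁ = solve-∀
    lem₂ : ∀ G r a → + 9 * (G * (r * a)) ≡ G * (+ 3 * (r * (+ 3 * a)))
    lem₂ = solve-∀

  open Distribution F S G (sym S²≡order) G²≡G K class (λ j x → K-classify j x (x ≟ 𝟘)) (λ j x
      → null-classify j x (x ≟ 𝟘))
    K-⊖ ∑-K K-convolution public using (Φ-values; total; distribution)

  g β : Carrier
  g = α ↑ k
  β = α ↑ R

  β≢𝟙 : β ≢ 𝟙
  β≢𝟙 = <αᵒ⇒≢𝟙 R (ℕ.>-nonZero⁻¹ R) (subst (R <_) (sym αᵒ≡R*3) (ℕₚ.m<m*n R 3 (s≤s (s≤s z≤n))))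

  β³≡𝟙 : β ↑ 3 ≡ 𝟙
  β³≡𝟙 = trans (sym (↑-* α 3 R)) (trans (cong (α ↑_) (trans (ℕₚ.*-comm 3 R) (sym αᵒ≡R*3))) α↑αᵒ≡𝟙)

  -- Multiplication by `β` permutes the three summands, so a nonzero sum could be cancelled to give
  -- `β ≡ 𝟙`.
  β-sum : 𝟙 ⊕ (β ⊕ β ⊗ β) ≡ 𝟘
  β-sum with 𝟙 ⊕ (β ⊕ β ⊗ β) ≟ 𝟘
  ... | yes eq = eq
  ... | no t≢0 = contradiction (⊗-cancelˡ β 𝟙 t≢0 (trans (⊗-comm _ β) (trans β-fixes (sym (⊗-identityʳ _))))) β≢𝟙
    where
    open ≡-Reasoning
    β-fixes : β ⊗ (𝟙 ⊕ (β ⊕ β ⊗ β)) ≡ 𝟙 ⊕ (β ⊕ β ⊗ β)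
    β-fixes = begin
      β ⊗ (𝟙 ⊕ (β ⊕ β ⊗ β))
          ≡⟨ trans (⊗-distribˡ-⊕ β 𝟙 _) (cong₂ _⊕_ (⊗-identityʳ β) (⊗-distribˡ-⊕ β β _)) ⟩
      β ⊕ (β ⊗ β ⊕ β ⊗ (β ⊗ β))          ≡⟨ cong (λ t → β ⊕ (β ⊗ β ⊕ β ⊗ (β ⊗ t))) (sym (⊗-identityʳ β)) ⟩
      β ⊕ (β ⊗ β ⊕ β ↑ 3)                ≡⟨ cong (λ t → β ⊕ (β ⊗ β ⊕ t)) β³≡𝟙 ⟩
      β ⊕ (β ⊗ β ⊕ 𝟙)                    ≡⟨ sym (⊕-assoc β _ 𝟙) ⟩
      β ⊕ β ⊗ β ⊕ 𝟙                      ≡⟨ ⊕-comm _ 𝟙 ⟩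
      𝟙 ⊕ (β ⊕ β ⊗ β)                    ∎

  -- `β` is a cube: its exponent `R = q⁻ v` inherits the factor 3 of `q⁻`.
  K-β : ∀ j x → K j (β ⊗ x) ≡ K j x
  K-β j x = cong (+ 3 *_) (begin
    H (α ↑ (k ℕ.* j) ⊗ (α ↑ R ⊗ x))              ≡⟨ cong H (⊗-leftComm _ _ x) ⟩
    H (α ↑ R ⊗ (α ↑ (k ℕ.* j) ⊗ x))              ≡⟨ cong (λ n → H (α ↑ n ⊗ (α ↑ (k ℕ.* j) ⊗ x))) R≡3l ⟩
    H (α ↑ (3 ℕ.* l) ⊗ (α ↑ (k ℕ.* j) ⊗ x))      ≡⟨ H-α↑3* l _ ⟩
    H (α ↑ (k ℕ.* j) ⊗ x)                        ∎)
    where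
    open ≡-Reasoning
    3∣R : 3 ∣ R
    3∣R = ∣.∣m⇒∣m*n v 3∣q⁻
    l : ℕ
    l = _∣_.quotient 3∣R
    R≡3l : R ≡ 3 ℕ.* l
    R≡3l = trans (_∣_.equality 3∣R) (ℕₚ.*-comm l 3)

  -- What remains of `a gⁱ + b (β g)ⁱ` after `gⁱ` is factored out; as `β³ = 1`, it depends only on
  -- the index modulo 3.
  y : Carrier → Carrier → ℕ → Carrier
  y a b j = a ⊕ b ⊗ β ↑ j

  -- Since 1 + β + β² = 0, the three arguments X, Y = β y₁ and β² y₂ add up to 0.
  module _ (a b : Carrier) where

    private
      X Y : Carrier
      X = a ⊕ b
      Y = β ⊗ (a ⊕ b ⊗ β)

    X⊕Y≡ : X ⊕ Y ≡ ⊖ (β ⊗ (β ⊗ y a b 2))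
    X⊕Y≡ = ⊕-inverseˡ-unique (X ⊕ Y) (β ⊗ (β ⊗ y a b 2)) (begin
      a ⊕ b ⊕ β ⊗ (a ⊕ b ⊗ β) ⊕ β ⊗ (β ⊗ y a b 2)
        ≡⟨ cong₂ _⊕_ (cong₂ _⊕_ (cong (_⊕ b) (sym (⊗-identityʳ a))) (⊗-distribˡ-⊕ β a _)) β²y₂ ⟩
      a ⊗ 𝟙 ⊕ b ⊕ (β ⊗ a ⊕ β ⊗ (b ⊗ β)) ⊕ (a ⊗ (β ⊗ β) ⊕ b ⊗ β)
        ≡⟨ cong (_⊕ (a ⊗ (β ⊗ β) ⊕ b ⊗ β)) (trans (⊕-interchange (a ⊗ 𝟙) b _ _)
             (cong₂ (λ s t → a ⊗ 𝟙 ⊕ s ⊕ t) (⊗-comm β a) (cong₂ _⊕_ (sym (⊗-identityʳ b)) (⊗-leftComm β b β)))) ⟩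
      (a ⊗ 𝟙 ⊕ a ⊗ β) ⊕ (b ⊗ 𝟙 ⊕ b ⊗ (β ⊗ β)) ⊕ (a ⊗ (β ⊗ β) ⊕ b ⊗ β)
        ≡⟨ ⊕-interchange _ _ _ _ ⟩
      (a ⊗ 𝟙 ⊕ a ⊗ β ⊕ a ⊗ (β ⊗ β)) ⊕ (b ⊗ 𝟙 ⊕ b ⊗ (β ⊗ β) ⊕ b ⊗ β)
        ≡⟨ cong₂ _⊕_ (vanish a) (trans (⊕-assoc _ _ _)
            (trans (cong (b ⊗ 𝟙 ⊕_) (⊕-comm _ _)) (trans (sym (⊕-assoc _ _ _)) (vanish b)))) ⟩
      𝟘 ⊕ 𝟘 ≡⟨ ⊕-identityʳ 𝟘 ⟩
      𝟘 ∎)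
      where
      open ≡-Reasoning
      vanish : ∀ c → c ⊗ 𝟙 ⊕ c ⊗ β ⊕ c ⊗ (β ⊗ β) ≡ 𝟘
      vanish c = begin
        c ⊗ 𝟙 ⊕ c ⊗ β ⊕ c ⊗ (β ⊗ β)     ≡⟨ ⊕-assoc _ _ _ ⟩
        c ⊗ 𝟙 ⊕ (c ⊗ β ⊕ c ⊗ (β ⊗ β))   ≡⟨ cong (c ⊗ 𝟙 ⊕_) (sym (⊗-distribˡ-⊕ c β _)) ⟩
        c ⊗ 𝟙 ⊕ c ⊗ (β ⊕ β ⊗ β)         ≡⟨ sym (⊗-distribˡ-⊕ c 𝟙 _) ⟩
        c ⊗ (𝟙 ⊕ (β ⊕ β ⊗ β))           ≡⟨ cong (c ⊗_) β-sum ⟩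
        c ⊗ 𝟘                           ≡⟨ ⊗-zeroʳ c ⟩
        𝟘                               ∎
      β²y₂ : β ⊗ (β ⊗ y a b 2) ≡ a ⊗ (β ⊗ β) ⊕ b ⊗ β
      β²y₂ = begin
        β ⊗ (β ⊗ (a ⊕ b ⊗ β ↑ 2))
            ≡⟨ trans (cong (β ⊗_) (⊗-distribˡ-⊕ β a _)) (⊗-distribˡ-⊕ β _ _) ⟩
        β ⊗ (β ⊗ a) ⊕ β ⊗ (β ⊗ (b ⊗ β ↑ 2))            ≡⟨ cong₂ _⊕_ (trans (sym (⊗-assoc β β a)) (⊗-comm _ a))
                                                            (trans (cong (β ⊗_) (⊗-leftComm β b _))
                                                                (⊗-leftComm β b _)) ⟩
        a ⊗ (β ⊗ β) ⊕ b ⊗ (β ⊗ β ↑ 3)                  ≡⟨ cong (λ t → a ⊗ (β ⊗ β) ⊕ b ⊗ (β ⊗ t)) β³≡𝟙 ⟩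
        a ⊗ (β ⊗ β) ⊕ b ⊗ (β ⊗ 𝟙)                      ≡⟨ cong (λ t → a ⊗ (β ⊗ β) ⊕ b ⊗ t) (⊗-identityʳ β) ⟩
        a ⊗ (β ⊗ β) ⊕ b ⊗ β                            ∎

    K-sum : K 0 (y a b 0) + (K 1 (y a b 1) + K 2 (y a b 2)) ≡ K 0 X + (K 1 Y + K 2 (X ⊕ Y))
    K-sum = cong₂ _+_ (cong (λ t → K 0 (a ⊕ t)) (⊗-identityʳ b)) (cong₂ _+_
      (trans (cong (λ t → K 1 (a ⊕ b ⊗ t)) (⊗-identityʳ β)) (sym (K-β 1 _)))
      (sym (trans (cong (K 2) X⊕Y≡) (trans (K-⊖ 2 _) (trans (K-β 2 _) (K-β 2 _))))))

  -- The substitution of `(X , Y)` for `(a , b)` is made one variable at a time: for fixed `b`, `a`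
  -- is translated into `X = a + b`; for fixed `X`, `Y` is affine in `b` with slope `β (β - 1)`,
  -- which is nonzero.
  ∑∑-y : ∀ Φ → ∑ elements (λ a → ∑ elements (λ b → Φ (K 0 (y a b 0) + (K 1 (y a b 1) + K 2 (y a b 2))))) ≡ total Φ
  ∑∑-y Φ = begin
    ∑ elements (λ a → ∑ elements (λ b → Φ (K 0 (y a b 0) + (K 1 (y a b 1) + K 2 (y a b 2)))))
      ≡⟨ (∑-cong elements λ a → ∑-cong elements λ b → cong Φ (K-sum a b)) ⟩
    ∑ elements (λ a → ∑ elements (λ b → Q (a ⊕ b) (β ⊗ (a ⊕ b ⊗ β))))
      ≡⟨ ∑-swap elements elements (λ a b → Q (a ⊕ b) (β ⊗ (a ⊕ b ⊗ β))) ⟩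
    ∑ elements (λ b → ∑ elements (λ a → Q (a ⊕ b) (β ⊗ (a ⊕ b ⊗ β))))
      ≡⟨ (∑-cong elements λ b → trans (∑-cong elements λ a
          → cong (λ t → Q (a ⊕ b) (β ⊗ (t ⊕ b ⊗ β))) (sym (⊕-⊖-cancel a b)))
           (∑-translate b (λ x → Q x (β ⊗ (x ⊕ ⊖ b ⊕ b ⊗ β))))) ⟩
    ∑ elements (λ b → ∑ elements (λ x → Q x (β ⊗ (x ⊕ ⊖ b ⊕ b ⊗ β))))
      ≡⟨ ∑-swap elements elements (λ b x → Q x (β ⊗ (x ⊕ ⊖ b ⊕ b ⊗ β))) ⟩
    ∑ elements (λ x → ∑ elements (λ b → Q x (β ⊗ (x ⊕ ⊖ b ⊕ b ⊗ β))))
      ≡⟨ (∑-cong elements λ x → trans (∑-cong elements λ b → cong (Q x) (affine x b)) (∑-affine (β ⊗ x) βc≢0 (Q x))) ⟩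
    total Φ ∎
    where
    open ≡-Reasoning
    Q : Carrier → Carrier → ℤ
    Q x y = Φ (K 0 x + (K 1 y + K 2 (x ⊕ y)))
    c : Carrier
    c = β ⊕ ⊖ 𝟙
    βc≢0 : β ⊗ c ≢ 𝟘
    βc≢0 = ⊗≢0 (↑≢0 R α≢0) (λ c≡0 → β≢𝟙 (⊖≡0⇒≡ β 𝟙 c≡0))
    affine : ∀ x b → β ⊗ (x ⊕ ⊖ b ⊕ b ⊗ β) ≡ β ⊗ c ⊗ b ⊕ β ⊗ x
    affine x b = begin
      β ⊗ (x ⊕ ⊖ b ⊕ b ⊗ β)                ≡⟨ cong (β ⊗_) (trans (⊕-assoc x _ _) (⊕-comm x _)) ⟩
      β ⊗ (⊖ b ⊕ b ⊗ β ⊕ x)                ≡⟨ cong (λ t → β ⊗ (t ⊕ x)) (trans (⊕-comm _ _) (cong₂ _⊕_ (⊗-comm b β)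
                                                (trans (cong ⊖_ (sym (⊗-identityˡ b))) (⊖-distribˡ-⊗ 𝟙 b)))) ⟩
      β ⊗ (β ⊗ b ⊕ ⊖ 𝟙 ⊗ b ⊕ x)            ≡⟨ cong (λ t → β ⊗ (t ⊕ x)) (sym (⊗-distribʳ-⊕ b β (⊖ 𝟙))) ⟩
      β ⊗ (c ⊗ b ⊕ x)                      ≡⟨ ⊗-distribˡ-⊕ β _ x ⟩
      β ⊗ (c ⊗ b) ⊕ β ⊗ x                  ≡⟨ cong (_⊕ β ⊗ x) (sym (⊗-assoc β c b)) ⟩
      β ⊗ c ⊗ b ⊕ β ⊗ x                    ∎

  module _ (a b : Carrier) where

    private
      n : ℕ
      n = h ℕ.* (3 ℕ.* v)

      x : ℕ → Carrier
      x i = a ⊗ g ↑ i ⊕ b ⊗ (β ⊗ g) ↑ i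

      x-factor : ∀ i → x i ≡ g ↑ i ⊗ y a b i
      x-factor i = begin
        a ⊗ g ↑ i ⊕ b ⊗ (β ⊗ g) ↑ i           ≡⟨ cong (λ t → a ⊗ g ↑ i ⊕ b ⊗ t) (⊗-↑ β g i) ⟩
        a ⊗ g ↑ i ⊕ b ⊗ (β ↑ i ⊗ g ↑ i)       ≡⟨ cong (a ⊗ g ↑ i ⊕_) (sym (⊗-assoc b _ _)) ⟩
        a ⊗ g ↑ i ⊕ b ⊗ β ↑ i ⊗ g ↑ i         ≡⟨ sym (⊗-distribʳ-⊕ (g ↑ i) a _) ⟩
        y a b i ⊗ g ↑ i                       ≡⟨ ⊗-comm _ _ ⟩
        g ↑ i ⊗ y a b i                       ∎
        where open ≡-Reasoning

      β↑-mod : ∀ i j → β ↑ (i ℕ.* 3 ℕ.+ j) ≡ β ↑ j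
      β↑-mod i j = trans (↑-+ β (i ℕ.* 3) j) (trans (cong (_⊗ β ↑ j) (↑≡1⇒ β i 3 β³≡𝟙)) (⊗-identityˡ _))

      x-split : ∀ i j → x (i ℕ.* 3 ℕ.+ j) ≡ α ↑ (3 ℕ.* (k ℕ.* i)) ⊗ (α ↑ (k ℕ.* j) ⊗ y a b j)
      x-split i j = begin
        x (i ℕ.* 3 ℕ.+ j)                                        ≡⟨ x-factor (i ℕ.* 3 ℕ.+ j) ⟩
        g ↑ (i ℕ.* 3 ℕ.+ j) ⊗ y a b (i ℕ.* 3 ℕ.+ j)
            ≡⟨ cong₂ (λ s t → s ⊗ (a ⊕ b ⊗ t)) (sym (↑-* α (i ℕ.* 3 ℕ.+ j) k)) (β↑-mod i j) ⟩
        α ↑ ((i ℕ.* 3 ℕ.+ j) ℕ.* k) ⊗ y a b j                    ≡⟨ cong (λ e → α ↑ e ⊗ y a b j) (lem i j k) ⟩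
        α ↑ (3 ℕ.* (k ℕ.* i) ℕ.+ k ℕ.* j) ⊗ y a b j
            ≡⟨ cong (_⊗ y a b j) (↑-+ α (3 ℕ.* (k ℕ.* i)) (k ℕ.* j)) ⟩
        α ↑ (3 ℕ.* (k ℕ.* i)) ⊗ α ↑ (k ℕ.* j) ⊗ y a b j          ≡⟨ ⊗-assoc _ _ _ ⟩
        α ↑ (3 ℕ.* (k ℕ.* i)) ⊗ (α ↑ (k ℕ.* j) ⊗ y a b j)        ∎
        where
        open ≡-Reasoning
        lem : ∀ i j k → (i ℕ.* 3 ℕ.+ j) ℕ.* k ≡ 3 ℕ.* (k ℕ.* i) ℕ.+ k ℕ.* j
        lem = ℕ-solve-∀

      -- The index range covers `h` periods of length `v`, and in each of them `i ↦ k i` only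
      -- permutes the terms of `H`.
      ∑-residue : ∀ j → ∑ (upTo (h ℕ.* v)) (λ i → w (x (i ℕ.* 3 ℕ.+ j))) ≡ + h * H (α ↑ (k ℕ.* j) ⊗ y a b j)
      ∑-residue j = begin
        ∑ (upTo (h ℕ.* v)) (λ i → w (x (i ℕ.* 3 ℕ.+ j)))       ≡⟨ (∑-cong (upTo (h ℕ.* v)) λ i → cong w (x-split i j)) ⟩
        ∑ (upTo (h ℕ.* v)) (λ i → f (k ℕ.* i))                 ≡⟨ ∑-periodic-* {v} {λ i → f (k ℕ.* i)} f∘k-periodic h ⟩
        + h * ∑ (upTo v) (λ i → f (k ℕ.* i))
            ≡⟨ cong (+ h *_) (∑-periodic-coprime {v} {f} (w-α↑3-periodic _) k v-k-coprime) ⟩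
        + h * H (α ↑ (k ℕ.* j) ⊗ y a b j)                      ∎
        where
        open ≡-Reasoning
        f : ℕ → ℤ
        f i = w (α ↑ (3 ℕ.* i) ⊗ (α ↑ (k ℕ.* j) ⊗ y a b j))
        f∘k-periodic : Periodic v (λ i → f (k ℕ.* i))
        f∘k-periodic i = trans (cong f (ℕₚ.*-distribˡ-+ k v i)) (periodic-* {v} {f} (w-α↑3-periodic _) k (k ℕ.* i))

      ∑-w-x : ∑ (upTo n) (λ i → w (x i))
          ≡ + h * H (α ↑ (k ℕ.* 0) ⊗ y a b 0)
          + (+ h * H (α ↑ (k ℕ.* 1) ⊗ y a b 1) + (+ h * H (α ↑ (k ℕ.* 2) ⊗ y a b 2) + 0ℤ))
      ∑-w-x = begin
        ∑ (upTo n) (λ i → w (x i))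
            ≡⟨ cong (λ l → ∑ (upTo l) (λ i → w (x i))) (lem h v) ⟩
        ∑ (upTo (h ℕ.* v ℕ.* 3)) (λ i → w (x i))                             ≡⟨ ∑-upTo-* (h ℕ.* v) 3 (λ i → w (x i)) ⟩
        ∑ (upTo (h ℕ.* v)) (λ i → ∑ (upTo 3) (λ j → w (x (i ℕ.* 3 ℕ.+ j))))
            ≡⟨ ∑-swap (upTo (h ℕ.* v)) (upTo 3) (λ i j → w (x (i ℕ.* 3 ℕ.+ j))) ⟩
        ∑ (upTo 3) (λ j → ∑ (upTo (h ℕ.* v)) (λ i → w (x (i ℕ.* 3 ℕ.+ j))))  ≡⟨ ∑-cong (upTo 3) ∑-residue ⟩
        ∑ (upTo 3) (λ j → + h * H (α ↑ (k ℕ.* j) ⊗ y a b j))                 ∎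
        where
        open ≡-Reasoning
        lem : ∀ h v → h ℕ.* (3 ℕ.* v) ≡ h ℕ.* v ℕ.* 3
        lem = ℕ-solve-∀

      W : ℕ
      W = codewordWeight q m n g β a b

      -- Pointwise, `q` times the indicator of a nonzero trace is `q⁻ - w`.
      q*W : + q * + W ≡ + n * + q⁻ - ∑ (upTo n) (λ i → w (x i))
      q*W = begin
        + q * + W
            ≡⟨ cong (+ q *_) (length-filter≡∑ (λ i → ¬? (Tr (x i) ≟ 𝟘)) (upTo n)) ⟩
        + q * ∑ (upTo n) (λ i → ⟦ ¬? (Tr (x i) ≟ 𝟘) ⟧)
            ≡⟨ sym (∑-*ˡ (upTo n) (+ q) (λ i → ⟦ ¬? (Tr (x i) ≟ 𝟘) ⟧)) ⟩
        ∑ (upTo n) (λ i → + q * ⟦ ¬? (Tr (x i) ≟ 𝟘) ⟧)         ≡⟨ (∑-cong (upTo n) λ i → complement (Tr (x i) ≟ 𝟘)) ⟩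
        ∑ (upTo n) (λ i → + q⁻ + - 1ℤ * w (x i))               ≡⟨ ∑-+ (upTo n) (λ _ → + q⁻) (λ i → - 1ℤ * w (x i)) ⟩
        ∑ (upTo n) (λ _ → + q⁻) + ∑ (upTo n) (λ i → - 1ℤ * w (x i))
          ≡⟨ cong₂ _+_ (∑-upTo-const n (+ q⁻)) (trans (∑-*ˡ (upTo n) (- 1ℤ) (λ i → w (x i))) (ℤₚ.-1*i≡-i _)) ⟩
        + n * + q⁻ - ∑ (upTo n) (λ i → w (x i))                ∎
        where
        open ≡-Reasoning
        complement : ∀ {P : Set} (d : Dec P) → + q * ⟦ ¬? d ⟧ ≡ + q⁻ + - 1ℤ * (+ q * ⟦ d ⟧ - 1ℤ)
        complement (yes _) = trans (cong (_* 0ℤ) +q≡1+q⁻)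
            (trans (lem (+ q⁻)) (cong (λ t → + q⁻ + - 1ℤ * (t * 1ℤ - 1ℤ)) (sym +q≡1+q⁻)))
          where
          lem : ∀ t → (1ℤ + t) * 0ℤ ≡ t + - 1ℤ * ((1ℤ + t) * 1ℤ - 1ℤ)
          lem = solve-∀
        complement (no _) = trans (cong (_* 1ℤ) +q≡1+q⁻)
            (trans (lem (+ q⁻)) (cong (λ t → + q⁻ + - 1ℤ * (t * 0ℤ - 1ℤ)) (sym +q≡1+q⁻)))
          where
          lem : ∀ t → (1ℤ + t) * 1ℤ ≡ t + - 1ℤ * ((1ℤ + t) * 0ℤ - 1ℤ)
          lem = solve-∀

    -- The term `3 h (r - 1)` equals `3 n q⁻` and cancels the constant part of `3 q W`, which leaves
    -- three times the sum of `w` over the positions. The order is written `suc αᵒ` so that `r - 1`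
    -- reduces to `αᵒ`.
    scaledLambda≡ : scaledLambda q m n h (suc αᵒ) g β (a , b) ≡ + h * (K 0 (y a b 0) + (K 1 (y a b 1) + K 2 (y a b 2)))
    scaledLambda≡ = begin
      + (3 ℕ.* h ℕ.* αᵒ) - + (3 ℕ.* q ℕ.* W)
        ≡⟨ cong₂ _-_ (pos-*₃ 3 h αᵒ) (trans (pos-*₃ 3 q W) (ℤₚ.*-assoc (+ 3) (+ q) (+ W))) ⟩
      + 3 * + h * + αᵒ - + 3 * (+ q * + W)
        ≡⟨ cong₂ (λ s t → + 3 * + h * s - + 3 * t) (trans (cong +_ (sym 3vq⁻≡αᵒ)) (ℤₚ.pos-* (3 ℕ.* v) q⁻))
             (trans q*W (cong₂ (λ s t → s * + q⁻ - t) (ℤₚ.pos-* h (3 ℕ.* v)) ∑-w-x)) ⟩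
      + 3 * + h * (+ (3 ℕ.* v) * + q⁻) - + 3 * (+ h * + (3 ℕ.* v) * + q⁻ - (+ h * H₀ + (+ h * H₁ + (+ h * H₂ + 0ℤ))))
        ≡⟨ lem (+ h) (+ (3 ℕ.* v)) (+ q⁻) H₀ H₁ H₂ ⟩
      + h * (+ 3 * H₀ + (+ 3 * H₁ + + 3 * H₂)) ∎
      where
      open ≡-Reasoning
      H₀ H₁ H₂ : ℤ
      H₀ = H (α ↑ (k ℕ.* 0) ⊗ y a b 0)
      H₁ = H (α ↑ (k ℕ.* 1) ⊗ y a b 1)
      H₂ = H (α ↑ (k ℕ.* 2) ⊗ y a b 2)
      pos-*₃ : ∀ x y z → + (x ℕ.* y ℕ.* z) ≡ + x * + y * + z
      pos-*₃ x y z = trans (ℤₚ.pos-* (x ℕ.* y) z) (cong (_* + z) (ℤₚ.pos-* x y))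
      lem : ∀ h u q a b c → + 3 * h * (u * q) - + 3 * (h * u * q - (h * a + (h * b + (h * c + 0ℤ))))
          ≡ h * (+ 3 * a + (+ 3 * b + + 3 * c))
      lem = solve-∀

  pairCount≡total : ∀ z → + pairCount q m (h ℕ.* (3 ℕ.* v)) h (suc αᵒ) g β z ≡ total (λ t → ⟦ + h * t ℤ.≟ z ⟧)
  pairCount≡total z = begin
    + pairCount q m (h ℕ.* (3 ℕ.* v)) h (suc αᵒ) g β z
      ≡⟨ length-filter≡∑ (λ ab → scaledLambda q m (h ℕ.* (3 ℕ.* v)) h (suc αᵒ) g β ab ℤ.≟ z)
          (cartesianProduct elements elements) ⟩
    ∑ (cartesianProduct elements elements) (λ ab → ⟦ scaledLambda q m (h ℕ.* (3 ℕ.* v)) h (suc αᵒ) g β ab ℤ.≟ z ⟧)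
      ≡⟨ ∑-cartesianProduct elements elements (λ ab → ⟦ scaledLambda q m (h ℕ.* (3 ℕ.* v)) h (suc αᵒ) g β ab ℤ.≟ z ⟧) ⟩
    ∑ elements (λ a → ∑ elements (λ b → ⟦ scaledLambda q m (h ℕ.* (3 ℕ.* v)) h (suc αᵒ) g β (a , b) ℤ.≟ z ⟧))
      ≡⟨ (∑-cong elements λ a → ∑-cong elements λ b → cong (λ t → ⟦ t ℤ.≟ z ⟧) (scaledLambda≡ a b)) ⟩
    ∑ elements (λ a → ∑ elements (λ b → ⟦ + h * (K 0 (y a b 0) + (K 1 (y a b 1) + K 2 (y a b 2))) ℤ.≟ z ⟧))
      ≡⟨ ∑∑-y (λ t → ⟦ + h * t ℤ.≟ z ⟧) ⟩
    total (λ t → ⟦ + h * t ℤ.≟ z ⟧) ∎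
    where open ≡-Reasoning

-- Matching the class counts with the two tables.

listedCount≡∑ : ∀ t z → listedCount t z ≡ ∑ t (λ (v , c) → c * ⟦ v ℤ.≟ z ⟧)
listedCount≡∑ []            z = refl
listedCount≡∑ ((v , c) ∷ t) z with v ℤ.≟ z
... | yes _ = cong₂ _+_ (sym (ℤₚ.*-identityʳ c)) (listedCount≡∑ t z)
... | no _  = trans (listedCount≡∑ t z) (trans (sym (ℤₚ.+-identityˡ (∑ t (λ (v , c) → c * ⟦ v ℤ.≟ z ⟧))))
                (cong (_+ ∑ t (λ (v , c) → c * ⟦ v ℤ.≟ z ⟧)) (sym (ℤₚ.*-zeroʳ c))))

module _ (h r : ℕ) (S z : ℤ) (r≡S² : + r ≡ S * S) where

  private
    v : Class → Class → Class → ℤ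
    v a b c = + h * (value S a + (value S b + value S c))

    I : Class → Class → Class → ℤ
    I a b c = ⟦ v a b c ℤ.≟ z ⟧

    -- Each line keeps its own indicator, so coinciding values have their counts added and no
    -- distinctness has to be shown.
    seven : (c₁ c₂ c₃ c₄ c₅ c₆ c₇ v₁ v₂ v₃ v₄ v₅ v₆ v₇ : ℤ) → ℤ
    seven c₁ c₂ c₃ c₄ c₅ c₆ c₇ v₁ v₂ v₃ v₄ v₅ v₆ v₇ = c₁ * ⟦ v₁ ℤ.≟ z ⟧ + (c₂ * ⟦ v₂ ℤ.≟ z ⟧ + (c₃ * ⟦ v₃ ℤ.≟ z ⟧
      + (c₄ * ⟦ v₄ ℤ.≟ z ⟧ + (c₅ * ⟦ v₅ ℤ.≟ z ⟧ + (c₆ * ⟦ v₆ ℤ.≟ z ⟧ + (c₇ * ⟦ v₇ ℤ.≟ z ⟧ + 0ℤ))))))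

    seven-cong : ∀ c₁ c₂ c₃ c₄ c₅ c₆ c₇ {v₁ v₂ v₃ v₄ v₅ v₆ v₇ w₁ w₂ w₃ w₄ w₅ w₆ w₇} →
      v₁ ≡ w₁ → v₂ ≡ w₂ → v₃ ≡ w₃ → v₄ ≡ w₄ → v₅ ≡ w₅ → v₆ ≡ w₆ → v₇ ≡ w₇ →
      seven c₁ c₂ c₃ c₄ c₅ c₆ c₇ v₁ v₂ v₃ v₄ v₅ v₆ v₇ ≡ seven c₁ c₂ c₃ c₄ c₅ c₆ c₇ w₁ w₂ w₃ w₄ w₅ w₆ w₇
    seven-cong c₁ c₂ c₃ c₄ c₅ c₆ c₇ refl refl refl refl refl refl refl = refl

    v-ccc : - (+ 3 * + h * (+ 2 * S + + 1)) ≡ v cubic cubic cubic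
    v-ccc = lem (+ h) S
      where
      lem : ∀ H S → - (+ 3 * H * (+ 2 * S + + 1)) ≡ H * ((- 1ℤ - + 2 * S) + ((- 1ℤ - + 2 * S) + (- 1ℤ - + 2 * S)))
      lem = solve-∀
    v-ggg : + 3 * + h * (S - + 1) ≡ v noncubic noncubic noncubic
    v-ggg = lem (+ h) S
      where
      lem : ∀ H S → + 3 * H * (S - + 1) ≡ H * ((S - 1ℤ) + ((S - 1ℤ) + (S - 1ℤ)))
      lem = solve-∀
    v-ccg : - (+ 3 * + h * (S + + 1)) ≡ v cubic cubic noncubic
    v-ccg = lem (+ h) S
      where
      lem : ∀ H S → - (+ 3 * H * (S + + 1)) ≡ H * ((- 1ℤ - + 2 * S) + ((- 1ℤ - + 2 * S) + (S - 1ℤ)))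
      lem = solve-∀
    v-cgg : - (+ 3 * + h) ≡ v cubic noncubic noncubic
    v-cgg = lem (+ h) S
      where
      lem : ∀ H S → - (+ 3 * H) ≡ H * ((- 1ℤ - + 2 * S) + ((S - 1ℤ) + (S - 1ℤ)))
      lem = solve-∀
    v-ncc : + h * (+ r - + 4 * S - + 3) ≡ v null cubic cubic
    v-ncc = trans (cong (λ R → + h * (R - + 4 * S - + 3)) r≡S²) (lem (+ h) S)
      where
      lem : ∀ H S → H * (S * S - + 4 * S - + 3) ≡ H * ((S * S - 1ℤ) + ((- 1ℤ - + 2 * S) + (- 1ℤ - + 2 * S)))
      lem = solve-∀
    v-ngg : + h * (+ r + + 2 * S - + 3) ≡ v null noncubic noncubic
    v-ngg = trans (cong (λ R → + h * (R + + 2 * S - + 3)) r≡S²) (lem (+ h) S)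
      where
      lem : ∀ H S → H * (S * S + + 2 * S - + 3) ≡ H * ((S * S - 1ℤ) + ((S - 1ℤ) + (S - 1ℤ)))
      lem = solve-∀
    v-ncg : + h * (+ r - S - + 3) ≡ v null cubic noncubic
    v-ncg = trans (cong (λ R → + h * (R - S - + 3)) r≡S²) (lem (+ h) S)
      where
      lem : ∀ H S → H * (S * S - S - + 3) ≡ H * ((S * S - 1ℤ) + ((- 1ℤ - + 2 * S) + (S - 1ℤ)))
      lem = solve-∀
    v-nnn : + 3 * + h * (+ r - + 1) ≡ v null null null
    v-nnn = trans (cong (λ R → + 3 * + h * (R - + 1)) r≡S²) (lem (+ h) S)
      where
      lem : ∀ H S → + 3 * H * (S * S - + 1) ≡ H * ((S * S - 1ℤ) + ((S * S - 1ℤ) + (S * S - 1ℤ)))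
      lem = solve-∀

  -- At `G = 1` the pattern null, cubic, noncubic drops out, and for instance `4 r - 11 - 2 S + 9`
  -- becomes `2 (2 r - 1 - S)`.
  distributionSum≡table1 : distributionSum S 1ℤ I ≡ listedCount (table1 h r S) z
  distributionSum≡table1 = sym (begin
    listedCount (table1 h r S) z                              ≡⟨ listedCount≡∑ (table1 h r S) z ⟩
    ∑ (table1 h r S) (λ (v , c) → c * ⟦ v ℤ.≟ z ⟧)
        ≡⟨ seven-cong (C₁ (+ r)) (C₂ (+ r)) (C₃ (+ r)) (C₄ (+ r)) (C₅ (+ r)) (C₆ (+ r)) (+ 27)
                                                                    v-ccc v-ggg v-ccg v-cgg v-ncc v-ngg v-nnn ⟩
    Σ₁ (+ r)                                                  ≡⟨ cong Σ₁ r≡S² ⟩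
    Σ₁ (S * S)
        ≡⟨ lem S (I null null null) (I null cubic cubic) (I null cubic noncubic) (I null noncubic noncubic)
                                                                   (I cubic cubic cubic) (I cubic cubic noncubic)
                                                                       (I cubic noncubic noncubic) (I noncubic
                                                                       noncubic noncubic) ⟩
    distributionSum S 1ℤ I                                    ∎)
    where
    open ≡-Reasoning
    C₁ C₂ C₃ C₄ C₅ C₆ Σ₁ : ℤ → ℤ
    C₁ R = (R - + 1) * (R - + 8 - + 2 * S)
    C₂ R = + 2 * (R - + 1) * (+ 4 * R - + 14 + S)
    C₃ R = + 6 * (R - + 1) * (R - + 2 + S)
    C₄ R = + 6 * (R - + 1) * (+ 2 * R - + 1 - S)
    C₅ R = + 27 * (R - + 1)
    C₆ R = + 54 * (R - + 1)
    Σ₁ R = seven (C₁ R) (C₂ R) (C₃ R) (C₄ R) (C₅ R) (C₆ R) (+ 27) (v cubic cubic cubic)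
        (v noncubic noncubic noncubic) (v cubic cubic noncubic)
      (v cubic noncubic noncubic) (v null cubic cubic) (v null noncubic noncubic) (v null null null)
    lem : ∀ S nnn ncc ncg ngg ccc ccg cgg ggg → 
      ((S * S) - + 1) * ((S * S) - + 8 - + 2 * S) * ccc
          + (+ 2 * ((S * S) - + 1) * (+ 4 * (S * S) - + 14 + S) * ggg
          + (+ 6 * ((S * S) - + 1) * ((S * S) - + 2 + S) * ccg
          + (+ 6 * ((S * S) - + 1) * (+ 2 * (S * S) - + 1 - S) * cgg
          + (+ 27 * ((S * S) - + 1) * ncc + (+ 54 * ((S * S) - + 1) * ngg + (+ 27 * nnn + (0ℤ))))))) ≡
      + 27 * nnn + + 27 * (S * S - 1ℤ) * 1ℤ * ncc + + 54 * (S * S - 1ℤ) * (1ℤ - 1ℤ) * ncg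
          + + 27 * (S * S - 1ℤ) * (1ℤ + 1ℤ) * ngg + (S * S - 1ℤ) * (S * S + 1ℤ - + 2 * S - + 9 * 1ℤ) * ccc
          + + 6 * (S * S - 1ℤ) * (S * S - + 2 + S) * ccg
          + + 3 * (S * S - 1ℤ) * (+ 4 * (S * S) - + 11 - + 2 * S + + 9 * 1ℤ) * cgg
          + + 2 * (S * S - 1ℤ) * (+ 4 * (S * S) - + 5 + S - + 9 * 1ℤ) * ggg
    lem = solve-∀

  -- At `G = 0` the pattern null, cubic, cubic drops out instead.
  distributionSum≡table2 : distributionSum S 0ℤ I ≡ listedCount (table2 h r S) z
  distributionSum≡table2 = sym (begin
    listedCount (table2 h r S) z                              ≡⟨ listedCount≡∑ (table2 h r S) z ⟩
    ∑ (table2 h r S) (λ (v , c) → c * ⟦ v ℤ.≟ z ⟧)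
        ≡⟨ seven-cong (C₁ (+ r)) (C₂ (+ r)) (C₃ (+ r)) (C₄ (+ r)) (C₅ (+ r)) (C₆ (+ r)) (+ 27)
                                                                    v-ccc v-ggg v-ccg v-cgg v-ngg v-ncg v-nnn ⟩
    Σ₂ (+ r)                                                  ≡⟨ cong Σ₂ r≡S² ⟩
    Σ₂ (S * S)
        ≡⟨ lem S (I null null null) (I null cubic cubic) (I null cubic noncubic) (I null noncubic noncubic)
                                                                   (I cubic cubic cubic) (I cubic cubic noncubic)
                                                                       (I cubic noncubic noncubic) (I noncubic
                                                                       noncubic noncubic) ⟩
    distributionSum S 0ℤ I                                    ∎)
    where
    open ≡-Reasoning
    C₁ C₂ C₃ C₄ C₅ C₆ Σ₂ : ℤ → ℤ
    C₁ R = (R - + 1) * (R + + 1 - + 2 * S)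
    C₂ R = + 2 * (R - + 1) * (+ 4 * R - + 5 + S)
    C₃ R = + 6 * (R - + 1) * (R - + 2 + S)
    C₄ R = + 3 * (R - + 1) * (+ 4 * R - + 11 - + 2 * S)
    C₅ R = + 27 * (R - + 1)
    C₆ R = + 54 * (R - + 1)
    Σ₂ R = seven (C₁ R) (C₂ R) (C₃ R) (C₄ R) (C₅ R) (C₆ R) (+ 27) (v cubic cubic cubic)
        (v noncubic noncubic noncubic) (v cubic cubic noncubic)
      (v cubic noncubic noncubic) (v null noncubic noncubic) (v null cubic noncubic) (v null null null)
    lem : ∀ S nnn ncc ncg ngg ccc ccg cgg ggg → 
      ((S * S) - + 1) * ((S * S) + + 1 - + 2 * S) * ccc
          + (+ 2 * ((S * S) - + 1) * (+ 4 * (S * S) - + 5 + S) * ggg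
          + (+ 6 * ((S * S) - + 1) * ((S * S) - + 2 + S) * ccg
          + (+ 3 * ((S * S) - + 1) * (+ 4 * (S * S) - + 11 - + 2 * S) * cgg
          + (+ 27 * ((S * S) - + 1) * ngg + (+ 54 * ((S * S) - + 1) * ncg + (+ 27 * nnn + (0ℤ))))))) ≡
      + 27 * nnn + + 27 * (S * S - 1ℤ) * 0ℤ * ncc + + 54 * (S * S - 1ℤ) * (1ℤ - 0ℤ) * ncg
          + + 27 * (S * S - 1ℤ) * (1ℤ + 0ℤ) * ngg + (S * S - 1ℤ) * (S * S + 1ℤ - + 2 * S - + 9 * 0ℤ) * ccc
          + + 6 * (S * S - 1ℤ) * (S * S - + 2 + S) * ccg
          + + 3 * (S * S - 1ℤ) * (+ 4 * (S * S) - + 11 - + 2 * S + + 9 * 0ℤ) * cgg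
          + + 2 * (S * S - 1ℤ) * (+ 4 * (S * S) - + 5 + S - + 9 * 0ℤ) * ggg
    lem = solve-∀

-- Residues of powers of `p` modulo 3 and the sign of the square root of `r`.

^-%3≡1 : ∀ x → x % 3 ≡ 1 → ∀ n → (x ℕ.^ n) % 3 ≡ 1
^-%3≡1 x x%3≡1 zero    = refl
^-%3≡1 x x%3≡1 (suc n) = trans (%-distribˡ-* x (x ℕ.^ n) 3) (cong₂ (λ a b → (a ℕ.* b) % 3) x%3≡1 (^-%3≡1 x x%3≡1 n))

module _ {p : ℕ} (p%3≡2 : p % 3 ≡ 2) where

  even-power-%3 : ∀ n → (p ℕ.^ (n ℕ.* 2)) % 3 ≡ 1
  even-power-%3 n = trans (cong (_% 3) (trans (cong (p ℕ.^_) (ℕₚ.*-comm n 2)) (sym (ℕₚ.^-*-assoc p 2 n))))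
      (^-%3≡1 (p ℕ.^ 2) p²%3≡1 n)
    where
    p²%3≡1 : (p ℕ.^ 2) % 3 ≡ 1
    p²%3≡1 = trans (cong (λ t → (p ℕ.* t) % 3) (ℕₚ.*-identityʳ p))
        (trans (%-distribˡ-* p p 3) (cong₂ (λ a b → (a ℕ.* b) % 3) p%3≡2 p%3≡2))

  even-power : ∀ n → n % 2 ≡ 0 → (p ℕ.^ n) % 3 ≡ 1
  even-power n even = trans (cong (λ e → (p ℕ.^ e) % 3) (trans (m≡m%n+[m/n]*n n 2) (cong (ℕ._+ n / 2 ℕ.* 2) even)))
      (even-power-%3 (n / 2))

  odd-power : ∀ n → n % 2 ≡ 1 → (p ℕ.^ n) % 3 ≡ 2
  odd-power n odd = trans (cong (λ e → (p ℕ.^ e) % 3) (trans (m≡m%n+[m/n]*n n 2) (cong (ℕ._+ n / 2 ℕ.* 2) odd)))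
    (trans (%-distribˡ-* p (p ℕ.^ (n / 2 ℕ.* 2)) 3) (cong₂ (λ a b → (a ℕ.* b) % 3) p%3≡2 (even-power-%3 (n / 2))))

  -- As `p` is `-1` modulo 3, `p ^ t` is congruent to `(-1) ^ t`, and the sign of `S` is that same
  -- parity. So `S` is always the root congruent to 1 modulo 3.
  epsSqrt-mod-3 : ∀ s m → ∃ λ σ → epsSqrt p s m ≡ 1ℤ + + 3 * σ
  epsSqrt-mod-3 s m with ((m ℕ.* s) / 2) % 2 in eq
  ... | zero = + (p ℕ.^ t / 3) , trans
      (cong +_ (trans (m≡m%n+[m/n]*n (p ℕ.^ t) 3) (cong₂ ℕ._+_ (even-power t eq) (ℕₚ.*-comm (p ℕ.^ t / 3) 3))))
                                   (cong (_+_ 1ℤ) (ℤₚ.pos-* 3 (p ℕ.^ t / 3)))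
    where t = (m ℕ.* s) / 2
  -- The power is `2 + 3 a` here, and `- (2 + 3 a) = 1 + 3 (- 1 - a)`.
  ... | suc zero = - 1ℤ - + (p ℕ.^ t / 3) , trans
      (cong (λ a → - (+ a)) (trans (m≡m%n+[m/n]*n (p ℕ.^ t) 3)
      (cong₂ ℕ._+_ (odd-power t eq) (ℕₚ.*-comm (p ℕ.^ t / 3) 3))))
                                     (trans (cong (λ a → - (+ 2 + a)) (ℤₚ.pos-* 3 (p ℕ.^ t / 3)))
                                         (lem (+ (p ℕ.^ t / 3))))
    where
    t = (m ℕ.* s) / 2
    lem : ∀ a → - (+ 2 + + 3 * a) ≡ 1ℤ + + 3 * (- 1ℤ - a)
    lem = solve-∀
  ... | suc (suc _) = contradiction (subst (_< 2) eq (m%n<n ((m ℕ.* s) / 2) 2)) λ { (s≤s (s≤s ())) }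

  -- An odd power of `p` is 2 modulo 3. Evenness of `s` makes the halving of `m s` exact, so that
  -- `r` is the square of `S`.
  3∣p^s∸1⇒even : ∀ s → 3 ∣ p ℕ.^ s ℕ.∸ 1 → s % 2 ≡ 0
  3∣p^s∸1⇒even s 3∣q⁻ = go (s % 2) refl (m%n<n s 2)
    where
    go : ∀ d → s % 2 ≡ d → d < 2 → d ≡ 0
    go 0 _   _ = refl
    go 1 odd _ = contradiction (trans (sym (odd-power s odd)) q%3≡1) λ ()
      where
      1≤q : 1 ≤ p ℕ.^ s
      1≤q = ℕₚ.m^n>0 p {{ℕ.≢-nonZero λ { refl → contradiction p%3≡2 λ () }}} s
      q%3≡1 : (p ℕ.^ s) % 3 ≡ 1
      q%3≡1 = trans (cong (_% 3) (trans (sym (ℕₚ.m+[n∸m]≡n 1≤q)) (cong (1 ℕ.+_) (_∣_.equality 3∣q⁻))))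
          ([m+kn]%n≡m%n 1 (_∣_.quotient 3∣q⁻) 3)
    go (suc (suc _)) _ (s≤s (s≤s ()))

epsSqrt² : ∀ p s m → epsSqrt p s m * epsSqrt p s m ≡ + (p ℕ.^ ((m ℕ.* s) / 2)) * + (p ℕ.^ ((m ℕ.* s) / 2))
epsSqrt² p s m with ((m ℕ.* s) / 2) % 2
... | zero  = refl
... | suc _ = lem (+ (p ℕ.^ ((m ℕ.* s) / 2)))
  where
  lem : ∀ a → - a * - a ≡ a * a
  lem = solve-∀

epsSqrt²-even : ∀ p s m → s % 2 ≡ 0 → epsSqrt p s m * epsSqrt p s m ≡ + ((p ℕ.^ s) ℕ.^ m)
epsSqrt²-even p s m even = trans (epsSqrt² p s m)
    (trans (sym (ℤₚ.pos-* (p ℕ.^ ((m ℕ.* s) / 2)) (p ℕ.^ ((m ℕ.* s) / 2)))) (cong +_ (begin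
  p ℕ.^ t ℕ.* p ℕ.^ t          ≡⟨ sym (ℕₚ.^-distribˡ-+-* p t t) ⟩
  p ℕ.^ (t ℕ.+ t)              ≡⟨ cong (p ℕ.^_) t+t≡sm ⟩
  p ℕ.^ (s ℕ.* m)              ≡⟨ sym (ℕₚ.^-*-assoc p s m) ⟩
  (p ℕ.^ s) ℕ.^ m              ∎)))
  where
  open ≡-Reasoning
  t : ℕ
  t = (m ℕ.* s) / 2
  ms≡ : m ℕ.* s ≡ m ℕ.* (s / 2) ℕ.* 2
  ms≡ = trans (cong (m ℕ.*_) (trans (m≡m%n+[m/n]*n s 2) (cong (ℕ._+ s / 2 ℕ.* 2) even))) (sym (ℕₚ.*-assoc m (s / 2) 2))
  t+t≡sm : t ℕ.+ t ≡ s ℕ.* m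
  t+t≡sm = begin
    t ℕ.+ t
        ≡⟨ cong (λ a → a ℕ.+ a) (trans (cong (_/ 2) ms≡) (m*n/n≡m (m ℕ.* (s / 2)) 2)) ⟩
    m ℕ.* (s / 2) ℕ.+ m ℕ.* (s / 2)             ≡⟨ lem (m ℕ.* (s / 2)) ⟩
    m ℕ.* (s / 2) ℕ.* 2                         ≡⟨ sym ms≡ ⟩
    m ℕ.* s                                     ≡⟨ ℕₚ.*-comm m s ⟩
    s ℕ.* m                                     ∎
    where
    lem : ∀ a → a ℕ.+ a ≡ a ℕ.* 2
    lem = ℕ-solve-∀

module _ (k : ℕ) where

  same-class-∣ : 3 ∣ k → ∀ i j → i < j → j < 3 → ⟦ (k ℕ.* j) % 3 ℕₚ.≟ (k ℕ.* i) % 3 ⟧ ≡ 1ℤ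
  same-class-∣ 3∣k i j _ _ = ⟦⟧-true ((k ℕ.* j) % 3 ℕₚ.≟ (k ℕ.* i) % 3) (trans (multiple j) (sym (multiple i)))
    where
    multiple : ∀ j → (k ℕ.* j) % 3 ≡ 0
    multiple j = ∣.n∣m⇒m%n≡0 (k ℕ.* j) 3 (∣.∣m⇒∣m*n j 3∣k)

  -- Equal residues would make 3 divide `k (j - i)`, where `j - i` lies strictly between 0 and 3.
  same-class-∤ : ¬ 3 ∣ k → ∀ i j → i < j → j < 3 → ⟦ (k ℕ.* j) % 3 ℕₚ.≟ (k ℕ.* i) % 3 ⟧ ≡ 0ℤ
  same-class-∤ 3∤k i j i<j j<3 = ⟦⟧-false ((k ℕ.* j) % 3 ℕₚ.≟ (k ℕ.* i) % 3) λ eq →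
    go (euclidsLemma k (j ℕ.∸ i) (from-yes (prime? 3)) (subst (3 ∣_) (sym (ℕₚ.*-distribˡ-∸ k j i))
      (≡-mod⇒∣ (k ℕ.* i) (k ℕ.* j) 3 (ℕₚ.*-monoʳ-≤ k (ℕₚ.<⇒≤ i<j)) (sym eq))))
    where
    go : ¬ (3 ∣ k ⊎ 3 ∣ j ℕ.∸ i)
    go (inj₁ 3∣k) = 3∤k 3∣k
    go (inj₂ 3∣d) = ℕₚ.<⇒≱ j<3 (ℕₚ.≤-trans (∣.∣⇒≤ {{ℕ.>-nonZero (ℕₚ.m<n⇒0<n∸m i<j)}} 3∣d) (ℕₚ.m∸n≤m j i))

-- The hypotheses of the theorem turned into those of the counting.

theorem1 : (p s m q r : ℕ) → Prime p → p % 3 ≡ 2 → s ≥ 1 → m ≥ 1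
    → q ≡ p ℕ.^ s → r ≡ q ℕ.^ m
    → (F : FiniteField) → FiniteField.order F ≡ r
    → (α : FiniteField.Carrier F) → FiniteField.IsPrimitive F α
    → (h : ℕ) → h ≥ 1 → h ∣ (q ℕ.∸ 1)
    → 3 ∣ gcd (q ℕ.∸ 1) (h ℕ.* m)
    → (k : ℕ) → k ℕ.* h ≡ q ℕ.∸ 1
    → (u : ℕ) → u ℕ.* (q ℕ.∸ 1) ≡ r ℕ.∸ 1
    → gcd u (3 ℕ.* k) ≡ 3
    → let g = FiniteField._^_ F α k
          β = FiniteField._^_ F α ((r ℕ.∸ 1) / 3)
          n = h ℕ.* u
          S = epsSqrt p s m
          cnt = FiniteField.pairCount F q m n h r g β
      in (3 ∣ k → (z : ℤ) → + 27 ℤ.* + (cnt z) ≡ listedCount (table1 h r S) z)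
         × (¬ (3 ∣ k) → (z : ℤ) → + 27 ℤ.* + (cnt z) ≡ listedCount (table2 h r S) z)
theorem1 p s m _ _ p-prime p%3≡2 s≥1 m≥1 refl refl F order≡ α α-primitive h _ _ 3∣gcd k _ u uq⁻≡ gcd≡3 =
  (λ 3∣k z → trans (cong (+ 27 *_) (cong +_ (cnt≡ z)))
      (counted 1ℤ refl (same-class-∣ k 3∣k) z (distributionSum≡table1 h r S z r≡S²))) ,
  (λ 3∤k z → trans (cong (+ 27 *_) (cong +_ (cnt≡ z)))
      (counted 0ℤ refl (same-class-∤ k 3∤k) z (distributionSum≡table2 h r S z r≡S²)))
  where
  open FieldProperties F
  open PrimitiveElement F α-primitive
  q r : ℕ
  q = p ℕ.^ s
  r = q ℕ.^ m
  3∣u : 3 ∣ u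
  3∣u = subst (_∣ u) gcd≡3 (gcd[m,n]∣m u (3 ℕ.* k))
  v : ℕ
  v = _∣_.quotient 3∣u
  u≡3v : u ≡ 3 ℕ.* v
  u≡3v = trans (_∣_.equality 3∣u) (ℕₚ.*-comm v 3)
  r≡1+αᵒ : r ≡ suc αᵒ
  r≡1+αᵒ = trans (sym order≡) order≡1+αᵒ
  3vq⁻≡αᵒ : 3 ℕ.* v ℕ.* (q ℕ.∸ 1) ≡ αᵒ
  3vq⁻≡αᵒ = trans (cong (ℕ._* (q ℕ.∸ 1)) (sym u≡3v)) (trans uq⁻≡ (cong (ℕ._∸ 1) r≡1+αᵒ))
  3∣q⁻ : 3 ∣ q ℕ.∸ 1
  3∣q⁻ = ∣.∣-trans 3∣gcd (gcd[m,n]∣m (q ℕ.∸ 1) (h ℕ.* m))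
  -- With `u = 3 v`, the hypothesis reads `3 * gcd v k = 3`.
  v-k-coprime : Coprime v k
  v-k-coprime = gcd≡1⇒coprime (ℕₚ.*-cancelˡ-≡ (gcd v k) 1 3
    (trans (c*gcd[m,n]≡gcd[cm,cn] 3 v k) (trans (cong (λ t → gcd t (3 ℕ.* k)) (sym u≡3v)) gcd≡3)))
  S σ : ℤ
  S = epsSqrt p s m
  σ = proj₁ (epsSqrt-mod-3 p%3≡2 s m)
  r≡S² : + r ≡ S * S
  r≡S² = sym (epsSqrt²-even p s m (3∣p^s∸1⇒even p%3≡2 s 3∣q⁻))
  -- A vanishing `S` would make `r = S²` zero, whereas `r` is `suc αᵒ`.
  S³≢0 : ℤ.NonZero (S * S * S)
  S³≢0 = ℤ.≢-nonZero λ S³≡0 → contradiction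
      (trans (sym r≡1+αᵒ) (ℤₚ.+-injective (trans r≡S² (S²≡0 (ℤₚ.i*j≡0⇒i≡0∨j≡0 (S * S) S³≡0))))) λ ()
    where
    S²≡0 : S * S ≡ 0ℤ ⊎ S ≡ 0ℤ → S * S ≡ 0ℤ
    S²≡0 (inj₁ eq) = eq
    S²≡0 (inj₂ eq) = trans (cong (_* S) eq) (ℤₚ.*-zeroˡ S)
  R : ℕ
  R = (q ℕ.∸ 1) ℕ.* v
  R≡ : (r ℕ.∸ 1) / 3 ≡ R
  R≡ = trans (cong (_/ 3) (trans (cong (ℕ._∸ 1) r≡1+αᵒ) (trans (sym 3vq⁻≡αᵒ) (lem v (q ℕ.∸ 1))))) (m*n/n≡m R 3)
    where
    lem : ∀ v q → 3 ℕ.* v ℕ.* q ≡ q ℕ.* v ℕ.* 3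
    lem = ℕ-solve-∀
  -- Length, order and `β` are brought to the shape in which `Code` computes with them.
  cnt≡ : ∀ z → pairCount q m (h ℕ.* u) h r (α ↑ k) (α ↑ ((r ℕ.∸ 1) / 3)) z ≡
               pairCount q m (h ℕ.* (3 ℕ.* v)) h (suc αᵒ) (α ↑ k) (α ↑ R) z
  cnt≡ z = trans (cong₂ (λ u e → pairCount q m (h ℕ.* u) h r (α ↑ k) (α ↑ e) z) u≡3v R≡)
    (cong (λ r → pairCount q m (h ℕ.* (3 ℕ.* v)) h r (α ↑ k) (α ↑ R) z) r≡1+αᵒ)
  counted : ∀ G → G * G ≡ G → (∀ i j → i < j → j < 3 → ⟦ (k ℕ.* j) % 3 ℕₚ.≟ (k ℕ.* i) % 3 ⟧ ≡ G) → ∀ z {t} →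
    distributionSum S G (λ a b c → ⟦ + h * (value S a + (value S b + value S c)) ℤ.≟ z ⟧) ≡ t →
    + 27 * + pairCount q m (h ℕ.* (3 ℕ.* v)) h (suc αᵒ) (α ↑ k) (α ↑ R) z ≡ t
  counted G G²≡G same-class z eq = trans (cong (+ 27 *_) (pairCount≡total z))
      (trans (distribution (λ t → ⟦ + h * t ℤ.≟ z ⟧) {{S³≢0}}) eq)
    where
    open Code F α-primitive p-prime s≥1 m≥1 order≡ p%3≡2 v 3vq⁻≡αᵒ 3∣q⁻ h k v-k-coprime S σ
      (trans (sym r≡S²) (cong +_ (sym order≡))) (proj₂ (epsSqrt-mod-3 p%3≡2 s m)) G G²≡G same-class
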